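{- For independent parameters (indeterminates) $t$ and $s$, $$\mathcal{Y}(z;t)\,\mathcal{Y}(w;s)=F_{t,s}(w/z)\;:\!\mathcal{Y}(z;t)\mathcal{Y}(w;s)\!:\,,$$ where $$F_{t,s}(u)=\exp\Big(-2\sum_{n\ge1,\ n\text{ odd}}\frac{1-s^n}{1-t^n}\frac{u^n}{n}\Big)\in\mathbb{K}[[u]],$$ with $\mathbb{K}=\mathbb{Q}(t,s)$. When $s=t$, $$F_{t,t}(u)=\frac{1-u}{1+u}.$$
   Context: Work over $\mathbb{K}=\mathbb{Q}(t,s)$ and on $\Gamma_{\mathbb{K}}=\mathbb{K}[p_1,p_3,p_5,\ldots]$. For odd $n\ge1$, $a_{ -n}$ is multiplication by $p_n$ and $a_n=\frac n2\frac{\partial}{\partial p_n}$. For a parameter $t$ set $$A_t(z)=\sum_{n\ge1,\ n\text{ odd}}\frac{2(1-t^n)}{n}a_{ -n}z^n,\qquad B_t(z)=-\sum_{n\ge1,\ n\text{ odd}}\frac{2}{n(1-t^n)}a_nz^{ -n},$$ and $\mathcal{Y}(z;t)=e^{A_t(z)}e^{B_t(z)}$, a formal series in $z^{\pm1}$ with coefficients in the linear operators on $\Gamma_{\mathbb{K}}$; $\mathcal{Y}(w;s)$ is defined in the same way with $(z,t)$ replaced by $(w,s)$. The normally ordered product is $$:\!\mathcal{Y}(z;t)\mathcal{Y}(w;s)\!:\;=e^{A_t(z)+A_s(w)}e^{B_t(z)+B_s(w)}.$$ Scalar factors $F_{t,s}(w/z)$ are expanded as formal power series in $w/z$. -}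

module Defs where

open import Algebra.Bundles using (CommutativeRing)
open import Algebra.Bundles.Raw using (RawRing)
import Algebra.Consequences.Setoid as Consequences
import Algebra.Definitions.RawMonoid as RawMonoidDefs
import Algebra.Definitions.RawSemiring as RawSemiringDefs
open import Algebra.Module.Bundles using (LeftModule)
open import Algebra.Module.Morphism.Structures using (module LeftModuleMorphisms)
import Algebra.Module.Morphism.Construct.Composition as Composition
import Algebra.Module.Morphism.Construct.Identity as Identity
import Algebra.Properties.CommutativeSemigroup as CommutativeSemigroupProperties
import Algebra.Properties.CommutativeMonoid.Sum as CommutativeMonoidSum
import Algebra.Properties.Ring as RingProperties
import Algebra.Properties.Semiring.Sum as SemiringSum
import Algebra.Solver.Ring.NaturalCoefficients.Default as SemiringSolver
open import Data.Empty using (⊥-elim)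
open import Data.Fin.Base using (Fin; zero; suc; toℕ)
open import Data.Fin.Properties using (toℕ≤pred[n])
open import Data.Integer.Base as ℤ using (ℤ; +_; -[1+_])
import Data.Integer.Properties as ℤ
open import Data.List.Base using (List; []; _∷_; map)
open import Data.Nat.Base as ℕ using (ℕ; zero; suc; _∸_; _⊔_; _≤_; z≤n; s≤s; _%_; _!)
import Data.Nat.Properties as ℕ
open import Data.Product.Base using (Σ-syntax; _,_; proj₁; proj₂)
open import Data.Rational.Base using (ℚ; 0ℚ; 1ℚ; ≢-nonZero; 1/_)
import Data.Rational.Base as ℚ
import Data.Rational.Properties as ℚ
open import Data.Sum.Base using (_⊎_; inj₁; inj₂)
open import Data.Vec.Base as Vec using (Vec; []; _∷_)
open import Function.Base using (_∘_; id)
open import Level using (Level; 0ℓ) renaming (_⊔_ to _⊔ˡ_; suc to lsuc)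
open import Relation.Binary.Bundles using (Setoid)
open import Relation.Binary.PropositionalEquality as ≡ using (_≡_)
import Relation.Binary.Reasoning.Setoid as SetoidReasoning
open import Relation.Nullary using (Dec; yes; no; ¬_)

private
  variable
    c ℓ : Level

record IntegralDomain c ℓ : Set (lsuc (c ⊔ˡ ℓ)) where
  field
    commutativeRing : CommutativeRing c ℓ
  open CommutativeRing commutativeRing public
  field
    _≟0            : ∀ x → Dec (x ≈ 0#)
    noZeroDivisors : ∀ x y → x * y ≈ 0# → x ≈ 0# ⊎ y ≈ 0#
    1≉0            : ¬ (1# ≈ 0#)

-- Inversion is total, with the convention that the inverse of 0 is 0.
record Field c ℓ : Set (lsuc (c ⊔ˡ ℓ)) where
  infix 9 _⁻¹
  infixl 7 _/_
  field
    commutativeRing : CommutativeRing c ℓ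
  open CommutativeRing commutativeRing public
  field
    _⁻¹     : Carrier → Carrier
    inverse : ∀ x → ¬ (x ≈ 0#) → x * x ⁻¹ ≈ 1#
    0⁻¹≈0   : ∀ x → x ≈ 0# → x ⁻¹ ≈ 0#
    1≉0     : ¬ (1# ≈ 0#)

  open RawSemiringDefs (RawRing.rawSemiring rawRing) public using (_^_)
  open RawMonoidDefs +-rawMonoid using () renaming (_×_ to _times_)

  fromℕ : ℕ → Carrier
  fromℕ n = n times 1#

  _/_ : Carrier → Carrier → Carrier
  x / y = x * y ⁻¹

-- Polynomials are coefficient lists, constant term first; lists that
-- differ by trailing zeros are equal.
module Polynomial (R : CommutativeRing c ℓ) where
  open CommutativeRing R
  private module S = SetoidReasoning setoid
  private module CS = CommutativeSemigroupProperties +-commutativeSemigroup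

  Poly : Set c
  Poly = List Carrier

  coeff : Poly → ℕ → Carrier
  coeff []      _       = 0#
  coeff (a ∷ p) zero    = a
  coeff (a ∷ p) (suc n) = coeff p n

  infix 4 _≋_
  record _≋_ (p q : Poly) : Set ℓ where
    constructor mk
    field at : ∀ n → coeff p n ≈ coeff q n
  open _≋_ public

  infixl 6 _+ₚ_
  infixl 7 _*ₚ_
  infixr 7 _·_

  _+ₚ_ : Poly → Poly → Poly
  []      +ₚ q       = q
  (a ∷ p) +ₚ []      = a ∷ p
  (a ∷ p) +ₚ (b ∷ q) = (a + b) ∷ (p +ₚ q)

  _·_ : Carrier → Poly → Poly
  a · p = map (a *_) p

  -ₚ_ : Poly → Poly
  -ₚ p = map (-_) p

  _*ₚ_ : Poly → Poly → Poly
  []      *ₚ q = []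
  (a ∷ p) *ₚ q = a · q +ₚ (0# ∷ p *ₚ q)

  1ₚ X : Poly
  1ₚ = 1# ∷ []
  X  = 0# ∷ 1# ∷ []

  const : Carrier → Poly
  const a = a ∷ []

  ≋-refl : ∀ {p} → p ≋ p
  ≋-refl = mk λ _ → refl

  ≋-sym : ∀ {p q} → p ≋ q → q ≋ p
  ≋-sym e = mk λ n → sym (at e n)

  ≋-trans : ∀ {p q r} → p ≋ q → q ≋ r → p ≋ r
  ≋-trans e e′ = mk λ n → trans (at e n) (at e′ n)

  polySetoid : Setoid c ℓ
  polySetoid = record
    { Carrier = Poly ; _≈_ = _≋_
    ; isEquivalence = record { refl = ≋-refl ; sym = ≋-sym ; trans = ≋-trans } }

  private module P = SetoidReasoning polySetoid

  coeff-+ : ∀ p q n → coeff (p +ₚ q) n ≈ coeff p n + coeff q n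
  coeff-+ []      q       n       = sym (+-identityˡ _)
  coeff-+ (a ∷ p) []      n       = sym (+-identityʳ _)
  coeff-+ (a ∷ p) (b ∷ q) zero    = refl
  coeff-+ (a ∷ p) (b ∷ q) (suc n) = coeff-+ p q n

  coeff-· : ∀ a p n → coeff (a · p) n ≈ a * coeff p n
  coeff-· a []      n       = sym (zeroʳ a)
  coeff-· a (b ∷ p) zero    = refl
  coeff-· a (b ∷ p) (suc n) = coeff-· a p n

  coeff-neg : ∀ p n → coeff (-ₚ p) n ≈ - coeff p n
  coeff-neg []      n       = sym (RingProperties.-0#≈0# ring)
  coeff-neg (a ∷ p) zero    = refl
  coeff-neg (a ∷ p) (suc n) = coeff-neg p n

  +ₚ-cong : ∀ {p p′ q q′} → p ≋ p′ → q ≋ q′ → p +ₚ q ≋ p′ +ₚ q′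
  +ₚ-cong {p} {p′} {q} {q′} e e′ = mk λ n →
    trans (coeff-+ p q n) (trans (+-cong (at e n) (at e′ n)) (sym (coeff-+ p′ q′ n)))

  +ₚ-assoc : ∀ p q r → (p +ₚ q) +ₚ r ≋ p +ₚ (q +ₚ r)
  +ₚ-assoc p q r = mk λ n → S.begin
    coeff ((p +ₚ q) +ₚ r) n             S.≈⟨ coeff-+ (p +ₚ q) r n ⟩
    coeff (p +ₚ q) n + coeff r n        S.≈⟨ +-congʳ (coeff-+ p q n) ⟩
    coeff p n + coeff q n + coeff r n   S.≈⟨ +-assoc _ _ _ ⟩
    coeff p n + (coeff q n + coeff r n) S.≈⟨ +-congˡ (coeff-+ q r n) ⟨
    coeff p n + coeff (q +ₚ r) n        S.≈⟨ coeff-+ p (q +ₚ r) n ⟨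
    coeff (p +ₚ (q +ₚ r)) n             S.∎

  +ₚ-comm : ∀ p q → p +ₚ q ≋ q +ₚ p
  +ₚ-comm p q = mk λ n →
    trans (coeff-+ p q n) (trans (+-comm _ _) (sym (coeff-+ q p n)))

  +ₚ-identityʳ : ∀ p → p +ₚ [] ≋ p
  +ₚ-identityʳ p = mk λ n → trans (coeff-+ p [] n) (+-identityʳ _)

  -ₚ-cong : ∀ {p q} → p ≋ q → -ₚ p ≋ -ₚ q
  -ₚ-cong {p} {q} e = mk λ n →
    trans (coeff-neg p n) (trans (-‿cong (at e n)) (sym (coeff-neg q n)))

  -ₚ-inverseˡ : ∀ p → (-ₚ p) +ₚ p ≋ []
  -ₚ-inverseˡ p = mk λ n →
    trans (coeff-+ (-ₚ p) p n) (trans (+-congʳ (coeff-neg p n)) (-‿inverseˡ _))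

  +ₚ-interchange : ∀ p q r s → (p +ₚ q) +ₚ (r +ₚ s) ≋ (p +ₚ r) +ₚ (q +ₚ s)
  +ₚ-interchange p q r s = mk λ n →
    trans (expand p q r s n) (trans (CS.interchange _ _ _ _) (sym (expand p r q s n)))
    where
    expand : ∀ p q r s n → coeff ((p +ₚ q) +ₚ (r +ₚ s)) n ≈
             (coeff p n + coeff q n) + (coeff r n + coeff s n)
    expand p q r s n = trans (coeff-+ (p +ₚ q) (r +ₚ s) n)
                             (+-cong (coeff-+ p q n) (coeff-+ r s n))

  +ₚ-swap : ∀ p q r → p +ₚ (q +ₚ r) ≋ q +ₚ (p +ₚ r)
  +ₚ-swap p q r = ≋-trans (≋-sym (+ₚ-assoc p q r))
    (≋-trans (+ₚ-cong (+ₚ-comm p q) ≋-refl) (+ₚ-assoc q p r))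

  ∷-cong : ∀ {a b p q} → a ≈ b → p ≋ q → (a ∷ p) ≋ (b ∷ q)
  ∷-cong e e′ = mk λ { zero → e ; (suc n) → at e′ n }

  ∷-zero : ∀ {a p} → a ≈ 0# → p ≋ [] → (a ∷ p) ≋ []
  ∷-zero e e′ = mk λ { zero → e ; (suc n) → at e′ n }

  tail-cong : ∀ {a b p q} → (a ∷ p) ≋ (b ∷ q) → p ≋ q
  tail-cong e = mk λ n → at e (suc n)

  tail-zero : ∀ {a p} → (a ∷ p) ≋ [] → p ≋ []
  tail-zero e = mk λ n → at e (suc n)

  ·-cong : ∀ {a b p q} → a ≈ b → p ≋ q → a · p ≋ b · q
  ·-cong {a} {b} {p} {q} e e′ = mk λ n →
    trans (coeff-· a p n) (trans (*-cong e (at e′ n)) (sym (coeff-· b q n)))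

  0-· : ∀ {a} p → a ≈ 0# → a · p ≋ []
  0-· {a} p e = mk λ n → trans (coeff-· a p n) (trans (*-congʳ e) (zeroˡ _))

  1-· : ∀ p → 1# · p ≋ p
  1-· p = mk λ n → trans (coeff-· 1# p n) (*-identityˡ _)

  ·-distribʳ : ∀ a b p → (a + b) · p ≋ a · p +ₚ b · p
  ·-distribʳ a b p = mk λ n → S.begin
    coeff ((a + b) · p) n               S.≈⟨ coeff-· (a + b) p n ⟩
    (a + b) * coeff p n                 S.≈⟨ distribʳ _ _ _ ⟩
    a * coeff p n + b * coeff p n       S.≈⟨ +-cong (coeff-· a p n) (coeff-· b p n) ⟨
    coeff (a · p) n + coeff (b · p) n   S.≈⟨ coeff-+ (a · p) (b · p) n ⟨
    coeff (a · p +ₚ b · p) n            S.∎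

  ·-distribˡ : ∀ a p q → a · (p +ₚ q) ≋ a · p +ₚ a · q
  ·-distribˡ a p q = mk λ n → S.begin
    coeff (a · (p +ₚ q)) n              S.≈⟨ coeff-· a (p +ₚ q) n ⟩
    a * coeff (p +ₚ q) n                S.≈⟨ *-congˡ (coeff-+ p q n) ⟩
    a * (coeff p n + coeff q n)         S.≈⟨ distribˡ _ _ _ ⟩
    a * coeff p n + a * coeff q n       S.≈⟨ +-cong (coeff-· a p n) (coeff-· a q n) ⟨
    coeff (a · p) n + coeff (a · q) n   S.≈⟨ coeff-+ (a · p) (a · q) n ⟨
    coeff (a · p +ₚ a · q) n            S.∎

  ·-assoc : ∀ a b p → a · b · p ≋ (a * b) · p
  ·-assoc a b p = mk λ n → S.begin
    coeff (a · b · p) n   S.≈⟨ coeff-· a (b · p) n ⟩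
    a * coeff (b · p) n   S.≈⟨ *-congˡ (coeff-· b p n) ⟩
    a * (b * coeff p n)   S.≈⟨ *-assoc _ _ _ ⟨
    a * b * coeff p n     S.≈⟨ coeff-· (a * b) p n ⟨
    coeff ((a * b) · p) n S.∎

  *ₚ-nullˡ : ∀ p q → p ≋ [] → p *ₚ q ≋ []
  *ₚ-nullˡ []      q e = ≋-refl
  *ₚ-nullˡ (a ∷ p) q e =
    +ₚ-cong (0-· q (at e 0)) (∷-zero refl (*ₚ-nullˡ p q (tail-zero e)))

  *ₚ-zeroʳ : ∀ p → p *ₚ [] ≋ []
  *ₚ-zeroʳ []      = ≋-refl
  *ₚ-zeroʳ (a ∷ p) = ∷-zero refl (*ₚ-zeroʳ p)

  *ₚ-congʳ : ∀ p p′ q → p ≋ p′ → p *ₚ q ≋ p′ *ₚ q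
  *ₚ-congʳ []      p′       q e = ≋-sym (*ₚ-nullˡ p′ q (≋-sym e))
  *ₚ-congʳ (a ∷ p) []       q e = *ₚ-nullˡ (a ∷ p) q e
  *ₚ-congʳ (a ∷ p) (b ∷ p′) q e =
    +ₚ-cong (·-cong (at e 0) ≋-refl) (∷-cong refl (*ₚ-congʳ p p′ q (tail-cong e)))

  *ₚ-distribʳ : ∀ q p p′ → (p +ₚ p′) *ₚ q ≋ p *ₚ q +ₚ p′ *ₚ q
  *ₚ-distribʳ q []      p′       = ≋-refl
  *ₚ-distribʳ q (a ∷ p) []       = ≋-sym (+ₚ-identityʳ _)
  *ₚ-distribʳ q (a ∷ p) (b ∷ p′) = P.begin
    (a + b) · q +ₚ (0# ∷ (p +ₚ p′) *ₚ q)
      P.≈⟨ +ₚ-cong (·-distribʳ a b q)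
                   (∷-cong (sym (+-identityˡ 0#)) (*ₚ-distribʳ q p p′)) ⟩
    (a · q +ₚ b · q) +ₚ ((0# ∷ p *ₚ q) +ₚ (0# ∷ p′ *ₚ q))
      P.≈⟨ +ₚ-interchange (a · q) (b · q) _ _ ⟩
    (a ∷ p) *ₚ q +ₚ (b ∷ p′) *ₚ q P.∎

  ·-*ₚ : ∀ a p q → (a · p) *ₚ q ≋ a · (p *ₚ q)
  ·-*ₚ a []      q = ≋-refl
  ·-*ₚ a (b ∷ p) q = P.begin
    (a * b) · q +ₚ (0# ∷ (a · p) *ₚ q)
      P.≈⟨ +ₚ-cong (≋-sym (·-assoc a b q)) (∷-cong (sym (zeroʳ a)) (·-*ₚ a p q)) ⟩
    a · b · q +ₚ a · (0# ∷ p *ₚ q)   P.≈⟨ ·-distribˡ a (b · q) _ ⟨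
    a · (b · q +ₚ (0# ∷ p *ₚ q))     P.∎

  shift-*ₚ : ∀ p q → (0# ∷ p) *ₚ q ≋ 0# ∷ p *ₚ q
  shift-*ₚ p q = +ₚ-cong (0-· q refl) ≋-refl

  *ₚ-∷ : ∀ q a p → q *ₚ (a ∷ p) ≋ a · q +ₚ (0# ∷ q *ₚ p)
  *ₚ-∷ []      a p = ≋-sym (∷-zero refl ≋-refl)
  *ₚ-∷ (b ∷ q) a p = ∷-cong (+-congʳ (*-comm b a)) (P.begin
    b · p +ₚ q *ₚ (a ∷ p)               P.≈⟨ +ₚ-cong (≋-refl {b · p}) (*ₚ-∷ q a p) ⟩
    b · p +ₚ (a · q +ₚ (0# ∷ q *ₚ p))   P.≈⟨ +ₚ-swap (b · p) (a · q) _ ⟩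
    a · q +ₚ (b · p +ₚ (0# ∷ q *ₚ p))   P.∎)

  *ₚ-comm : ∀ p q → p *ₚ q ≋ q *ₚ p
  *ₚ-comm []      q = ≋-sym (*ₚ-zeroʳ q)
  *ₚ-comm (a ∷ p) q = ≋-trans
    (+ₚ-cong (≋-refl {a · q}) (∷-cong refl (*ₚ-comm p q))) (≋-sym (*ₚ-∷ q a p))

  *ₚ-cong : ∀ {p p′ q q′} → p ≋ p′ → q ≋ q′ → p *ₚ q ≋ p′ *ₚ q′
  *ₚ-cong {p} {p′} {q} {q′} e e′ = P.begin
    p *ₚ q    P.≈⟨ *ₚ-congʳ p p′ q e ⟩
    p′ *ₚ q   P.≈⟨ *ₚ-comm p′ q ⟩
    q *ₚ p′   P.≈⟨ *ₚ-congʳ q q′ p′ e′ ⟩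
    q′ *ₚ p′  P.≈⟨ *ₚ-comm q′ p′ ⟩
    p′ *ₚ q′  P.∎

  *ₚ-assoc : ∀ p q r → (p *ₚ q) *ₚ r ≋ p *ₚ (q *ₚ r)
  *ₚ-assoc []      q r = ≋-refl
  *ₚ-assoc (a ∷ p) q r = P.begin
    (a · q +ₚ (0# ∷ p *ₚ q)) *ₚ r            P.≈⟨ *ₚ-distribʳ r (a · q) _ ⟩
    (a · q) *ₚ r +ₚ (0# ∷ p *ₚ q) *ₚ r       P.≈⟨ +ₚ-cong (·-*ₚ a q r) (shift-*ₚ (p *ₚ q) r) ⟩
    a · (q *ₚ r) +ₚ (0# ∷ (p *ₚ q) *ₚ r)
      P.≈⟨ +ₚ-cong (≋-refl {a · (q *ₚ r)}) (∷-cong refl (*ₚ-assoc p q r)) ⟩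
    a · (q *ₚ r) +ₚ (0# ∷ p *ₚ (q *ₚ r))     P.∎

  *ₚ-identityˡ : ∀ p → 1ₚ *ₚ p ≋ p
  *ₚ-identityˡ p = ≋-trans (+ₚ-cong (1-· p) (∷-zero refl ≋-refl)) (+ₚ-identityʳ p)

  private module C = Consequences polySetoid

  polyRing : CommutativeRing c ℓ
  polyRing = record
    { Carrier = Poly ; _≈_ = _≋_ ; _+_ = _+ₚ_ ; _*_ = _*ₚ_ ; -_ = -ₚ_
    ; 0# = [] ; 1# = 1ₚ
    ; isCommutativeRing = record
      { isRing = record
        { +-isAbelianGroup = record
          { isGroup = record
            { isMonoid = record
              { isSemigroup = record
                { isMagma = record
                  { isEquivalence = Setoid.isEquivalence polySetoid
                  ; ∙-cong = +ₚ-cong }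
                ; assoc = +ₚ-assoc }
              ; identity = C.comm∧idˡ⇒id +ₚ-comm (λ _ → ≋-refl) }
            ; inverse = C.comm∧invˡ⇒inv +ₚ-comm -ₚ-inverseˡ
            ; ⁻¹-cong = -ₚ-cong }
          ; comm = +ₚ-comm }
        ; *-cong = *ₚ-cong
        ; *-assoc = *ₚ-assoc
        ; *-identity = C.comm∧idˡ⇒id *ₚ-comm *ₚ-identityˡ
        ; distrib = C.comm∧distrʳ⇒distr +ₚ-cong *ₚ-comm *ₚ-distribʳ }
      ; *-comm = *ₚ-comm } }

  module _ (_≟0 : ∀ x → Dec (x ≈ 0#))
           (noZeroDivisors : ∀ x y → x * y ≈ 0# → x ≈ 0# ⊎ y ≈ 0#) where

    poly≟0 : ∀ p → Dec (p ≋ [])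
    poly≟0 []      = yes ≋-refl
    poly≟0 (a ∷ p) with a ≟0 | poly≟0 p
    ... | yes e | yes e′ = yes (∷-zero e e′)
    ... | no ¬e | _      = no λ e → ¬e (at e 0)
    ... | _     | no ¬e′ = no λ e → ¬e′ (tail-zero e)

    cancel : ∀ {a} p q → ¬ (a ≈ 0#) → (a ∷ p) *ₚ q ≋ [] → q ≋ []
    cancel     p []      a≉0 e = ≋-refl
    cancel {a} p (b ∷ q) a≉0 e
      with noZeroDivisors a b (trans (sym (+-identityʳ _)) (at e 0))
    ... | inj₁ a≈0 = ⊥-elim (a≉0 a≈0)
    ... | inj₂ b≈0 = ∷-zero b≈0 (cancel p q a≉0 (tail-zero (P.begin
      0# ∷ (a ∷ p) *ₚ q                        P.≈⟨ +ₚ-cong (0-· (a ∷ p) b≈0) ≋-refl ⟨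
      b · (a ∷ p) +ₚ (0# ∷ (a ∷ p) *ₚ q)       P.≈⟨ *ₚ-∷ (a ∷ p) b q ⟨
      (a ∷ p) *ₚ (b ∷ q)                       P.≈⟨ e ⟩
      []                                       P.∎)))

    polyNoZeroDivisors : ∀ p q → p *ₚ q ≋ [] → p ≋ [] ⊎ q ≋ []
    polyNoZeroDivisors []      q e = inj₁ ≋-refl
    polyNoZeroDivisors (a ∷ p) q e with a ≟0
    ... | no a≉0  = inj₂ (cancel p q a≉0 e)
    ... | yes a≈0 with polyNoZeroDivisors p q
                         (tail-zero (≋-trans (≋-sym (+ₚ-cong (0-· q a≈0) ≋-refl)) e))
    ...   | inj₁ p≋0 = inj₁ (∷-zero a≈0 p≋0)
    ...   | inj₂ q≋0 = inj₂ q≋0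

polynomials : IntegralDomain c ℓ → IntegralDomain c ℓ
polynomials D = record
  { commutativeRing = polyRing
  ; _≟0             = poly≟0 _≟0 noZeroDivisors
  ; noZeroDivisors  = polyNoZeroDivisors _≟0 noZeroDivisors
  ; 1≉0             = λ e → 1≉0 (at e 0)
  }
  where
  open IntegralDomain D
  open Polynomial commutativeRing

module Fractions (D : IntegralDomain c ℓ) where
  open IntegralDomain D
  private module S = SetoidReasoning setoid
  private module RS = SemiringSolver commutativeSemiring
  open RS using (solve) renaming (_:=_ to _⊜_; _:+_ to _⊕_; _:*_ to _⊗_)

  record Frac : Set (c ⊔ˡ ℓ) where
    constructor frac
    field
      num   : Carrier
      den   : Carrier
      den≉0 : ¬ (den ≈ 0#)
  open Frac

  infix 4 _≃_
  record _≃_ (x y : Frac) : Set ℓ where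
    constructor mk
    field cross : num x * den y ≈ num y * den x
  open _≃_

  *-≉0 : ∀ {x y} → ¬ (x ≈ 0#) → ¬ (y ≈ 0#) → ¬ (x * y ≈ 0#)
  *-≉0 {x} {y} x≉0 y≉0 e with noZeroDivisors x y e
  ... | inj₁ x≈0 = x≉0 x≈0
  ... | inj₂ y≈0 = y≉0 y≈0

  cancelʳ : ∀ x y z → ¬ (z ≈ 0#) → x * z ≈ y * z → x ≈ y
  cancelʳ x y z z≉0 e with noZeroDivisors (x - y) z (S.begin
      (x - y) * z          S.≈⟨ distribʳ z x (- y) ⟩
      x * z + - y * z      S.≈⟨ +-cong e (sym (RingProperties.-‿distribˡ-* ring y z)) ⟩
      y * z + - (y * z)    S.≈⟨ -‿inverseʳ _ ⟩
      0#                   S.∎)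
  ... | inj₁ x-y≈0 = RingProperties.x∙y⁻¹≈ε⇒x≈y ring x y x-y≈0
  ... | inj₂ z≈0   = ⊥-elim (z≉0 z≈0)

  ≃-refl : ∀ {x} → x ≃ x
  ≃-refl = mk refl

  ≃-sym : ∀ {x y} → x ≃ y → y ≃ x
  ≃-sym e = mk (sym (cross e))

  ≃-trans : ∀ {x y z} → x ≃ y → y ≃ z → x ≃ z
  ≃-trans {frac a b _} {frac c′ d d≉0} {frac e f _} p q =
    mk (cancelʳ (a * f) (e * b) d d≉0 (S.begin
      (a * f) * d    S.≈⟨ solve 3 (λ a f d → ((a ⊗ f) ⊗ d) ⊜ ((a ⊗ d) ⊗ f)) refl a f d ⟩
      (a * d) * f    S.≈⟨ *-congʳ (cross p) ⟩
      (c′ * b) * f   S.≈⟨ solve 3 (λ c b f → ((c ⊗ b) ⊗ f) ⊜ ((c ⊗ f) ⊗ b)) refl c′ b f ⟩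
      (c′ * f) * b   S.≈⟨ *-congʳ (cross q) ⟩
      (e * d) * b    S.≈⟨ solve 3 (λ e d b → ((e ⊗ d) ⊗ b) ⊜ ((e ⊗ b) ⊗ d)) refl e d b ⟩
      (e * b) * d    S.∎))

  fracSetoid : Setoid (c ⊔ˡ ℓ) ℓ
  fracSetoid = record
    { Carrier = Frac ; _≈_ = _≃_
    ; isEquivalence = record { refl = ≃-refl ; sym = ≃-sym ; trans = ≃-trans } }

  infixl 6 _+ᶠ_
  infixl 7 _*ᶠ_

  embed : Carrier → Frac
  embed x = frac x 1# 1≉0

  _+ᶠ_ : Frac → Frac → Frac
  frac a b b≉0 +ᶠ frac c′ d d≉0 = frac (a * d + c′ * b) (b * d) (*-≉0 b≉0 d≉0)

  _*ᶠ_ : Frac → Frac → Frac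
  frac a b b≉0 *ᶠ frac c′ d d≉0 = frac (a * c′) (b * d) (*-≉0 b≉0 d≉0)

  -ᶠ_ : Frac → Frac
  -ᶠ frac a b b≉0 = frac (- a) b b≉0

  invᶠ : Frac → Frac
  invᶠ (frac a b b≉0) with a ≟0
  ... | yes _   = embed 0#
  ... | no  a≉0 = frac b a a≉0

  +ᶠ-cong : ∀ {x x′ y y′} → x ≃ x′ → y ≃ y′ → x +ᶠ y ≃ x′ +ᶠ y′
  +ᶠ-cong {frac a b _} {frac a′ b′ _} {frac c′ d _} {frac c″ d′ _} p q = mk (S.begin
    (a * d + c′ * b) * (b′ * d′)
      S.≈⟨ solve 6 (λ a b b′ c d d′ →
             ((a ⊗ d ⊕ c ⊗ b) ⊗ (b′ ⊗ d′)) ⊜ ((a ⊗ b′) ⊗ (d ⊗ d′) ⊕ (c ⊗ d′) ⊗ (b ⊗ b′)))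
           refl a b b′ c′ d d′ ⟩
    (a * b′) * (d * d′) + (c′ * d′) * (b * b′)
      S.≈⟨ +-cong (*-congʳ (cross p)) (*-congʳ (cross q)) ⟩
    (a′ * b) * (d * d′) + (c″ * d) * (b * b′)
      S.≈⟨ solve 6 (λ a b b′ c d d′ →
             ((a ⊗ b) ⊗ (d ⊗ d′) ⊕ (c ⊗ d) ⊗ (b ⊗ b′)) ⊜ ((a ⊗ d′ ⊕ c ⊗ b′) ⊗ (b ⊗ d)))
           refl a′ b b′ c″ d d′ ⟩
    (a′ * d′ + c″ * b′) * (b * d) S.∎)

  *ᶠ-cong : ∀ {x x′ y y′} → x ≃ x′ → y ≃ y′ → x *ᶠ y ≃ x′ *ᶠ y′
  *ᶠ-cong {frac a b _} {frac a′ b′ _} {frac c′ d _} {frac c″ d′ _} p q = mk (S.begin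
    (a * c′) * (b′ * d′)
      S.≈⟨ solve 4 (λ a b′ c d′ → ((a ⊗ c) ⊗ (b′ ⊗ d′)) ⊜ ((a ⊗ b′) ⊗ (c ⊗ d′)))
           refl a b′ c′ d′ ⟩
    (a * b′) * (c′ * d′)  S.≈⟨ *-cong (cross p) (cross q) ⟩
    (a′ * b) * (c″ * d)
      S.≈⟨ solve 4 (λ a b c d → ((a ⊗ b) ⊗ (c ⊗ d)) ⊜ ((a ⊗ c) ⊗ (b ⊗ d)))
           refl a′ b c″ d ⟩
    (a′ * c″) * (b * d)   S.∎)

  -ᶠ-cong : ∀ {x y} → x ≃ y → -ᶠ x ≃ -ᶠ y
  -ᶠ-cong {frac a b _} {frac c′ d _} p = mk (S.begin
    - a * d     S.≈⟨ RingProperties.-‿distribˡ-* ring a d ⟨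
    - (a * d)   S.≈⟨ -‿cong (cross p) ⟩
    - (c′ * b)  S.≈⟨ RingProperties.-‿distribˡ-* ring c′ b ⟩
    - c′ * b    S.∎)

  +ᶠ-assoc : ∀ x y z → (x +ᶠ y) +ᶠ z ≃ x +ᶠ (y +ᶠ z)
  +ᶠ-assoc (frac a b _) (frac c′ d _) (frac e f _) = mk (solve 6 (λ a b c d e f →
    (((a ⊗ d ⊕ c ⊗ b) ⊗ f ⊕ e ⊗ (b ⊗ d)) ⊗ (b ⊗ (d ⊗ f))) ⊜
    ((a ⊗ (d ⊗ f) ⊕ (c ⊗ f ⊕ e ⊗ d) ⊗ b) ⊗ ((b ⊗ d) ⊗ f))) refl a b c′ d e f)

  +ᶠ-comm : ∀ x y → x +ᶠ y ≃ y +ᶠ x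
  +ᶠ-comm (frac a b _) (frac c′ d _) = mk (solve 4 (λ a b c d →
    ((a ⊗ d ⊕ c ⊗ b) ⊗ (d ⊗ b)) ⊜ ((c ⊗ b ⊕ a ⊗ d) ⊗ (b ⊗ d))) refl a b c′ d)

  +ᶠ-identityˡ : ∀ x → embed 0# +ᶠ x ≃ x
  +ᶠ-identityˡ (frac a b _) = mk (*-cong
    (trans (+-cong (zeroˡ b) (*-identityʳ a)) (+-identityˡ a)) (sym (*-identityˡ b)))

  -ᶠ-inverseˡ : ∀ x → (-ᶠ x) +ᶠ x ≃ embed 0#
  -ᶠ-inverseˡ (frac a b _) = mk (S.begin
    (- a * b + a * b) * 1#  S.≈⟨ *-identityʳ _ ⟩
    - a * b + a * b         S.≈⟨ distribʳ b (- a) a ⟨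
    (- a + a) * b           S.≈⟨ *-congʳ (-‿inverseˡ a) ⟩
    0# * b                  S.≈⟨ zeroˡ b ⟩
    0#                      S.≈⟨ zeroˡ _ ⟨
    0# * (b * b)            S.∎)

  *ᶠ-assoc : ∀ x y z → (x *ᶠ y) *ᶠ z ≃ x *ᶠ (y *ᶠ z)
  *ᶠ-assoc (frac a b _) (frac c′ d _) (frac e f _) =
    mk (*-cong (*-assoc a c′ e) (sym (*-assoc b d f)))

  *ᶠ-comm : ∀ x y → x *ᶠ y ≃ y *ᶠ x
  *ᶠ-comm (frac a b _) (frac c′ d _) = mk (*-cong (*-comm a c′) (*-comm d b))

  *ᶠ-identityˡ : ∀ x → embed 1# *ᶠ x ≃ x
  *ᶠ-identityˡ (frac a b _) = mk (*-cong (*-identityˡ a) (sym (*-identityˡ b)))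

  *ᶠ-distribʳ : ∀ x y z → (y +ᶠ z) *ᶠ x ≃ y *ᶠ x +ᶠ z *ᶠ x
  *ᶠ-distribʳ (frac e f _) (frac a b _) (frac c′ d _) = mk (solve 6 (λ a b c d e f →
    (((a ⊗ d ⊕ c ⊗ b) ⊗ e) ⊗ ((b ⊗ f) ⊗ (d ⊗ f))) ⊜
    (((a ⊗ e) ⊗ (d ⊗ f) ⊕ (c ⊗ e) ⊗ (b ⊗ f)) ⊗ ((b ⊗ d) ⊗ f))) refl a b c′ d e f)

  num≈0 : ∀ {x} → x ≃ embed 0# → num x ≈ 0#
  num≈0 {frac a b _} p = trans (sym (*-identityʳ a)) (trans (cross p) (zeroˡ b))

  invᶠ-inverse : ∀ x → ¬ (x ≃ embed 0#) → x *ᶠ invᶠ x ≃ embed 1#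
  invᶠ-inverse (frac a b b≉0) x≉0 with a ≟0
  ... | yes a≈0 = ⊥-elim (x≉0 (mk (trans (*-identityʳ a) (trans a≈0 (sym (zeroˡ b))))))
  ... | no  a≉0 = mk (trans (*-identityʳ _) (trans (*-comm a b) (sym (*-identityˡ _))))

  invᶠ-zero : ∀ x → x ≃ embed 0# → invᶠ x ≃ embed 0#
  invᶠ-zero (frac a b b≉0) p with a ≟0
  ... | yes _   = ≃-refl
  ... | no  a≉0 = ⊥-elim (a≉0 (num≈0 p))

  private module C = Consequences fracSetoid

  fractionField : Field (c ⊔ˡ ℓ) ℓ
  fractionField = record
    { commutativeRing = record
      { Carrier = Frac ; _≈_ = _≃_ ; _+_ = _+ᶠ_ ; _*_ = _*ᶠ_ ; -_ = -ᶠ_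
      ; 0# = embed 0# ; 1# = embed 1#
      ; isCommutativeRing = record
        { isRing = record
          { +-isAbelianGroup = record
            { isGroup = record
              { isMonoid = record
                { isSemigroup = record
                  { isMagma = record
                    { isEquivalence = Setoid.isEquivalence fracSetoid
                    ; ∙-cong = +ᶠ-cong }
                  ; assoc = +ᶠ-assoc }
                ; identity = C.comm∧idˡ⇒id +ᶠ-comm {e = embed 0#} +ᶠ-identityˡ }
              ; inverse = C.comm∧invˡ⇒inv {_⁻¹ = -ᶠ_} {e = embed 0#} +ᶠ-comm -ᶠ-inverseˡ
              ; ⁻¹-cong = -ᶠ-cong }
            ; comm = +ᶠ-comm }
          ; *-cong = *ᶠ-cong
          ; *-assoc = *ᶠ-assoc
          ; *-identity = C.comm∧idˡ⇒id *ᶠ-comm {e = embed 1#} *ᶠ-identityˡ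
          ; distrib = C.comm∧distrʳ⇒distr +ᶠ-cong *ᶠ-comm *ᶠ-distribʳ }
        ; *-comm = *ᶠ-comm } }
    ; _⁻¹     = invᶠ
    ; inverse = invᶠ-inverse
    ; 0⁻¹≈0   = invᶠ-zero
    ; 1≉0     = λ p → 1≉0 (num≈0 p)
    }

rationals : IntegralDomain 0ℓ 0ℓ
rationals = record
  { commutativeRing = ℚ.+-*-commutativeRing
  ; _≟0             = λ x → x ℚ.≟ 0ℚ
  ; noZeroDivisors  = noZeroDivisors
  ; 1≉0             = λ ()
  }
  where
  noZeroDivisors : ∀ x y → x ℚ.* y ≡ 0ℚ → x ≡ 0ℚ ⊎ y ≡ 0ℚ
  noZeroDivisors x y xy≡0 with x ℚ.≟ 0ℚ
  ... | yes x≡0 = inj₁ x≡0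
  ... | no  x≢0 = inj₂ (begin
    y                     ≡⟨ ℚ.*-identityˡ y ⟨
    1ℚ ℚ.* y              ≡⟨ ≡.cong (ℚ._* y) (ℚ.*-inverseˡ x) ⟨
    (1/ x) ℚ.* x ℚ.* y    ≡⟨ ℚ.*-assoc (1/ x) x y ⟩
    (1/ x) ℚ.* (x ℚ.* y)  ≡⟨ ≡.cong ((1/ x) ℚ.*_) xy≡0 ⟩
    (1/ x) ℚ.* 0ℚ         ≡⟨ ℚ.*-zeroʳ (1/ x) ⟩
    0ℚ                    ∎)
    where
    open ≡.≡-Reasoning
    instance _ = ≢-nonZero x≢0

ℚ[t] ℚ[t][s] : IntegralDomain 0ℓ 0ℓ
ℚ[t]    = polynomials rationals
ℚ[t][s] = polynomials ℚ[t]

-- The rational function field ℚ(t,s).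
ℚ⟨t,s⟩ : Field 0ℓ 0ℓ
ℚ⟨t,s⟩ = Fractions.fractionField ℚ[t][s]

t s : Field.Carrier ℚ⟨t,s⟩
t = Fractions.embed ℚ[t][s]
      (Polynomial.const (IntegralDomain.commutativeRing ℚ[t])
        (Polynomial.X (IntegralDomain.commutativeRing rationals)))
s = Fractions.embed ℚ[t][s] (Polynomial.X (IntegralDomain.commutativeRing ℚ[t]))

-- Formal power series in d variables, commuting with each other and with
-- the coefficients. R may be non-commutative; K acts on it by scalars. A
-- series maps an exponent vector to its coefficient.
module Series (K : Field c ℓ) {r ρ : Level} (R : RawRing r ρ)
              (_·_ : Field.Carrier K → RawRing.Carrier R → RawRing.Carrier R) where
  open RawRing R
  private module K = Field K
  open RawMonoidDefs +-rawMonoid using (sum)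

  Power : ℕ → Set r
  Power d = Vec ℕ d → Carrier

  -- convolve x α is the sum of x β γ over all β + γ = α.
  convolve : ∀ {d} → (Vec ℕ d → Vec ℕ d → Carrier) → Vec ℕ d → Carrier
  convolve x []      = x [] []
  convolve x (n ∷ α) =
    sum {suc n} (λ i → convolve (λ β γ → x (toℕ i ∷ β) ((n ∸ toℕ i) ∷ γ)) α)

  one : ∀ {d} → Power d
  one []          = 1#
  one (zero  ∷ α) = one α
  one (suc _ ∷ _) = 0#

  seriesRing : ℕ → RawRing r ρ
  seriesRing d = record
    { Carrier = Power d
    ; _≈_     = λ C D → ∀ α → C α ≈ D α
    ; _+_     = λ C D α → C α + D α
    ; _*_     = λ C D → convolve (λ β γ → C β * D γ)
    ; -_      = λ C α → - C α
    ; 0#      = λ _ → 0#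
    ; 1#      = one
    }

  infix  4 _≈ˢ_
  infixl 6 _+ˢ_ _-ˢ_
  infixl 7 _/ˢ_

  _≈ˢ_ : ∀ {d} → Power d → Power d → Set ρ
  _≈ˢ_ {d} = RawRing._≈_ (seriesRing d)

  _+ˢ_ _-ˢ_ _/ˢ_ : ∀ {d} → Power d → Power d → Power d
  _+ˢ_ {d} = RawRing._+_ (seriesRing d)
  C -ˢ D   = C +ˢ RawRing.-_ (seriesRing _) D

  private module PS {d} = RawSemiringDefs (RawRing.rawSemiring (seriesRing d))

  expTerm : ∀ {d} → Power d → Vec ℕ d → ℕ → Carrier
  expTerm C α k = (K.1# K./ K.fromℕ (k !)) · (C PS.^ k) α

  -- The sum over k of C ^ k / k!, for C without constant term: then the
  -- coefficient of C ^ k at α vanishes when k exceeds the total degree.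
  exp : ∀ {d} → Power d → Power d
  exp C α = sum {suc (Vec.sum α)} (λ k → expTerm C α (toℕ k))

  -- Division by a series D with constant term 1: the reciprocal of D is
  -- the geometric series of 1 - D.
  reciprocal : ∀ {d} → Power d → Power d
  reciprocal D α = sum {suc (Vec.sum α)} (λ k → ((one -ˢ D) PS.^ toℕ k) α)

  _/ˢ_ {d} C D = RawRing._*_ (seriesRing d) C (reciprocal D)

  indeterminate : Power 1
  indeterminate (1 ∷ []) = 1#
  indeterminate (_ ∷ []) = 0#

  in-z in-w : Power 1 → Power 2
  in-z C (m ∷ zero  ∷ []) = C (m ∷ [])
  in-z C (m ∷ suc _ ∷ []) = 0#
  in-w C (zero  ∷ l ∷ []) = C (l ∷ [])
  in-w C (suc _ ∷ l ∷ []) = 0#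

Odd : ℕ → Set
Odd n = n % 2 ≡ 1

-- The series with coefficient cₙ at odd n and z at even n.
overOdd : ∀ {a} {A : Set a} → A → ((n : ℕ) → .(Odd n) → A) → Vec ℕ 1 → A
overOdd z c (n ∷ []) with n % 2 ℕ.≟ 1
... | yes odd = c n odd
... | no  _   = z

-- Γ = K[p₁, p₃, p₅, …] is presented as the free commutative K-algebra on
-- the pₙ: terms modulo the congruence generated by the algebra laws.
module Fock (K : Field c ℓ) where
  private module K = Field K
  open K using () renaming (Carrier to 𝕂)

  infixl 6 _+_
  infixl 7 _*_

  data Γ : Set c where
    con     : 𝕂 → Γ
    p       : (n : ℕ) → .(Odd n) → Γ
    _+_ _*_ : Γ → Γ → Γ

  infix 4 _≈_
  data _≈_ : Γ → Γ → Set (c ⊔ˡ ℓ) where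
    refl        : ∀ {f} → f ≈ f
    sym         : ∀ {f g} → f ≈ g → g ≈ f
    trans       : ∀ {f g h} → f ≈ g → g ≈ h → f ≈ h
    con-cong    : ∀ {x y} → x K.≈ y → con x ≈ con y
    +-cong      : ∀ {f f′ g g′} → f ≈ f′ → g ≈ g′ → f + g ≈ f′ + g′
    *-cong      : ∀ {f f′ g g′} → f ≈ f′ → g ≈ g′ → f * g ≈ f′ * g′
    con-+       : ∀ x y → con (x K.+ y) ≈ con x + con y
    con-*       : ∀ x y → con (x K.* y) ≈ con x * con y
    +-assoc     : ∀ f g h → (f + g) + h ≈ f + (g + h)
    +-comm      : ∀ f g → f + g ≈ g + f
    +-identityˡ : ∀ f → con K.0# + f ≈ f
    *-assoc     : ∀ f g h → (f * g) * h ≈ f * (g * h)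
    *-comm      : ∀ f g → f * g ≈ g * f
    *-identityˡ : ∀ f → con K.1# * f ≈ f
    zeroˡ       : ∀ f → con K.0# * f ≈ con K.0#
    distribʳ    : ∀ h f g → (f + g) * h ≈ f * h + g * h

  0Γ 1Γ : Γ
  0Γ = con K.0#
  1Γ = con K.1#

  -Γ_ : Γ → Γ
  -Γ f = con (K.- K.1#) * f

  Γ-setoid : Setoid c (c ⊔ˡ ℓ)
  Γ-setoid = record
    { Carrier = Γ ; _≈_ = _≈_
    ; isEquivalence = record { refl = refl ; sym = sym ; trans = trans } }

  private module C = Consequences Γ-setoid
  private module S = SetoidReasoning Γ-setoid

  -Γ-inverseˡ : ∀ f → (-Γ f) + f ≈ 0Γ
  -Γ-inverseˡ f = S.begin
    con (K.- K.1#) * f + f            S.≈⟨ +-cong refl (*-identityˡ f) ⟨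
    con (K.- K.1#) * f + 1Γ * f       S.≈⟨ distribʳ f _ _ ⟨
    (con (K.- K.1#) + 1Γ) * f         S.≈⟨ *-cong (con-+ _ _) refl ⟨
    con (K.- K.1# K.+ K.1#) * f       S.≈⟨ *-cong (con-cong (K.-‿inverseˡ K.1#)) refl ⟩
    0Γ * f                            S.≈⟨ zeroˡ f ⟩
    0Γ                                S.∎

  Γ-ring : CommutativeRing c (c ⊔ˡ ℓ)
  Γ-ring = record
    { Carrier = Γ ; _≈_ = _≈_ ; _+_ = _+_ ; _*_ = _*_ ; -_ = -Γ_
    ; 0# = 0Γ ; 1# = 1Γ
    ; isCommutativeRing = record
      { isRing = record
        { +-isAbelianGroup = record
          { isGroup = record
            { isMonoid = record
              { isSemigroup = record
                { isMagma = record
                  { isEquivalence = Setoid.isEquivalence Γ-setoid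
                  ; ∙-cong = +-cong }
                ; assoc = +-assoc }
              ; identity = C.comm∧idˡ⇒id +-comm +-identityˡ }
            ; inverse = C.comm∧invˡ⇒inv +-comm -Γ-inverseˡ
            ; ⁻¹-cong = *-cong refl }
          ; comm = +-comm }
        ; *-cong = *-cong
        ; *-assoc = *-assoc
        ; *-identity = C.comm∧idˡ⇒id *-comm *-identityˡ
        ; distrib = C.comm∧distrʳ⇒distr +-cong *-comm distribʳ }
      ; *-comm = *-comm } }

  private module G = CommutativeRing Γ-ring
  private module CS = CommutativeSemigroupProperties G.*-commutativeSemigroup
  private module CS⁺ = CommutativeSemigroupProperties G.+-commutativeSemigroup

  infixr 7 _*ₗ_
  _*ₗ_ : 𝕂 → Γ → Γ
  x *ₗ f = con x * f

  Γ-module : LeftModule K.ring c (c ⊔ˡ ℓ)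
  Γ-module = record
    { Carrierᴹ = Γ ; _≈ᴹ_ = _≈_ ; _+ᴹ_ = _+_ ; _*ₗ_ = _*ₗ_ ; 0ᴹ = 0Γ ; -ᴹ_ = -Γ_
    ; isLeftModule = record
      { isLeftSemimodule = record
        { +ᴹ-isCommutativeMonoid = G.+-isCommutativeMonoid
        ; isPreleftSemimodule = record
          { *ₗ-cong      = λ e e′ → *-cong (con-cong e) e′
          ; *ₗ-zeroˡ     = zeroˡ
          ; *ₗ-distribʳ  = λ f x y → trans (*-cong (con-+ x y) refl) (distribʳ f _ _)
          ; *ₗ-identityˡ = *-identityˡ
          ; *ₗ-assoc     = λ x y f → trans (*-cong (con-* x y) refl) (*-assoc _ _ f)
          ; *ₗ-zeroʳ     = λ x → G.zeroʳ (con x)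
          ; *ₗ-distribˡ  = λ x → G.distribˡ (con x) } }
      ; -ᴹ‿cong    = G.-‿cong
      ; -ᴹ‿inverse = G.-‿inverse } }

  M = LeftModule.rawLeftModule Γ-module
  open LeftModuleMorphisms M M using (IsLeftModuleHomomorphism)

  record Operator : Set (c ⊔ˡ ℓ) where
    no-eta-equality
    constructor operator
    field
      ⟦_⟧      : Γ → Γ
      isLinear : IsLeftModuleHomomorphism ⟦_⟧
    open IsLeftModuleHomomorphism isLinear public
      using () renaming (⟦⟧-cong to cong; +ᴹ-homo to +-homo; *ₗ-homo to ·-homo; 0ᴹ-homo to 0-homo)
  open Operator using (⟦_⟧)

  abstract
    isLinearMap : (φ : Γ → Γ) → (∀ {f g} → f ≈ g → φ f ≈ φ g) →
                  (∀ f g → φ (f + g) ≈ φ f + φ g) →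
                  (∀ x f → φ (x *ₗ f) ≈ x *ₗ φ f) → IsLeftModuleHomomorphism φ
    isLinearMap φ cong +-homo ·-homo = record
      { +ᴹ-isGroupHomomorphism = record
        { isMonoidHomomorphism = record
          { isMagmaHomomorphism = record
            { isRelHomomorphism = record { cong = cong }
            ; homo = +-homo }
          ; ε-homo = S.begin
              φ 0Γ                 S.≈⟨ cong (zeroˡ 0Γ) ⟨
              φ (K.0# *ₗ 0Γ)       S.≈⟨ ·-homo K.0# 0Γ ⟩
              K.0# *ₗ φ 0Γ         S.≈⟨ zeroˡ _ ⟩
              0Γ                   S.∎ }
        ; ⁻¹-homo = ·-homo (K.- K.1#) }
      ; *ₗ-homo = ·-homo }

  linear : (φ : Γ → Γ) → (∀ {f g} → f ≈ g → φ f ≈ φ g) →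
           (∀ f g → φ (f + g) ≈ φ f + φ g) →
           (∀ x f → φ (x *ₗ f) ≈ x *ₗ φ f) → Operator
  linear φ cong +-homo ·-homo = operator φ (isLinearMap φ cong +-homo ·-homo)

  infixr 9 _∘ᵒ_
  infixr 7 _·_

  _∘ᵒ_ : Operator → Operator → Operator
  Φ ∘ᵒ Ψ = operator (⟦ Φ ⟧ ∘ ⟦ Ψ ⟧)
    (Composition.isLeftModuleHomomorphism {M₁ = M} {M₂ = M} {M₃ = M} trans
      (Operator.isLinear Ψ) (Operator.isLinear Φ))

  idᵒ 0ᵒ : Operator
  idᵒ = operator id (Identity.isLeftModuleHomomorphism M refl)
  0ᵒ  = linear (λ _ → 0Γ) (λ _ → refl) (λ _ _ → sym (+-identityˡ 0Γ))
               (λ x _ → sym (G.zeroʳ (con x)))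

  _+ᵒ_ : Operator → Operator → Operator
  Φ +ᵒ Ψ = linear (λ f → ⟦ Φ ⟧ f + ⟦ Ψ ⟧ f)
    (λ e → +-cong (Φ.cong e) (Ψ.cong e))
    (λ f g → trans (+-cong (Φ.+-homo f g) (Ψ.+-homo f g)) (CS⁺.interchange _ _ _ _))
    (λ x f → trans (+-cong (Φ.·-homo x f) (Ψ.·-homo x f)) (sym (G.distribˡ (con x) _ _)))
    where
    module Φ = Operator Φ
    module Ψ = Operator Ψ

  _·_ : 𝕂 → Operator → Operator
  x · Φ = linear (λ f → x *ₗ ⟦ Φ ⟧ f)
    (λ e → *-cong refl (Φ.cong e))
    (λ f g → trans (*-cong refl (Φ.+-homo f g)) (G.distribˡ (con x) _ _))
    (λ y f → trans (*-cong refl (Φ.·-homo y f)) (CS.x∙yz≈y∙xz _ _ _))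
    where
    module Φ = Operator Φ

  infix 4 _≈ᵒ_
  _≈ᵒ_ : Operator → Operator → Set (c ⊔ˡ ℓ)
  Φ ≈ᵒ Ψ = ∀ f → ⟦ Φ ⟧ f ≈ ⟦ Ψ ⟧ f

  operatorRing : RawRing (c ⊔ˡ ℓ) (c ⊔ˡ ℓ)
  operatorRing = record
    { Carrier = Operator ; _≈_ = _≈ᵒ_ ; _+_ = _+ᵒ_ ; _*_ = _∘ᵒ_
    ; -_ = (K.- K.1#) ·_ ; 0# = 0ᵒ ; 1# = idᵒ }

  multiply : Γ → Operator
  multiply h = linear (h *_) (*-cong refl) (G.distribˡ h) (λ x f → CS.x∙yz≈y∙xz h (con x) f)

  ∂ : ℕ → Γ → Γ
  ∂ n (con x) = 0Γ
  ∂ n (p m _) with m ℕ.≟ n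
  ... | yes _ = 1Γ
  ... | no  _ = 0Γ
  ∂ n (f + g) = ∂ n f + ∂ n g
  ∂ n (f * g) = ∂ n f * g + f * ∂ n g

  ∂-con* : ∀ n x f → ∂ n (x *ₗ f) ≈ x *ₗ ∂ n f
  ∂-con* n x f = trans (+-cong (zeroˡ f) refl) (+-identityˡ _)

  ∂-cong : ∀ n {f g} → f ≈ g → ∂ n f ≈ ∂ n g
  ∂-cong n refl = refl
  ∂-cong n (sym e) = sym (∂-cong n e)
  ∂-cong n (trans e e′) = trans (∂-cong n e) (∂-cong n e′)
  ∂-cong n (con-cong _) = refl
  ∂-cong n (+-cong e e′) = +-cong (∂-cong n e) (∂-cong n e′)
  ∂-cong n (*-cong e e′) =
    +-cong (*-cong (∂-cong n e) e′) (*-cong e (∂-cong n e′))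
  ∂-cong n (con-+ x y) = sym (+-identityˡ 0Γ)
  ∂-cong n (con-* x y) =
    sym (trans (+-cong (zeroˡ (con y)) (G.zeroʳ (con x))) (+-identityˡ 0Γ))
  ∂-cong n (+-assoc f g h) = +-assoc _ _ _
  ∂-cong n (+-comm f g) = +-comm _ _
  ∂-cong n (+-identityˡ f) = +-identityˡ _
  ∂-cong n (*-assoc f g h) = S.begin
    (∂ n f * g + f * ∂ n g) * h + (f * g) * ∂ n h
      S.≈⟨ +-cong (distribʳ h _ _) refl ⟩
    ((∂ n f * g) * h + (f * ∂ n g) * h) + (f * g) * ∂ n h
      S.≈⟨ +-cong (+-cong (*-assoc _ _ _) (*-assoc _ _ _)) (*-assoc _ _ _) ⟩
    (∂ n f * (g * h) + f * (∂ n g * h)) + f * (g * ∂ n h)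
      S.≈⟨ +-assoc _ _ _ ⟩
    ∂ n f * (g * h) + (f * (∂ n g * h) + f * (g * ∂ n h))
      S.≈⟨ +-cong refl (G.distribˡ f _ _) ⟨
    ∂ n f * (g * h) + f * (∂ n g * h + g * ∂ n h) S.∎
  ∂-cong n (*-comm f g) =
    trans (+-comm _ _) (+-cong (*-comm _ _) (*-comm _ _))
  ∂-cong n (*-identityˡ f) = trans (∂-con* n K.1# f) (*-identityˡ _)
  ∂-cong n (zeroˡ f) = trans (∂-con* n K.0# f) (zeroˡ _)
  ∂-cong n (distribʳ h f g) =
    trans (+-cong (distribʳ h _ _) (distribʳ _ f g)) (CS⁺.interchange _ _ _ _)

  derivative : ℕ → Operator
  derivative n = linear (∂ n) (∂-cong n) (λ _ _ → refl) (∂-con* n)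

  a₋ : (n : ℕ) → .(Odd n) → Operator
  a₋ n odd = multiply (p n odd)

  a₊ : ℕ → Operator
  a₊ n = (K.fromℕ n K./ K.fromℕ 2) · derivative n

  open CommutativeMonoidSum G.+-commutativeMonoid using (sum; sum-cong-≋; ∑-distrib-+)
  open SemiringSum G.semiring using (*-distribˡ-sum)

  -- A locally finite sum is cut off at N; by box-stable any larger cut-off
  -- gives the same value.
  LocallyFinite : ∀ {d} → (Vec ℕ d → Operator) → Set (c ⊔ˡ ℓ)
  LocallyFinite Φ = ∀ f → Σ[ N ∈ ℕ ] (∀ β → N ≤ Vec.sum β → ⟦ Φ β ⟧ f ≈ 0Γ)

  -- The sum of x β over β in {0, …, N - 1} ^ d.
  box : ∀ {d} → ℕ → (Vec ℕ d → Γ) → Γ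
  box {zero}  N x = x []
  box {suc d} N x = sum {N} (λ i → box N (λ β → x (toℕ i ∷ β)))

  box-cong : ∀ {d} N {x y : Vec ℕ d → Γ} → (∀ β → x β ≈ y β) → box N x ≈ box N y
  box-cong {zero}  N e = e []
  box-cong {suc d} N e = sum-cong-≋ {N} (λ i → box-cong N (λ β → e (toℕ i ∷ β)))

  box-+ : ∀ {d} N (x y : Vec ℕ d → Γ) → box N (λ β → x β + y β) ≈ box N x + box N y
  box-+ {zero}  N x y = refl
  box-+ {suc d} N x y = trans
    (sum-cong-≋ {N} (λ i → box-+ N (λ β → x (toℕ i ∷ β)) (λ β → y (toℕ i ∷ β))))
    (∑-distrib-+ {N} _ _)

  box-· : ∀ {d} N k (x : Vec ℕ d → Γ) → box N (λ β → k *ₗ x β) ≈ k *ₗ box N x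
  box-· {zero}  N k x = refl
  box-· {suc d} N k x = trans
    (sum-cong-≋ {N} (λ i → box-· N k (λ β → x (toℕ i ∷ β))))
    (sym (*-distribˡ-sum {N} (con k) _))

  sum-zero : ∀ N (x : ℕ → Γ) → (∀ i → x i ≈ 0Γ) → sum {N} (λ i → x (toℕ i)) ≈ 0Γ
  sum-zero zero    x e = refl
  sum-zero (suc N) x e =
    trans (+-cong (e 0) (sum-zero N (λ i → x (suc i)) (λ i → e (suc i)))) (+-identityˡ 0Γ)

  sum-stable : ∀ {N M} → N ≤ M → (x : ℕ → Γ) → (∀ i → N ≤ i → x i ≈ 0Γ) →
               sum {M} (λ i → x (toℕ i)) ≈ sum {N} (λ i → x (toℕ i))
  sum-stable {M = M} z≤n x e = sum-zero M x (λ i → e i z≤n)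
  sum-stable (s≤s N≤M) x e =
    +-cong refl (sum-stable N≤M (λ i → x (suc i)) (λ i N≤i → e (suc i) (s≤s N≤i)))

  box-zero : ∀ {d} N (x : Vec ℕ d → Γ) → (∀ β → x β ≈ 0Γ) → box N x ≈ 0Γ
  box-zero {zero}  N x e = e []
  box-zero {suc d} N x e = sum-zero N (λ i → box N (λ β → x (i ∷ β)))
    (λ i → box-zero N (λ β → x (i ∷ β)) (λ β → e (i ∷ β)))

  box-stable : ∀ {d N M} → N ≤ M → (x : Vec ℕ d → Γ) →
               (∀ β → N ≤ Vec.sum β → x β ≈ 0Γ) → box M x ≈ box N x
  box-stable {zero}          N≤M x e = refl
  box-stable {suc d} {N} {M} N≤M x e = trans
    (sum-cong-≋ {M} (λ i → box-stable N≤M (λ β → x (toℕ i ∷ β))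
      (λ β N≤β → e (toℕ i ∷ β) (ℕ.≤-trans N≤β (ℕ.m≤n+m (Vec.sum β) (toℕ i))))))
    (sum-stable N≤M (λ i → box N (λ β → x (i ∷ β))) (λ i N≤i →
      box-zero N (λ β → x (i ∷ β))
        (λ β → e (i ∷ β) (ℕ.≤-trans N≤i (ℕ.m≤m+n i (Vec.sum β))))))

  ∑ : ∀ {d} (Φ : Vec ℕ d → Operator) → LocallyFinite Φ → Operator
  ∑ Φ fin = linear (λ f → box (N f) (λ β → ⟦ Φ β ⟧ f))
    (λ {f} {g} e → let M = N f ⊔ N g in S.begin
      box (N f) (at f)   S.≈⟨ upTo M f (ℕ.m≤m⊔n _ _) ⟨
      box M (at f)       S.≈⟨ box-cong M (λ β → Operator.cong (Φ β) e) ⟩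
      box M (at g)       S.≈⟨ upTo M g (ℕ.m≤n⊔m (N f) _) ⟩
      box (N g) (at g)   S.∎)
    (λ f g → let M = N (f + g) ⊔ (N f ⊔ N g) in S.begin
      box (N (f + g)) (at (f + g))
        S.≈⟨ upTo M (f + g) (ℕ.m≤m⊔n _ _) ⟨
      box M (at (f + g))
        S.≈⟨ box-cong M (λ β → Operator.+-homo (Φ β) f g) ⟩
      box M (λ β → at f β + at g β)
        S.≈⟨ box-+ M (at f) (at g) ⟩
      box M (at f) + box M (at g)
        S.≈⟨ +-cong
               (upTo M f (ℕ.≤-trans (ℕ.m≤m⊔n (N f) _) (ℕ.m≤n⊔m (N (f + g)) _)))
               (upTo M g (ℕ.≤-trans (ℕ.m≤n⊔m (N f) _) (ℕ.m≤n⊔m (N (f + g)) _))) ⟩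
      box (N f) (at f) + box (N g) (at g) S.∎)
    (λ x f → let M = N (x *ₗ f) ⊔ N f in S.begin
      box (N (x *ₗ f)) (at (x *ₗ f))   S.≈⟨ upTo M (x *ₗ f) (ℕ.m≤m⊔n _ _) ⟨
      box M (at (x *ₗ f))              S.≈⟨ box-cong M (λ β → Operator.·-homo (Φ β) x f) ⟩
      box M (λ β → x *ₗ at f β)        S.≈⟨ box-· M x (at f) ⟩
      x *ₗ box M (at f)
        S.≈⟨ *-cong refl (upTo M f (ℕ.m≤n⊔m (N (x *ₗ f)) _)) ⟩
      x *ₗ box (N f) (at f)            S.∎)
    where
    N : Γ → ℕ
    N f = proj₁ (fin f)
    at : Γ → Vec ℕ _ → Γ
    at f β = ⟦ Φ β ⟧ f
    upTo : ∀ M f → N f ≤ M → box M (at f) ≈ box (N f) (at f)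
    upTo M f N≤M = box-stable N≤M (at f) (proj₂ (fin f))

  ∑-zero : ∀ {d} (Φ : Vec ℕ d → Operator) (fin : LocallyFinite Φ) f →
           (∀ β → ⟦ Φ β ⟧ f ≈ 0Γ) → ⟦ ∑ Φ fin ⟧ f ≈ 0Γ
  ∑-zero Φ fin f e = box-zero (proj₁ (fin f)) (λ β → ⟦ Φ β ⟧ f) e

  -- Below d f: f is a sum of monomials of weight less than d, where pₙ has
  -- weight n. Local finiteness holds because aₙ lowers the weight by n.
  data Below : ℕ → Γ → Set (c ⊔ˡ ℓ) where
    zeroᵇ : ∀ {d} → Below d 0Γ
    conᵇ  : ∀ x → Below 1 (con x)
    pᵇ    : ∀ n .(odd : Odd n) → Below (suc n) (p n odd)
    _+ᵇ_  : ∀ {d f g} → Below d f → Below d g → Below d (f + g)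
    _*ᵇ_  : ∀ {d e f g} → Below (suc d) f → Below (suc e) g → Below (suc (d ℕ.+ e)) (f * g)
    resp  : ∀ {d f g} → f ≈ g → Below d f → Below d g
    mono  : ∀ {d e f} → d ≤ e → Below d f → Below e f

  below-0 : ∀ {d f} → Below d f → d ≤ 0 → f ≈ 0Γ
  below-0 zeroᵇ _ = refl
  below-0 (b +ᵇ b′) le = trans (+-cong (below-0 b le) (below-0 b′ le)) (+-identityˡ 0Γ)
  below-0 (resp e b) le = trans (sym e) (below-0 b le)
  below-0 (mono d≤e b) le = below-0 b (ℕ.≤-trans d≤e le)

  weight : ∀ f → Σ[ d ∈ ℕ ] Below (suc d) f
  weight (con x) = 0 , conᵇ x
  weight (p n odd) = n , pᵇ n odd
  weight (f + g) with weight f | weight g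
  ... | d , b | e , b′ = d ⊔ e ,
    (mono (s≤s (ℕ.m≤m⊔n d e)) b +ᵇ mono (s≤s (ℕ.m≤n⊔m d e)) b′)
  weight (f * g) with weight f | weight g
  ... | d , b | e , b′ = d ℕ.+ e , (b *ᵇ b′)

  record Lowers (r : ℕ) (Φ : Operator) : Set (c ⊔ˡ ℓ) where
    constructor lowers
    field lower : ∀ {d f} → Below d f → Below (d ∸ r) (⟦ Φ ⟧ f)
  open Lowers

  castᵇ : ∀ {d e f} → d ≡ e → Below d f → Below e f
  castᵇ ≡.refl b = b

  below-· : ∀ {d f} x → Below d f → Below d (x *ₗ f)
  below-· {zero}  x b = resp (trans (sym (G.zeroʳ (con x))) (*-cong refl (sym (below-0 b z≤n)))) zeroᵇ
  below-· {suc d} x b = conᵇ x *ᵇ b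

  below-* : ∀ {e g} n d {f} → Below (suc d ∸ n) f → Below (suc e) g →
            Below (suc (d ℕ.+ e) ∸ n) (f * g)
  below-* {e} {g} n d b b′ with n ℕ.≤? d
  ... | yes n≤d = castᵇ
    (≡.trans (≡.cong suc (≡.sym (ℕ.+-∸-comm e n≤d)))
             (≡.sym (ℕ.+-∸-assoc 1 (ℕ.≤-trans n≤d (ℕ.m≤m+n d e)))))
    (castᵇ (ℕ.+-∸-assoc 1 n≤d) b *ᵇ b′)
  ... | no n≰d = resp
    (sym (trans (*-cong (below-0 b (ℕ.≤-reflexive (ℕ.m≤n⇒m∸n≡0 (ℕ.≰⇒> n≰d)))) refl) (zeroˡ g)))
    zeroᵇ

  ∂-lowers : ∀ n → ∀ {d f} → Below d f → Below (d ∸ n) (∂ n f)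
  ∂-lowers n zeroᵇ = zeroᵇ
  ∂-lowers n (conᵇ x) = zeroᵇ
  ∂-lowers n (pᵇ m odd) with m ℕ.≟ n
  ... | yes ≡.refl = ≡.subst (λ k → Below k 1Γ) (≡.sym (ℕ.m+n∸n≡m 1 n)) (conᵇ K.1#)
  ... | no _ = zeroᵇ
  ∂-lowers n (b +ᵇ b′) = ∂-lowers n b +ᵇ ∂-lowers n b′
  ∂-lowers n (_*ᵇ_ {d} {e} {f} {g} b b′) =
    below-* n d (∂-lowers n b) b′ +ᵇ
    resp (*-comm _ _) (≡.subst (λ k → Below (suc k ∸ n) (∂ n g * f)) (ℕ.+-comm e d)
      (below-* n e (∂-lowers n b′) b))
  ∂-lowers n (resp e b) = resp (∂-cong n e) (∂-lowers n b)
  ∂-lowers n (mono d≤e b) = mono (ℕ.∸-monoˡ-≤ n d≤e) (∂-lowers n b)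

  0-lowers : ∀ {r} → Lowers r 0ᵒ
  0-lowers = lowers λ _ → zeroᵇ

  ∘-lowers : ∀ {r r′} Φ Ψ → Lowers r Φ → Lowers r′ Ψ → Lowers (r ℕ.+ r′) (Φ ∘ᵒ Ψ)
  ∘-lowers {r} {r′} Φ Ψ l l′ = lowers λ {d} b →
    castᵇ
      (≡.trans (ℕ.∸-+-assoc d r′ r) (≡.cong (d ∸_) (ℕ.+-comm r′ r))) (lower l (lower l′ b))

  +-lowers : ∀ {r} Φ Ψ → Lowers r Φ → Lowers r Ψ → Lowers r (Φ +ᵒ Ψ)
  +-lowers Φ Ψ l l′ = lowers λ b → lower l b +ᵇ lower l′ b

  ·-lowers : ∀ {r} x Φ → Lowers r Φ → Lowers r (x · Φ)
  ·-lowers x Φ l = lowers λ b → below-· x (lower l b)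

  module Scalar = Series K K.rawRing K._*_
  module Op     = Series K operatorRing _·_

  sumᵒ : ∀ {n} → (Fin n → Operator) → Operator
  sumᵒ = RawMonoidDefs.sum (RawRing.+-rawMonoid operatorRing)

  sum-lowers : ∀ {r} n {Φ : Fin n → Operator} → (∀ i → Lowers r (Φ i)) → Lowers r (sumᵒ Φ)
  sum-lowers zero        l = 0-lowers
  sum-lowers (suc n) {Φ} l =
    +-lowers (Φ zero) (sumᵒ (λ i → Φ (suc i))) (l zero) (sum-lowers n (λ i → l (suc i)))

  convolve-lowers : ∀ {d r} (x : Vec ℕ d → Vec ℕ d → Operator) α →
    (∀ β γ → Vec.sum β ℕ.+ Vec.sum γ ≡ Vec.sum α → Lowers r (x β γ)) →
    Lowers r (Op.convolve x α)
  convolve-lowers x []      l = l [] [] ≡.refl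
  convolve-lowers x (n ∷ α) l = sum-lowers (suc n) (λ i →
    convolve-lowers (λ β γ → x (toℕ i ∷ β) ((n ∸ toℕ i) ∷ γ)) α (λ β γ e →
      l (toℕ i ∷ β) ((n ∸ toℕ i) ∷ γ)
        (≡.trans (interchange (toℕ i) (Vec.sum β) (n ∸ toℕ i) (Vec.sum γ))
          (≡.cong₂ ℕ._+_ (ℕ.m+[n∸m]≡n (toℕ≤pred[n] i)) e))))
    where
    interchange = CommutativeSemigroupProperties.interchange ℕ.+-commutativeSemigroup

  Lowering : ∀ {d} → Op.Power d → Set (c ⊔ˡ ℓ)
  Lowering G = ∀ α → Lowers (Vec.sum α) (G α)

  private module PS {d} = RawSemiringDefs (RawRing.rawSemiring (Op.seriesRing d))

  one-lowering : ∀ {d} → Lowering (Op.one {d})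
  one-lowering []          = lowers id
  one-lowering (zero  ∷ α) = one-lowering α
  one-lowering (suc _ ∷ _) = 0-lowers

  ^-lowering : ∀ {d} (G : Op.Power d) → Lowering G → ∀ k → Lowering (G PS.^ k)
  ^-lowering G l zero    = one-lowering
  ^-lowering G l (suc k) α =
    convolve-lowers (λ β γ → G β ∘ᵒ (G PS.^ k) γ) α (λ β γ e →
      ≡.subst (λ r → Lowers r (G β ∘ᵒ (G PS.^ k) γ)) e
        (∘-lowers (G β) ((G PS.^ k) γ) (l β) (^-lowering G l k γ)))

  exp-lowering : ∀ {d} (G : Op.Power d) → Lowering G → Lowering (Op.exp G)
  exp-lowering G l α =
    sum-lowers (suc (Vec.sum α)) {λ k → Op.expTerm G α (toℕ k)} (λ k →
      ·-lowers (K.1# K./ K.fromℕ (toℕ k !)) ((G PS.^ toℕ k) α) (^-lowering G l (toℕ k) α))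

  lowering-finite : ∀ {d} {G : Op.Power d} → Lowering G → LocallyFinite G
  lowering-finite {G = G} l f with weight f
  ... | d , b = suc d , λ β d≤β →
    below-0 (lower (l β) b) (ℕ.≤-reflexive (ℕ.m≤n⇒m∸n≡0 d≤β))

  -- Formal series in z₁^±1, …, z_d^±1; a vector of integers indexes the
  -- coefficient of the corresponding Laurent monomial.
  Distribution : ℕ → Set (c ⊔ˡ ℓ)
  Distribution d = Vec ℤ d → Operator

  infix 4 _≈ᴰ_
  _≈ᴰ_ : ∀ {d} → Distribution d → Distribution d → Set (c ⊔ˡ ℓ)
  D ≈ᴰ E = ∀ a → D a ≈ᵒ E a

  -- Coefficients at exponents with a negative entry are zero.
  extend : ∀ {d} → Op.Power d → Distribution d
  extend C []             = C []
  extend C (+ n      ∷ a) = extend (λ α → C (n ∷ α)) a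
  extend C (-[1+ _ ] ∷ a) = 0ᵒ

  infixl 6 _⊞_
  _⊞_ : ∀ {d} → Vec ℤ d → Vec ℕ d → Vec ℤ d
  a ⊞ β = Vec.zipWith (λ i n → i ℤ.+ + n) a β

  product-finite : ∀ {d} (E G : Op.Power d) → LocallyFinite G →
                   ∀ a → LocallyFinite (λ β → extend E (a ⊞ β) ∘ᵒ G β)
  product-finite E G fin a f = proj₁ (fin f) , λ β N≤β →
    trans (Operator.cong (extend E (a ⊞ β)) (proj₂ (fin f) β N≤β))
          (Operator.0-homo (extend E (a ⊞ β)))

  -- The product E(z) G(z⁻¹), z = (z₁, …, z_d): the coefficient of z^a is the
  -- sum over β of E_{a+β} ∘ G_β.
  product± : ∀ {d} (E G : Op.Power d) → LocallyFinite G → Distribution d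
  product± E G fin a = ∑ (λ β → extend E (a ⊞ β) ∘ᵒ G β) (product-finite E G fin a)

  infixl 7 _⊗_
  _⊗_ : Distribution 1 → Distribution 1 → Distribution 2
  (D ⊗ E) (m ∷ l ∷ []) = D (m ∷ []) ∘ᵒ E (l ∷ [])

  -- The terms whose sum over k is the coefficient of z^m w^l in
  -- F(w/z) D(z,w).
  ratioTerm : Scalar.Power 1 → Distribution 2 → ℤ → ℤ → Vec ℕ 1 → Operator
  ratioTerm F D m l (k ∷ []) = F (k ∷ []) · D (m ℤ.+ + k ∷ l ℤ.- + k ∷ [])

  RatioFinite : Scalar.Power 1 → Distribution 2 → Set (c ⊔ˡ ℓ)
  RatioFinite F D = ∀ m l → LocallyFinite (ratioTerm F D m l)

  timesRatio : (F : Scalar.Power 1) (D : Distribution 2) → RatioFinite F D → Distribution 2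
  timesRatio F D fin (m ∷ l ∷ []) = ∑ (ratioTerm F D m l) (fin m l)

  extend-neg : ∀ E (i : ℤ) {j : ℤ} → j ℤ.< ℤ.0ℤ → ∀ f → ⟦ extend E (i ∷ j ∷ []) ⟧ f ≈ 0Γ
  extend-neg E (+ _)    {+ _}      (ℤ.+<+ ()) f
  extend-neg E (+ _)    { -[1+ _ ]} _         f = refl
  extend-neg E -[1+ _ ] {_}         _         f = refl

  negative : ∀ l k n N → N ℕ.+ ℤ.∣ l ∣ ≤ k → n ℕ.< N → (l ℤ.- + k) ℤ.+ + n ℤ.< ℤ.0ℤ
  negative l k n N le lt = begin-strict
    (l ℤ.- + k) ℤ.+ + n            ≡⟨ ℤ.+-assoc l (ℤ.- + k) (+ n) ⟩
    l ℤ.+ (ℤ.- + k ℤ.+ + n)        ≡⟨ ≡.cong (λ i → l ℤ.+ i) (ℤ.+-comm (ℤ.- + k) (+ n)) ⟩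
    l ℤ.+ (+ n ℤ.- + k)            ≡⟨ ℤ.+-assoc l (+ n) (ℤ.- + k) ⟨
    (l ℤ.+ + n) ℤ.- + k            <⟨ ℤ.+-monoˡ-< (ℤ.- + k) l+n<k ⟩
    + k ℤ.- + k                    ≡⟨ ℤ.+-inverseʳ (+ k) ⟩
    ℤ.0ℤ                           ∎
    where
    open ℤ.≤-Reasoning
    l≤∣l∣ : ∀ l → l ℤ.≤ + ℤ.∣ l ∣
    l≤∣l∣ (+ _)    = ℤ.≤-refl
    l≤∣l∣ -[1+ _ ] = ℤ.-≤+
    l+n<k : l ℤ.+ + n ℤ.< + k
    l+n<k = ℤ.≤-<-trans (ℤ.+-monoˡ-≤ (+ n) (l≤∣l∣ l)) (ℤ.+<+
      (ℕ.<-≤-trans (ℕ.+-monoʳ-< ℤ.∣ l ∣ lt)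
        (ℕ.≤-trans (ℕ.≤-reflexive (ℕ.+-comm ℤ.∣ l ∣ N)) le)))

  coefficient-vanishes : ∀ E (Φ : Operator) N m l k n n′ f → N ℕ.+ ℤ.∣ l ∣ ≤ k →
    (N ≤ n ℕ.+ n′ → ⟦ Φ ⟧ f ≈ 0Γ) →
    ⟦ extend E ((m ℤ.+ + k) ℤ.+ + n ∷ (l ℤ.- + k) ℤ.+ + n′ ∷ []) ⟧ (⟦ Φ ⟧ f) ≈ 0Γ
  coefficient-vanishes E Φ N m l k n n′ f le small with N ℕ.≤? n ℕ.+ n′
  ... | yes N≤ = trans (Operator.cong Ψ (small N≤)) (Operator.0-homo Ψ)
    where Ψ = extend E ((m ℤ.+ + k) ℤ.+ + n ∷ (l ℤ.- + k) ℤ.+ + n′ ∷ [])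
  ... | no  N≰ = extend-neg E ((m ℤ.+ + k) ℤ.+ + n)
    (negative l k n′ N le (ℕ.≤-<-trans (ℕ.m≤n+m n′ n) (ℕ.≰⇒> N≰))) (⟦ Φ ⟧ f)

  product±-vanishes : ∀ E G (fin : LocallyFinite G) m l k f →
    proj₁ (fin f) ℕ.+ ℤ.∣ l ∣ ≤ k →
    ⟦ product± E G fin (m ℤ.+ + k ∷ l ℤ.- + k ∷ []) ⟧ f ≈ 0Γ
  product±-vanishes E G fin m l k f le =
    ∑-zero (λ β → extend E (a ⊞ β) ∘ᵒ G β) (product-finite E G fin a) f term
    where
    a : Vec ℤ 2
    a = m ℤ.+ + k ∷ l ℤ.- + k ∷ []
    term : ∀ β → ⟦ extend E (a ⊞ β) ∘ᵒ G β ⟧ f ≈ 0Γ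
    term (n ∷ n′ ∷ []) = coefficient-vanishes E (G (n ∷ n′ ∷ [])) (proj₁ (fin f)) m l k n n′ f le
      (λ N≤ → proj₂ (fin f) (n ∷ n′ ∷ [])
        (≡.subst (λ j → proj₁ (fin f) ≤ n ℕ.+ j) (≡.sym (ℕ.+-identityʳ n′)) N≤))

  product±-finite : ∀ H E G (fin : LocallyFinite G) → RatioFinite H (product± E G fin)
  product±-finite H E G fin m l f = proj₁ (fin f) ℕ.+ ℤ.∣ l ∣ , λ { (k ∷ []) le →
    trans (*-cong refl (product±-vanishes E G fin m l k f
            (≡.subst (proj₁ (fin f) ℕ.+ ℤ.∣ l ∣ ≤_) (ℕ.+-identityʳ k) le)))
          (G.zeroʳ (con (H (k ∷ [])))) }

  A : 𝕂 → Op.Power 1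
  A τ = overOdd 0ᵒ λ n odd →
    ((K.fromℕ 2 K.* (K.1# K.- τ K.^ n)) K./ K.fromℕ n) · a₋ n odd

  -- A series in z⁻¹: the coefficient of z⁻ⁿ is B τ (n ∷ []).
  B : 𝕂 → Op.Power 1
  B τ = overOdd 0ᵒ λ n _ →
    (K.- (K.fromℕ 2 K./ (K.fromℕ n K.* (K.1# K.- τ K.^ n)))) · a₊ n

  A₂ B₂ : 𝕂 → 𝕂 → Op.Power 2
  A₂ τ σ = Op.in-z (A τ) Op.+ˢ Op.in-w (A σ)
  B₂ τ σ = Op.in-z (B τ) Op.+ˢ Op.in-w (B σ)

  B-lowering : ∀ τ → Lowering (B τ)
  B-lowering τ (n ∷ []) with n % 2 ℕ.≟ 1
  ... | no _  = 0-lowers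
  ... | yes _ = ·-lowers _ (a₊ n) (·-lowers _ (derivative n) (lowers λ {d} b →
    castᵇ (≡.cong (d ∸_) (≡.sym (ℕ.+-identityʳ n))) (∂-lowers n b)))

  in-z-lowering : ∀ {C} → Lowering C → Lowering (Op.in-z C)
  in-z-lowering l (m ∷ zero  ∷ []) = l (m ∷ [])
  in-z-lowering l (m ∷ suc _ ∷ []) = 0-lowers

  in-w-lowering : ∀ {C} → Lowering C → Lowering (Op.in-w C)
  in-w-lowering l (zero  ∷ n ∷ []) = l (n ∷ [])
  in-w-lowering l (suc _ ∷ n ∷ []) = 0-lowers

  expB-finite : ∀ τ → LocallyFinite (Op.exp (B τ))
  expB-finite τ = lowering-finite (exp-lowering (B τ) (B-lowering τ))

  expB₂-finite : ∀ τ σ → LocallyFinite (Op.exp (B₂ τ σ))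
  expB₂-finite τ σ = lowering-finite (exp-lowering (B₂ τ σ) (λ α →
    +-lowers (Op.in-z (B τ) α) (Op.in-w (B σ) α)
      (in-z-lowering (B-lowering τ) α) (in-w-lowering (B-lowering σ) α)))

  Y : 𝕂 → Distribution 1
  Y τ = product± (Op.exp (A τ)) (Op.exp (B τ)) (expB-finite τ)

  -- : Y(z;τ) Y(w;σ) :
  normalOrdered : 𝕂 → 𝕂 → Distribution 2
  normalOrdered τ σ = product± (Op.exp (A₂ τ σ)) (Op.exp (B₂ τ σ)) (expB₂-finite τ σ)

  F : 𝕂 → 𝕂 → Scalar.Power 1
  F τ σ = Scalar.exp (overOdd K.0# λ n _ →
    (K.- K.fromℕ 2) K.* (((K.1# K.- σ K.^ n) K./ (K.1# K.- τ K.^ n)) K./ K.fromℕ n))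

  normalOrdered-finite : ∀ H τ σ → RatioFinite H (normalOrdered τ σ)
  normalOrdered-finite H τ σ =
    product±-finite H (Op.exp (A₂ τ σ)) (Op.exp (B₂ τ σ)) (expB₂-finite τ σ)

module Γ⟨t,s⟩ = Fock ℚ⟨t,s⟩

module Submission where

-- Normal ordering Y(z;t) Y(w;s) amounts to moving e^B(z;t) past e^A(w;s).
-- The commutator of the coefficients B_n and A_j is the scalar c_n if n = j
-- and 0 otherwise (BA-commutator), where log F(u) is the sum of the c_n u^n.
-- So e^B(z;t) e^A(w;s) = F(w/z) e^A(w;s) e^B(z;t), the central case of the
-- Baker-Campbell-Hausdorff formula (exp-exchange).
--
-- Every identity between exponentials is proved by a differential equation.
-- Let θ be the Euler operator, which multiplies a coefficient by its total
-- degree. In characteristic 0 a linear equation θ X = M X, where M has no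
-- constant term, determines X from its constant term (ode-unique), and
-- exp C solves θ X = (θ C) X when the coefficients of C commute (θ-exp).
-- Therefore exp (C(z) + D(w)) = exp C(z) exp D(w) (exp-zw). The exchange
-- formula follows from two instances of one uniqueness argument, intertwine:
-- over power series in w it gives [B_n, exp A(w)] = c_n w^n exp A(w)
-- (commutator-exp), and over power series in x = 1/z, with power series in w
-- as coefficients, it turns this relation into the exchange of exp B(x) and
-- exp A(w).
--
-- NormalOrdering passes from the exchange formula to the coefficient of
-- z^m w^l applied to a fixed f. All sums there are locally finite, so one
-- bound can be taken for all of them. The exchange formula produces a sum
-- over triangles k + b < N, the right-hand side a sum over squares; the
-- terms in between vanish, because either the annihilation part already
-- kills f or the creation part has a negative exponent.
--
-- For s = t the series θ (log F) is -2u / (1 - u^2), and (1 - u) / (1 + u)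
-- solves the same equation θ X = θ (log F) X with the same constant term
-- (θ-quotient). The results hold over any field of characteristic 0 and any
-- t no positive power of which is 1. For the rational function field both
-- conditions are checked on constant terms, that is at t = s = 0.

open import Defs
open import Algebra.Bundles using (CommutativeMonoid; CommutativeRing; Ring)
open import Algebra.Bundles.Raw using (RawRing)
import Algebra.Definitions.RawMonoid as RawMonoidDefs
import Algebra.Definitions.RawSemiring as RawSemiringDefs
import Algebra.Properties.AbelianGroup as AbelianGroupProperties
import Algebra.Properties.CommutativeMonoid.Mult as MultProperties
import Algebra.Properties.CommutativeMonoid.Sum as CommutativeMonoidSum
import Algebra.Properties.CommutativeSemigroup as CommutativeSemigroupProperties
import Algebra.Properties.Ring as RingProperties
import Algebra.Properties.Semiring.Mult as SemiringMult
import Algebra.Solver.Ring.NaturalCoefficients.Default as SemiringSolver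
open import Algebra.Structures using (IsRing)
open import Data.Empty using (⊥-elim)
open import Data.Fin.Base using (toℕ)
open import Data.Integer.Base as ℤ using (ℤ; +_; -[1+_])
import Data.Integer.Properties as ℤ
open import Data.List.Base using ([]; _∷_)
open import Data.Nat.Base as ℕ
  using (ℕ; zero; suc; _∸_; _≤_; _<_; z≤n; s≤s; _%_; _!; NonZero)
open import Data.Nat.Induction using (<-rec)
import Data.Nat.Properties as ℕ
open import Data.Product.Base using (_,_; proj₁; proj₂; _×_)
open import Data.Rational.Base using (0ℚ; 1ℚ)
import Data.Rational.Base as ℚ
import Data.Rational.Properties as ℚ
open import Data.Vec.Base as Vec using (Vec; []; _∷_)
open import Level using (Level; _⊔_)
open import Relation.Binary.PropositionalEquality as ≡ using (_≡_; _≢_)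
import Relation.Binary.Reasoning.Setoid as SetoidReasoning
open import Relation.Nullary using (¬_; yes; no)

private
  variable
    c ℓ r ρ : Level

-- Finite sums in commutative monoids.

module FiniteSums (M : CommutativeMonoid c ℓ) where
  open CommutativeMonoid M renaming
    (_∙_ to _+_; ε to 0#; ∙-cong to +-cong; ∙-congˡ to +-congˡ; ∙-congʳ to +-congʳ;
     identityˡ to +-identityˡ; identityʳ to +-identityʳ; assoc to +-assoc; comm to +-comm)
  open CommutativeMonoidSum M using (sum)
  open CommutativeSemigroupProperties commutativeSemigroup using (interchange)
  open SetoidReasoning setoid

  -- The sum of x i over i < n.
  ∑< : ℕ → (ℕ → Carrier) → Carrier
  ∑< n x = sum {n} (λ i → x (toℕ i))

  -- The sum of x i j over i + j = n.
  diag : (ℕ → ℕ → Carrier) → ℕ → Carrier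
  diag x n = ∑< (suc n) (λ i → x i (n ∸ i))

  ∑<-cong : ∀ n x y → (∀ i → x i ≈ y i) → ∑< n x ≈ ∑< n y
  ∑<-cong zero    x y e = refl
  ∑<-cong (suc n) x y e =
    +-cong (e 0) (∑<-cong n (λ i → x (suc i)) (λ i → y (suc i)) (λ i → e (suc i)))

  ∑<-+ : ∀ n x y → ∑< n (λ i → x i + y i) ≈ ∑< n x + ∑< n y
  ∑<-+ zero    x y = sym (+-identityˡ 0#)
  ∑<-+ (suc n) x y = trans
    (+-congˡ (∑<-+ n (λ i → x (suc i)) (λ i → y (suc i)))) (interchange _ _ _ _)

  ∑<-zero : ∀ n x → (∀ i → x i ≈ 0#) → ∑< n x ≈ 0#
  ∑<-zero zero    x e = refl
  ∑<-zero (suc n) x e =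
    trans (+-cong (e 0) (∑<-zero n (λ i → x (suc i)) (λ i → e (suc i)))) (+-identityˡ 0#)

  ∑<-stable : ∀ {n m} → n ≤ m → ∀ x → (∀ i → n ≤ i → x i ≈ 0#) → ∑< m x ≈ ∑< n x
  ∑<-stable {m = m} z≤n       x e = ∑<-zero m x (λ i → e i z≤n)
  ∑<-stable         (s≤s n≤m) x e =
    +-congˡ (∑<-stable n≤m (λ i → x (suc i)) (λ i n≤i → e (suc i) (s≤s n≤i)))

  ∑<-swap : ∀ n m x → ∑< n (λ i → ∑< m (x i)) ≈ ∑< m (λ j → ∑< n (λ i → x i j))
  ∑<-swap zero    m x = sym (∑<-zero m (λ _ → 0#) (λ _ → refl))
  ∑<-swap (suc n) m x = trans (+-congˡ (∑<-swap n m (λ i → x (suc i))))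
    (sym (∑<-+ m (x 0) (λ j → ∑< n (λ i → x (suc i) j))))

  diag-cong : ∀ n x y → (∀ i j → i ℕ.+ j ≡ n → x i j ≈ y i j) → diag x n ≈ diag y n
  diag-cong zero    x y e = +-congʳ (e 0 0 ≡.refl)
  diag-cong (suc n) x y e = +-cong (e 0 (suc n) ≡.refl)
    (diag-cong n (λ i → x (suc i)) (λ i → y (suc i)) (λ i j eq → e (suc i) j (≡.cong suc eq)))

  diag-+ : ∀ n x y → diag (λ i j → x i j + y i j) n ≈ diag x n + diag y n
  diag-+ n x y = ∑<-+ (suc n) (λ i → x i (n ∸ i)) (λ i → y i (n ∸ i))

  diag-zero : ∀ n x → (∀ i j → i ℕ.+ j ≡ n → x i j ≈ 0#) → diag x n ≈ 0#
  diag-zero n x e = trans (diag-cong n x (λ _ _ → 0#) e)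
                          (∑<-zero (suc n) (λ _ → 0#) (λ _ → refl))

  diag-last : ∀ n x → diag x (suc n) ≈ diag (λ i j → x i (suc j)) n + x (suc n) 0
  diag-last zero    x = begin
    x 0 1 + (x 1 0 + 0#)    ≈⟨ +-congˡ (+-comm _ _) ⟩
    x 0 1 + (0# + x 1 0)    ≈⟨ +-assoc _ _ _ ⟨
    (x 0 1 + 0#) + x 1 0    ∎
  diag-last (suc n) x = trans (+-congˡ (diag-last n (λ i → x (suc i)))) (sym (+-assoc _ _ _))

  diag-comm : ∀ n x → diag x n ≈ diag (λ i j → x j i) n
  diag-comm zero    x = refl
  diag-comm (suc n) x = begin
    diag x (suc n)                               ≈⟨ diag-last n x ⟩
    diag (λ i j → x i (suc j)) n + x (suc n) 0   ≈⟨ +-congʳ (diag-comm n (λ i j → x i (suc j))) ⟩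
    diag (λ i j → x j (suc i)) n + x (suc n) 0   ≈⟨ +-comm _ _ ⟩
    diag (λ i j → x j i) (suc n)                 ∎

  diag-assoc : ∀ n (x : ℕ → ℕ → ℕ → Carrier) →
    diag (λ m k → diag (λ i j → x i j k) m) n ≈ diag (λ i m → diag (x i) m) n
  diag-assoc zero    x = +-congʳ refl
  diag-assoc (suc n) x = begin
    (x 0 0 (suc n) + 0#) +
    diag (λ m k → x 0 (suc m) k + diag (λ i j → x (suc i) j k) m) n
      ≈⟨ +-cong (+-identityʳ _) (diag-+ n (λ m k → x 0 (suc m) k)
           (λ m k → diag (λ i j → x (suc i) j k) m)) ⟩
    x 0 0 (suc n) + (diag (λ m k → x 0 (suc m) k) n +
                     diag (λ m k → diag (λ i j → x (suc i) j k) m) n)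
      ≈⟨ +-assoc _ _ _ ⟨
    diag (x 0) (suc n) + diag (λ m k → diag (λ i j → x (suc i) j k) m) n
      ≈⟨ +-congˡ (diag-assoc n (λ i → x (suc i))) ⟩
    diag (x 0) (suc n) + diag (λ i m → diag (x (suc i)) m) n ∎

  diag-swap : ∀ n m (x : ℕ → ℕ → ℕ → ℕ → Carrier) →
    diag (λ i j → diag (λ k l → x i j k l) m) n ≈ diag (λ k l → diag (λ i j → x i j k l) n) m
  diag-swap n m x = ∑<-swap (suc n) (suc m) (λ i k → x i (n ∸ i) k (m ∸ k))

  -- A sum over a triangle is a sum over a square when the terms beyond the
  -- hypotenuse vanish.
  triangle : ∀ n (x : ℕ → ℕ → Carrier) → (∀ i j → n ≤ i ℕ.+ j → x i j ≈ 0#) →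
             ∑< n (diag x) ≈ ∑< n (λ i → ∑< n (x i))
  triangle zero    x e = refl
  triangle (suc n) x e = begin
    (x 0 0 + 0#) + ∑< n (λ m → x 0 (suc m) + diag (λ i → x (suc i)) m)
      ≈⟨ +-cong (+-identityʳ _) (∑<-+ n (λ m → x 0 (suc m)) (diag (λ i → x (suc i)))) ⟩
    x 0 0 + (∑< n (λ m → x 0 (suc m)) + ∑< n (diag (λ i → x (suc i))))
      ≈⟨ +-assoc _ _ _ ⟨
    ∑< (suc n) (x 0) + ∑< n (diag (λ i → x (suc i)))
      ≈⟨ +-congˡ (triangle n (λ i → x (suc i)) (λ i j n≤ → e (suc i) j (s≤s n≤))) ⟩
    ∑< (suc n) (x 0) + ∑< n (λ i → ∑< n (x (suc i)))
      ≈⟨ +-congˡ (∑<-cong n (λ i → ∑< n (x (suc i))) (λ i → ∑< (suc n) (x (suc i))) (λ i →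
           sym (∑<-stable (ℕ.n≤1+n n) (x (suc i)) (λ j n≤j →
             e (suc i) j (s≤s (ℕ.≤-trans n≤j (ℕ.m≤n+m j i))))))) ⟩
    ∑< (suc n) (λ i → ∑< (suc n) (x i)) ∎

∑<-homo : (M : CommutativeMonoid c ℓ) (N : CommutativeMonoid r ρ) →
  let module M = CommutativeMonoid M; module N = CommutativeMonoid N in
  (φ : M.Carrier → N.Carrier) → φ M.ε N.≈ N.ε → (∀ a b → φ (a M.∙ b) N.≈ φ a N.∙ φ b) →
  ∀ n x → φ (FiniteSums.∑< M n x) N.≈ FiniteSums.∑< N n (λ i → φ (x i))
∑<-homo M N φ ε-homo ∙-homo zero    x = ε-homo
∑<-homo M N φ ε-homo ∙-homo (suc n) x = trans (∙-homo _ _)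
  (∙-congˡ (∑<-homo M N φ ε-homo ∙-homo n (λ i → x (suc i))))
  where open CommutativeMonoid N

-- Rings of formal power series.

-- The ring axioms for given operations. Power series are taken over a raw
-- ring together with these axioms, so that the raw ring can be prescribed
-- literally.
RingLaws : RawRing r ρ → Set (r ⊔ ρ)
RingLaws R = IsRing _≈_ _+_ _*_ -_ 0# 1#
  where open RawRing R

fromLaws : (R : RawRing r ρ) → RingLaws R → Ring r ρ
fromLaws R laws = record { isRing = laws }

module PowerSeries (K : Field c ℓ) (R : RawRing r ρ) (laws : RingLaws R)
                   (_·_ : Field.Carrier K → RawRing.Carrier R → RawRing.Carrier R) where
  open Ring (fromLaws R laws)
  open Series K R _·_ public
  open FiniteSums +-commutativeMonoid
  open MultProperties +-commutativeMonoid using (×-congʳ; ×-distrib-+; ×-homo-+) renaming (_×_ to _times_)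
  open SemiringMult semiring using (×-comm-*; ×-assoc-*)
  open CommutativeSemigroupProperties +-commutativeSemigroup using (interchange)
  private module E = SetoidReasoning setoid

  private
    +-interchange : ∀ m n k l → (m ℕ.+ n) ℕ.+ (k ℕ.+ l) ≡ (m ℕ.+ k) ℕ.+ (n ℕ.+ l)
    +-interchange = CommutativeSemigroupProperties.interchange ℕ.+-commutativeSemigroup

  -- The total degree.
  deg : ∀ {d} → Vec ℕ d → ℕ
  deg = Vec.sum

  -- Only pairs of exponents adding up to the degree of α matter.
  convolve-cong : ∀ {d} (α : Vec ℕ d) x y →
    (∀ β γ → deg β ℕ.+ deg γ ≡ deg α → x β γ ≈ y β γ) → convolve x α ≈ convolve y α
  convolve-cong []      x y e = e [] [] ≡.refl
  convolve-cong (n ∷ α) x y e = diag-cong n _ _ (λ i j i+j≡n →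
    convolve-cong α (λ β γ → x (i ∷ β) (j ∷ γ)) (λ β γ → y (i ∷ β) (j ∷ γ)) (λ β γ eq →
      e (i ∷ β) (j ∷ γ) (≡.trans (+-interchange i (deg β) j (deg γ)) (≡.cong₂ ℕ._+_ i+j≡n eq))))

  convolve-cong′ : ∀ {d} (α : Vec ℕ d) x y → (∀ β γ → x β γ ≈ y β γ) → convolve x α ≈ convolve y α
  convolve-cong′ α x y e = convolve-cong α x y (λ β γ _ → e β γ)

  -- Additive maps commute with convolutions.
  convolve-homo : (φ : Carrier → Carrier) → (∀ {a b} → a ≈ b → φ a ≈ φ b) → φ 0# ≈ 0# →
    (∀ a b → φ (a + b) ≈ φ a + φ b) →
    ∀ {d} (α : Vec ℕ d) x → φ (convolve x α) ≈ convolve (λ β γ → φ (x β γ)) α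
  convolve-homo φ φ-cong φ-0 φ-+ []      x = refl
  convolve-homo φ φ-cong φ-0 φ-+ (n ∷ α) x = trans
    (∑<-homo +-commutativeMonoid +-commutativeMonoid φ φ-0 φ-+ (suc n)
      (λ i → convolve (λ β γ → x (i ∷ β) ((n ∸ i) ∷ γ)) α))
    (diag-cong n _ _ (λ i j _ →
      convolve-homo φ φ-cong φ-0 φ-+ α (λ β γ → x (i ∷ β) (j ∷ γ))))

  convolve-+ : ∀ {d} (α : Vec ℕ d) x y →
    convolve (λ β γ → x β γ + y β γ) α ≈ convolve x α + convolve y α
  convolve-+ []      x y = refl
  convolve-+ (n ∷ α) x y = trans
    (diag-cong n _ _ (λ i j _ →
      convolve-+ α (λ β γ → x (i ∷ β) (j ∷ γ)) (λ β γ → y (i ∷ β) (j ∷ γ))))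
    (diag-+ n (λ i j → convolve (λ β γ → x (i ∷ β) (j ∷ γ)) α)
              (λ i j → convolve (λ β γ → y (i ∷ β) (j ∷ γ)) α))

  convolve-zero : ∀ {d} (α : Vec ℕ d) x → (∀ β γ → deg β ℕ.+ deg γ ≡ deg α → x β γ ≈ 0#) →
                  convolve x α ≈ 0#
  convolve-zero []      x e = e [] [] ≡.refl
  convolve-zero (n ∷ α) x e = diag-zero n _ (λ i j i+j≡n →
    convolve-zero α (λ β γ → x (i ∷ β) (j ∷ γ)) (λ β γ eq →
      e (i ∷ β) (j ∷ γ) (≡.trans (+-interchange i (deg β) j (deg γ)) (≡.cong₂ ℕ._+_ i+j≡n eq))))

  convolve-comm : ∀ {d} (α : Vec ℕ d) x → convolve x α ≈ convolve (λ β γ → x γ β) α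
  convolve-comm []      x = refl
  convolve-comm (n ∷ α) x = trans
    (diag-comm n (λ i j → convolve (λ β γ → x (i ∷ β) (j ∷ γ)) α))
    (diag-cong n _ _ (λ i j _ → convolve-comm α (λ β γ → x (j ∷ β) (i ∷ γ))))

  convolve-diag : ∀ {d} n (α : Vec ℕ d) (x : ℕ → ℕ → Vec ℕ d → Vec ℕ d → Carrier) →
    convolve (λ β γ → diag (λ i j → x i j β γ) n) α ≈ diag (λ i j → convolve (x i j) α) n
  convolve-diag n []      x = refl
  convolve-diag n (m ∷ α) x = trans
    (diag-cong m _ _ (λ k l _ → convolve-diag n α (λ i j β γ → x i j (k ∷ β) (l ∷ γ))))
    (diag-swap m n (λ k l i j → convolve (λ β γ → x i j (k ∷ β) (l ∷ γ)) α))

  convolve-assoc : ∀ {d} (α : Vec ℕ d) (x : Vec ℕ d → Vec ℕ d → Vec ℕ d → Carrier) →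
    convolve (λ μ γ → convolve (λ β δ → x β δ γ) μ) α ≈
    convolve (λ β μ → convolve (x β) μ) α
  convolve-assoc []      x = refl
  convolve-assoc (n ∷ α) x = E.begin
    diag (λ m k → convolve (λ μ γ →
      diag (λ i j → convolve (λ β δ → x (i ∷ β) (j ∷ δ) (k ∷ γ)) μ) m) α) n
      E.≈⟨ diag-cong n _ _ (λ m k _ → convolve-diag m α
             (λ i j μ γ → convolve (λ β δ → x (i ∷ β) (j ∷ δ) (k ∷ γ)) μ)) ⟩
    diag (λ m k → diag (λ i j → convolve (λ μ γ →
      convolve (λ β δ → x (i ∷ β) (j ∷ δ) (k ∷ γ)) μ) α) m) n
      E.≈⟨ diag-cong n _ _ (λ m k _ → diag-cong m _ _ (λ i j _ →
             convolve-assoc α (λ β δ γ → x (i ∷ β) (j ∷ δ) (k ∷ γ)))) ⟩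
    diag (λ m k → diag (λ i j → convolve (λ β μ →
      convolve (λ δ γ → x (i ∷ β) (j ∷ δ) (k ∷ γ)) μ) α) m) n
      E.≈⟨ diag-assoc n (λ i j k → convolve (λ β μ →
             convolve (λ δ γ → x (i ∷ β) (j ∷ δ) (k ∷ γ)) μ) α) ⟩
    diag (λ i m → diag (λ j k → convolve (λ β μ →
      convolve (λ δ γ → x (i ∷ β) (j ∷ δ) (k ∷ γ)) μ) α) m) n
      E.≈⟨ diag-cong n _ _ (λ i m _ → convolve-diag m α
             (λ j k β μ → convolve (λ δ γ → x (i ∷ β) (j ∷ δ) (k ∷ γ)) μ)) ⟨
    diag (λ i m → convolve (λ β μ →
      diag (λ j k → convolve (λ δ γ → x (i ∷ β) (j ∷ δ) (k ∷ γ)) μ) m) α) n E.∎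

  -- The series 1 is a left unit for convolution along any operation for
  -- which 0# is absorbing and 1# is neutral on the left. Multiplication and
  -- its opposite are two such operations.
  convolve-constant : ∀ {d} (_∙_ : Carrier → Carrier → Carrier) →
    (∀ b → 0# ∙ b ≈ 0#) → (∀ b → 1# ∙ b ≈ b) →
    ∀ α (C : Power d) → convolve (λ β γ → one β ∙ C γ) α ≈ C α
  convolve-constant _∙_ 0∙ 1∙ []      C = 1∙ (C [])
  convolve-constant _∙_ 0∙ 1∙ (zero ∷ α) C = trans (+-identityʳ _)
    (convolve-constant _∙_ 0∙ 1∙ α (λ γ → C (0 ∷ γ)))
  convolve-constant _∙_ 0∙ 1∙ (suc n ∷ α) C = trans
    (+-cong (convolve-constant _∙_ 0∙ 1∙ α (λ γ → C (suc n ∷ γ)))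
      (diag-zero n _ (λ i j _ → convolve-zero α _ (λ β γ _ → 0∙ (C (j ∷ γ))))))
    (+-identityʳ _)

  infixl 7 _*ˢ_
  infix  8 -ˢ_
  _*ˢ_ : ∀ {d} → Power d → Power d → Power d
  C *ˢ D = λ α → convolve (λ β γ → C β * D γ) α
  -ˢ_ : ∀ {d} → Power d → Power d
  -ˢ C = λ α → - C α

  *ˢ-cong : ∀ {d} {C C′ D D′ : Power d} → C ≈ˢ C′ → D ≈ˢ D′ → C *ˢ D ≈ˢ C′ *ˢ D′
  *ˢ-cong e e′ α = convolve-cong′ α _ _ (λ β γ → *-cong (e β) (e′ γ))

  *ˢ-assoc : ∀ {d} (C D E : Power d) → (C *ˢ D) *ˢ E ≈ˢ C *ˢ (D *ˢ E)
  *ˢ-assoc C D E α = E.begin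
    convolve (λ μ γ → convolve (λ β δ → C β * D δ) μ * E γ) α
      E.≈⟨ convolve-cong′ α _ _ (λ μ γ → convolve-homo (_* E γ) *-congʳ (zeroˡ _)
             (distribʳ (E γ)) μ (λ β δ → C β * D δ)) ⟩
    convolve (λ μ γ → convolve (λ β δ → C β * D δ * E γ) μ) α
      E.≈⟨ convolve-assoc α (λ β δ γ → C β * D δ * E γ) ⟩
    convolve (λ β μ → convolve (λ δ γ → C β * D δ * E γ) μ) α
      E.≈⟨ convolve-cong′ α _ _ (λ β μ → convolve-cong′ μ _ _ (λ δ γ → *-assoc _ _ _)) ⟩
    convolve (λ β μ → convolve (λ δ γ → C β * (D δ * E γ)) μ) α
      E.≈⟨ convolve-cong′ α _ _ (λ β μ → convolve-homo (C β *_) *-congˡ (zeroʳ _)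
             (distribˡ (C β)) μ (λ δ γ → D δ * E γ)) ⟨
    convolve (λ β μ → C β * convolve (λ δ γ → D δ * E γ) μ) α E.∎

  *ˢ-identityˡ : ∀ {d} (C : Power d) → one *ˢ C ≈ˢ C
  *ˢ-identityˡ C α = convolve-constant _*_ zeroˡ *-identityˡ α C

  *ˢ-identityʳ : ∀ {d} (C : Power d) → C *ˢ one ≈ˢ C
  *ˢ-identityʳ C α = trans (convolve-comm α (λ β γ → C β * one γ))
    (convolve-constant (λ a b → b * a) zeroʳ *-identityʳ α C)

  *ˢ-distribˡ : ∀ {d} (C D E : Power d) → C *ˢ (D +ˢ E) ≈ˢ C *ˢ D +ˢ C *ˢ E
  *ˢ-distribˡ C D E α = trans (convolve-cong′ α _ _ (λ β γ → distribˡ (C β) (D γ) (E γ)))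
    (convolve-+ α (λ β γ → C β * D γ) (λ β γ → C β * E γ))

  *ˢ-distribʳ : ∀ {d} (C D E : Power d) → (D +ˢ E) *ˢ C ≈ˢ D *ˢ C +ˢ E *ˢ C
  *ˢ-distribʳ C D E α = trans (convolve-cong′ α _ _ (λ β γ → distribʳ (C γ) (D β) (E β)))
    (convolve-+ α (λ β γ → D β * C γ) (λ β γ → E β * C γ))

  -- Power series in d variables form a ring.
  seriesLaws : ∀ d → RingLaws (seriesRing d)
  seriesLaws d = record
    { +-isAbelianGroup = record
      { isGroup = record
        { isMonoid = record
          { isSemigroup = record
            { isMagma = record
              { isEquivalence = record
                { refl  = λ _ → refl
                ; sym   = λ e α → sym (e α)
                ; trans = λ e e′ α → trans (e α) (e′ α) }
              ; ∙-cong = λ e e′ α → +-cong (e α) (e′ α) }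
            ; assoc = λ C D E α → +-assoc (C α) (D α) (E α) }
          ; identity = (λ C α → +-identityˡ (C α)) , (λ C α → +-identityʳ (C α)) }
        ; inverse = (λ C α → -‿inverseˡ (C α)) , (λ C α → -‿inverseʳ (C α))
        ; ⁻¹-cong = λ e α → -‿cong (e α) }
      ; comm = λ C D α → +-comm (C α) (D α) }
    ; *-cong = *ˢ-cong
    ; *-assoc = *ˢ-assoc
    ; *-identity = *ˢ-identityˡ , *ˢ-identityʳ
    ; distrib = *ˢ-distribˡ , *ˢ-distribʳ }

  series : ℕ → Ring r ρ
  series d = fromLaws (seriesRing d) (seriesLaws d)

  *ˢ-comm : ∀ {d} (C D : Power d) → (∀ β γ → C β * D γ ≈ D γ * C β) → C *ˢ D ≈ˢ D *ˢ C
  *ˢ-comm C D e α = trans (convolve-cong′ α _ _ e) (convolve-comm α (λ β γ → D γ * C β))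

  -- The series with constant term a and no other terms.
  constant : ∀ {d} → Carrier → Power d
  constant a α = a * one α

  constant-*ˡ : ∀ {d} a (C : Power d) α → (constant a *ˢ C) α ≈ a * C α
  constant-*ˡ a C α = E.begin
    convolve (λ β γ → a * one β * C γ) α
      E.≈⟨ convolve-cong′ α _ _ (λ β γ → *-assoc _ _ _) ⟩
    convolve (λ β γ → a * (one β * C γ)) α
      E.≈⟨ convolve-homo (a *_) *-congˡ (zeroʳ a) (distribˡ a) α (λ β γ → one β * C γ) ⟨
    a * convolve (λ β γ → one β * C γ) α  E.≈⟨ *-congˡ (*ˢ-identityˡ C α) ⟩
    a * C α                               E.∎

  constant-*ʳ : ∀ {d} (C : Power d) a α → (C *ˢ constant a) α ≈ C α * a
  constant-*ʳ C a α = trans (convolve-cong′ α _ _ (λ β γ → sym (*-assoc _ _ _)))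
    (*ˢ-identityʳ (λ β → C β * a) α)

  one-deg : ∀ {d} (α : Vec ℕ d) {n} → deg α ≡ suc n → one α ≈ 0#
  one-deg (zero  ∷ α) eq = one-deg α eq
  one-deg (suc _ ∷ α) eq = refl

  times-0 : ∀ n → n times 0# ≈ 0#
  times-0 zero    = refl
  times-0 (suc n) = trans (+-identityˡ _) (times-0 n)

  -- The Euler operator, which multiplies the coefficient at α by deg α.
  θ : ∀ {d} → Power d → Power d
  θ C α = deg α times C α

  θ-cong : ∀ {d} {C D : Power d} → C ≈ˢ D → θ C ≈ˢ θ D
  θ-cong e α = ×-congʳ (deg α) (e α)

  θ-+ : ∀ {d} (C D : Power d) → θ (C +ˢ D) ≈ˢ θ C +ˢ θ D
  θ-+ C D α = ×-distrib-+ (C α) (D α) (deg α)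

  θ-* : ∀ {d} (C D : Power d) → θ (C *ˢ D) ≈ˢ θ C *ˢ D +ˢ C *ˢ θ D
  θ-* C D α = E.begin
    deg α times convolve (λ β γ → C β * D γ) α
      E.≈⟨ convolve-homo (deg α times_) (×-congʳ (deg α)) (times-0 (deg α))
             (λ a b → ×-distrib-+ a b (deg α)) α (λ β γ → C β * D γ) ⟩
    convolve (λ β γ → deg α times (C β * D γ)) α
      E.≈⟨ convolve-cong α _ _ term ⟩
    convolve (λ β γ → θ C β * D γ + C β * θ D γ) α
      E.≈⟨ convolve-+ α (λ β γ → θ C β * D γ) (λ β γ → C β * θ D γ) ⟩
    (θ C *ˢ D) α + (C *ˢ θ D) α E.∎
    where
    term : ∀ β γ → deg β ℕ.+ deg γ ≡ deg α →
           deg α times (C β * D γ) ≈ θ C β * D γ + C β * θ D γ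
    term β γ eq = E.begin
      deg α times (C β * D γ)             E.≡⟨ ≡.cong (_times (C β * D γ)) eq ⟨
      (deg β ℕ.+ deg γ) times (C β * D γ) E.≈⟨ ×-homo-+ (C β * D γ) (deg β) (deg γ) ⟩
      deg β times (C β * D γ) + deg γ times (C β * D γ)
        E.≈⟨ +-cong (×-assoc-* (deg β) (C β) (D γ)) (×-comm-* (deg γ) (C β) (D γ)) ⟨
      θ C β * D γ + C β * θ D γ           E.∎

  θ-deg0 : ∀ {d} (C : Power d) β → deg β ≡ 0 → θ C β ≈ 0#
  θ-deg0 C β eq = reflexive (≡.cong (_times C β) eq)

  θ-constant : ∀ {d} a → θ {d} (constant a) ≈ˢ (λ _ → 0#)
  θ-constant a α with deg α in eq
  ... | zero  = refl
  ... | suc n = E.begin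
    suc n times (a * one α)   E.≈⟨ ×-comm-* (suc n) a (one α) ⟨
    a * (suc n times one α)   E.≈⟨ *-congˡ (×-congʳ (suc n) (one-deg α eq)) ⟩
    a * (suc n times 0#)      E.≈⟨ ×-comm-* (suc n) a 0# ⟩
    suc n times (a * 0#)      E.≈⟨ ×-congʳ (suc n) (zeroʳ a) ⟩
    suc n times 0#            E.≈⟨ times-0 (suc n) ⟩
    0#                        E.∎

  -- Multiplication by a positive natural number is injective.
  TorsionFree : Set _
  TorsionFree = ∀ n {x y} → suc n times x ≈ suc n times y → x ≈ y

  -- A linear differential equation θ X = M X without constant term in M
  -- determines X from its constant term.
  ode-unique : TorsionFree → ∀ {d} (M X Y : Power d) → (∀ β → deg β ≡ 0 → M β ≈ 0#) →
    θ X ≈ˢ M *ˢ X → θ Y ≈ˢ M *ˢ Y → (∀ α → deg α ≡ 0 → X α ≈ Y α) → X ≈ˢ Y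
  ode-unique tf {d} M X Y M₀ eX eY e₀ α = <-rec P step (deg α) α ≡.refl
    where
    P : ℕ → Set _
    P n = ∀ α → deg α ≡ n → X α ≈ Y α
    step : ∀ n → (∀ {m} → m < n → P m) → P n
    step zero    rec α eq = e₀ α eq
    step (suc n) rec α eq = tf n (E.begin
      suc n times X α   E.≡⟨ ≡.cong (_times X α) eq ⟨
      θ X α             E.≈⟨ eX α ⟩
      (M *ˢ X) α        E.≈⟨ convolve-cong α _ _ term ⟩
      (M *ˢ Y) α        E.≈⟨ eY α ⟨
      θ Y α             E.≡⟨ ≡.cong (_times Y α) eq ⟩
      suc n times Y α   E.∎)
      where
      term : ∀ β γ → deg β ℕ.+ deg γ ≡ deg α → M β * X γ ≈ M β * Y γ
      -- If deg β > 0 then γ has smaller degree than α.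
      term β γ eq′ with deg β in eqβ
      ... | zero  = trans (*-congʳ (M₀ β eqβ))
                      (trans (zeroˡ _) (sym (trans (*-congʳ (M₀ β eqβ)) (zeroˡ _))))
      ... | suc m = *-congˡ (rec (s≤s (ℕ.≤-trans (ℕ.m≤n+m (deg γ) m)
                      (ℕ.≤-reflexive (ℕ.suc-injective (≡.trans eq′ eq))))) γ ≡.refl)

  -- If θ G = M G, then any solution v of the adjoint equation
  -- θ v = M v - v M with the right constant term satisfies G b = v G for
  -- constant b: both sides solve θ X = M X.
  intertwine : TorsionFree → ∀ {d} (M G b v : Power d) → (∀ β → deg β ≡ 0 → M β ≈ 0#) →
    θ G ≈ˢ M *ˢ G → θ b ≈ˢ (λ _ → 0#) → θ v +ˢ v *ˢ M ≈ˢ M *ˢ v →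
    (∀ α → deg α ≡ 0 → (G *ˢ b) α ≈ (v *ˢ G) α) → G *ˢ b ≈ˢ v *ˢ G
  intertwine tf {d} M G b v M₀ eG eb ev e₀ =
    ode-unique tf M (G *ˢ b) (v *ˢ G) M₀
      (S.begin
        θ (G *ˢ b)                     S.≈⟨ θ-* G b ⟩
        θ G *ˢ b +ˢ G *ˢ θ b           S.≈⟨ SR.+-cong (SR.*-congʳ eG) (SR.*-congˡ eb) ⟩
        (M *ˢ G) *ˢ b +ˢ G *ˢ SR.0#    S.≈⟨ SR.+-cong (SR.*-assoc M G b) (SR.zeroʳ G) ⟩
        M *ˢ (G *ˢ b) +ˢ SR.0#         S.≈⟨ SR.+-identityʳ (M *ˢ (G *ˢ b)) ⟩
        M *ˢ (G *ˢ b)                  S.∎)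
      (S.begin
        θ (v *ˢ G)                     S.≈⟨ θ-* v G ⟩
        θ v *ˢ G +ˢ v *ˢ θ G           S.≈⟨ SR.+-congˡ {x = θ v *ˢ G} (SR.*-congˡ {x = v} eG) ⟩
        θ v *ˢ G +ˢ v *ˢ (M *ˢ G)      S.≈⟨ SR.+-congˡ {x = θ v *ˢ G} (SR.*-assoc v M G) ⟨
        θ v *ˢ G +ˢ (v *ˢ M) *ˢ G      S.≈⟨ SR.distribʳ G (θ v) (v *ˢ M) ⟨
        (θ v +ˢ v *ˢ M) *ˢ G           S.≈⟨ SR.*-congʳ {x = G} ev ⟩
        (M *ˢ v) *ˢ G                  S.≈⟨ SR.*-assoc M v G ⟩
        M *ˢ (v *ˢ G)                  S.∎)
      e₀
    where
    module SR = Ring (series d)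
    module S = SetoidReasoning SR.setoid

-- Exponentials and reciprocals of power series.

Characteristic0 : CommutativeRing c ℓ → Set ℓ
Characteristic0 R = ∀ n → ¬ suc n times 1# ≈ 0#
  where
  open CommutativeRing R
  open RawMonoidDefs +-rawMonoid using () renaming (_×_ to _times_)

-- No positive power of x is 1.
NotRootOfUnity : (R : CommutativeRing c ℓ) → CommutativeRing.Carrier R → Set ℓ
NotRootOfUnity R x = ∀ n .{{_ : NonZero n}} → ¬ 1# - x ^ n ≈ 0#
  where
  open CommutativeRing R
  open RawSemiringDefs (RawRing.rawSemiring rawRing) using (_^_)

module FieldProperties (K : Field c ℓ) where
  open Field K
  open SetoidReasoning setoid

  inverse-unique : ∀ a b → ¬ a ≈ 0# → a * b ≈ 1# → a ⁻¹ ≈ b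
  inverse-unique a b a≉0 e = begin
    a ⁻¹            ≈⟨ *-identityʳ _ ⟨
    a ⁻¹ * 1#       ≈⟨ *-congˡ e ⟨
    a ⁻¹ * (a * b)  ≈⟨ *-assoc _ _ _ ⟨
    a ⁻¹ * a * b    ≈⟨ *-congʳ (trans (*-comm _ _) (inverse a a≉0)) ⟩
    1# * b          ≈⟨ *-identityˡ b ⟩
    b               ∎

-- The raw ring R, whose multiplication need not commute, is a K-algebra with
-- scalar multiplication _·_.
record IsAlgebra (K : Field c ℓ) (R : RawRing r ρ)
                 (_·_ : Field.Carrier K → RawRing.Carrier R → RawRing.Carrier R) : Set (c ⊔ ℓ ⊔ r ⊔ ρ) where
  private module K = Field K
  open RawRing R
  field
    ·-cong     : ∀ {x y a b} → x K.≈ y → a ≈ b → x · a ≈ y · b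
    ·-distribˡ : ∀ x a b → x · (a + b) ≈ (x · a) + (x · b)
    ·-distribʳ : ∀ x y a → (x K.+ y) · a ≈ (x · a) + (y · a)
    ·-assoc    : ∀ x y a → (x K.* y) · a ≈ x · (y · a)
    1-·        : ∀ a → K.1# · a ≈ a
    ·-*ˡ       : ∀ x a b → (x · a) * b ≈ x · (a * b)
    ·-*ʳ       : ∀ x a b → a * (x · b) ≈ x · (a * b)

module Exponentials (K : Field c ℓ) (char0 : Characteristic0 (Field.commutativeRing K)) (R : RawRing r ρ)
                    (laws : RingLaws R)
                    (_·_ : Field.Carrier K → RawRing.Carrier R → RawRing.Carrier R)
                    (isAlgebra : IsAlgebra K R _·_) where
  private module K = Field K
  open Ring (fromLaws R laws)
  open IsAlgebra isAlgebra
  open FieldProperties K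
  open RingProperties (fromLaws R laws) using (x+x≈x⇒x≈0)
  open AbelianGroupProperties +-abelianGroup using (xyx⁻¹≈y; ⁻¹-anti-homo‿-)
  open PowerSeries K R laws _·_ public
  open FiniteSums +-commutativeMonoid
  open MultProperties +-commutativeMonoid using (×-congʳ; ×-distrib-+; ×-homo-+) renaming (_×_ to _times_)
  open SemiringMult semiring using (×-comm-*; ×-assoc-*)
  private module E = SetoidReasoning setoid
  private module KE = SetoidReasoning K.setoid
  private module S {d} = Ring (series d)
  private module ES {d} = SetoidReasoning (S.setoid {d})
  private module SM {d} = SemiringMult (S.semiring {d})

  infixr 8 _^ˢ_
  _^ˢ_ : ∀ {d} → Power d → ℕ → Power d
  _^ˢ_ {d} = RawSemiringDefs._^_ (RawRing.rawSemiring (seriesRing d))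

  ·-zeroʳ : ∀ x → x · 0# ≈ 0#
  ·-zeroʳ x = x+x≈x⇒x≈0 (x · 0#) (trans (sym (·-distribˡ x 0# 0#)) (·-cong K.refl (+-identityˡ 0#)))

  ·-zeroˡ : ∀ a → K.0# · a ≈ 0#
  ·-zeroˡ a = x+x≈x⇒x≈0 (K.0# · a)
    (trans (sym (·-distribʳ K.0# K.0# a)) (·-cong (K.+-identityˡ K.0#) refl))

  times-· : ∀ n a → n times a ≈ K.fromℕ n · a
  times-· zero    a = sym (·-zeroˡ a)
  times-· (suc n) a = sym (trans (·-distribʳ K.1# (K.fromℕ n) a)
                                 (+-cong (1-· a) (sym (times-· n a))))

  ·-times : ∀ n x a → n times (x · a) ≈ x · (n times a)
  ·-times zero    x a = sym (·-zeroʳ x)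
  ·-times (suc n) x a = trans (+-congˡ (·-times n x a)) (sym (·-distribˡ x a (n times a)))

  torsionFree : TorsionFree
  torsionFree n {x} {y} e = E.begin
    x                              E.≈⟨ undo x ⟨
    (k K.⁻¹) · (suc n times x)       E.≈⟨ ·-cong K.refl e ⟩
    (k K.⁻¹) · (suc n times y)       E.≈⟨ undo y ⟩
    y                              E.∎
    where
    k = K.fromℕ (suc n)
    undo : ∀ a → (k K.⁻¹) · (suc n times a) ≈ a
    undo a = E.begin
      (k K.⁻¹) · (suc n times a)     E.≈⟨ ·-cong K.refl (times-· (suc n) a) ⟩
      (k K.⁻¹) · (k · a)             E.≈⟨ ·-assoc _ _ _ ⟨
      (k K.⁻¹ K.* k) · a           E.≈⟨ ·-cong (K.trans (K.*-comm _ _) (K.inverse k (char0 n))) refl ⟩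
      K.1# · a                     E.≈⟨ 1-· a ⟩
      a                            E.∎

  fromℕ≉0 : ∀ n .{{_ : NonZero n}} → ¬ K.fromℕ n K.≈ K.0#
  fromℕ≉0 (suc n) = char0 n

  -- (1 / (k+1)!) (k + 1) = 1 / k!.
  factorial-step : ∀ k a →
    (K.1# K./ K.fromℕ (suc k !)) · (suc k times a) ≈ (K.1# K./ K.fromℕ (k !)) · a
  factorial-step k a = E.begin
    (K.1# K.* z K.⁻¹) · (suc k times a)   E.≈⟨ ·-cong K.refl (times-· (suc k) a) ⟩
    (K.1# K.* z K.⁻¹) · (x · a)           E.≈⟨ ·-assoc _ _ _ ⟨
    ((K.1# K.* z K.⁻¹) K.* x) · a         E.≈⟨ ·-cong scalars refl ⟩
    (K.1# K.* y K.⁻¹) · a                 E.∎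
    where
    x = K.fromℕ (suc k)
    y = K.fromℕ (k !)
    z = K.fromℕ (suc k !)
    z≈xy : z K.≈ x K.* y
    z≈xy = SemiringMult.×1-homo-* K.semiring (suc k) (k !)
    z≉0 : ¬ z K.≈ K.0#
    z≉0 = fromℕ≉0 (suc k !) {{ℕ._!≢0 (suc k)}}
    scalars : (K.1# K.* z K.⁻¹) K.* x K.≈ K.1# K.* y K.⁻¹
    scalars = KE.begin
      (K.1# K.* z K.⁻¹) K.* x        KE.≈⟨ K.*-congʳ (K.*-identityˡ _) ⟩
      z K.⁻¹ K.* x                   KE.≈⟨ inverse-unique y (z K.⁻¹ K.* x) (fromℕ≉0 (k !) {{ℕ._!≢0 k}}) (KE.begin
        y K.* (z K.⁻¹ K.* x)         KE.≈⟨ K.*-comm _ _ ⟩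
        (z K.⁻¹ K.* x) K.* y         KE.≈⟨ K.*-assoc _ _ _ ⟩
        z K.⁻¹ K.* (x K.* y)         KE.≈⟨ K.*-congˡ z≈xy ⟨
        z K.⁻¹ K.* z                 KE.≈⟨ K.*-comm _ _ ⟩
        z K.* z K.⁻¹                 KE.≈⟨ K.inverse z z≉0 ⟩
        K.1#                         KE.∎) ⟨
      y K.⁻¹                         KE.≈⟨ K.*-identityˡ _ ⟨
      K.1# K.* y K.⁻¹                KE.∎

  NoConstantTerm : ∀ {d} → Power d → Set ρ
  NoConstantTerm C = ∀ α → deg α ≡ 0 → C α ≈ 0#

  -- C ^ k has order at least k.
  ^-order : ∀ {d} (C : Power d) → NoConstantTerm C → ∀ k α → deg α < k → (C ^ˢ k) α ≈ 0#
  ^-order C C₀ (suc k) α (s≤s α≤k) = convolve-zero α (λ β γ → C β * (C ^ˢ k) γ) term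
    where
    term : ∀ β γ → deg β ℕ.+ deg γ ≡ deg α → C β * (C ^ˢ k) γ ≈ 0#
    term β γ eq with deg β in eqβ
    ... | zero  = trans (*-congʳ (C₀ β eqβ)) (zeroˡ _)
    ... | suc m = trans (*-congˡ (^-order C C₀ k γ (ℕ.≤-trans
          (s≤s (ℕ.m≤n+m (deg γ) m)) (ℕ.≤-trans (ℕ.≤-reflexive eq) α≤k)))) (zeroʳ _)

  convolve-∑< : ∀ {d} n (α : Vec ℕ d) (x : Vec ℕ d → Vec ℕ d → ℕ → Carrier) →
    convolve (λ β γ → ∑< n (x β γ)) α ≈ ∑< n (λ k → convolve (λ β γ → x β γ k) α)
  convolve-∑< zero    α x = convolve-zero α (λ _ _ → 0#) (λ _ _ _ → refl)
  convolve-∑< (suc n) α x = trans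
    (convolve-+ α (λ β γ → x β γ 0) (λ β γ → ∑< n (λ k → x β γ (suc k))))
    (+-congˡ (convolve-∑< n α (λ β γ k → x β γ (suc k))))

  -- Let T k have order at least k. The coefficient at α of the sum of the T k
  -- needs only k ≤ deg α; after multiplication by a series without constant
  -- term, k < deg α is enough.
  *-truncated : ∀ {d} (M : Power d) → NoConstantTerm M → (T : ℕ → Power d) →
    (∀ k γ → deg γ < k → T k γ ≈ 0#) → ∀ α →
    (M *ˢ (λ γ → ∑< (suc (deg γ)) (λ k → T k γ))) α ≈ ∑< (deg α) (λ k → (M *ˢ T k) α)
  *-truncated M M₀ T order α = E.begin
    convolve (λ β γ → M β * ∑< (suc (deg γ)) (λ k → T k γ)) α
      E.≈⟨ convolve-cong α _ _ term ⟩
    convolve (λ β γ → M β * ∑< (deg α) (λ k → T k γ)) α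
      E.≈⟨ convolve-cong′ α _ _ (λ β γ → ∑<-homo +-commutativeMonoid +-commutativeMonoid
             (M β *_) (zeroʳ _) (distribˡ (M β)) (deg α) (λ k → T k γ)) ⟩
    convolve (λ β γ → ∑< (deg α) (λ k → M β * T k γ)) α
      E.≈⟨ convolve-∑< (deg α) α (λ β γ k → M β * T k γ) ⟩
    ∑< (deg α) (λ k → (M *ˢ T k) α) E.∎
    where
    term : ∀ β γ → deg β ℕ.+ deg γ ≡ deg α →
      M β * ∑< (suc (deg γ)) (λ k → T k γ) ≈ M β * ∑< (deg α) (λ k → T k γ)
    term β γ eq with deg β in eqβ
    ... | zero  = trans (*-congʳ (M₀ β eqβ))
                    (trans (zeroˡ _) (sym (trans (*-congʳ (M₀ β eqβ)) (zeroˡ _))))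
    ... | suc m = *-congˡ (sym (∑<-stable
          (ℕ.≤-trans (s≤s (ℕ.m≤n+m (deg γ) m)) (ℕ.≤-reflexive eq))
          (λ k → T k γ) (λ k γ<k → order k γ γ<k)))

  times-pointwise : ∀ {d} n (C : Power d) α → (n SM.× C) α ≈ n times C α
  times-pointwise zero    C α = refl
  times-pointwise (suc n) C α = +-congˡ (times-pointwise n C α)

  -- Every coefficient of C commutes with every coefficient of D.
  Commute : ∀ {d e} → Power d → Power e → Set ρ
  Commute C D = ∀ α β → C α * D β ≈ D β * C α

  θ-commuteˡ : ∀ {d e} (C : Power d) (D : Power e) → Commute C D → Commute (θ C) D
  θ-commuteˡ C D e α β = E.begin
    (deg α times C α) * D β    E.≈⟨ ×-assoc-* (deg α) (C α) (D β) ⟩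
    deg α times (C α * D β)    E.≈⟨ ×-congʳ (deg α) (e α β) ⟩
    deg α times (D β * C α)    E.≈⟨ ×-comm-* (deg α) (D β) (C α) ⟨
    D β * (deg α times C α)    E.∎

  θ-one : ∀ {d} → θ (one {d}) ≈ˢ (λ _ → 0#)
  θ-one α = trans (×-congʳ (deg α) (sym (*-identityˡ (one α)))) (θ-constant 1# α)

  -- θ (C ^ (k+1)) = (k + 1) (θ C) C ^ k, because θ is a derivation and C
  -- commutes with θ C.
  θ-^ : ∀ {d} (C : Power d) → Commute C C → ∀ k →
        θ (C ^ˢ suc k) ≈ˢ suc k SM.× (θ C *ˢ C ^ˢ k)
  θ-^ C comm zero = ES.begin
    θ (C *ˢ one)                         ES.≈⟨ θ-* C one ⟩
    θ C *ˢ one +ˢ C *ˢ θ one             ES.≈⟨ S.+-congˡ {x = θ C *ˢ one} (S.*-congˡ {x = C} θ-one) ⟩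
    θ C *ˢ one +ˢ C *ˢ (λ _ → 0#)        ES.≈⟨ S.+-congˡ {x = θ C *ˢ one} (S.zeroʳ C) ⟩
    1 SM.× (θ C *ˢ one)                  ES.∎
  θ-^ C comm (suc k) = ES.begin
    θ (C *ˢ C ^ˢ suc k)                                ES.≈⟨ θ-* C (C ^ˢ suc k) ⟩
    θ C *ˢ C ^ˢ suc k +ˢ C *ˢ θ (C ^ˢ suc k)
      ES.≈⟨ S.+-congˡ {x = θ C *ˢ C ^ˢ suc k} (ES.begin
        C *ˢ θ (C ^ˢ suc k)                            ES.≈⟨ S.*-congˡ {x = C} (θ-^ C comm k) ⟩
        C *ˢ (suc k SM.× (θ C *ˢ C ^ˢ k))              ES.≈⟨ SM.×-comm-* (suc k) C (θ C *ˢ C ^ˢ k) ⟩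
        suc k SM.× (C *ˢ (θ C *ˢ C ^ˢ k))
          ES.≈⟨ SM.×-congʳ (suc k) (ES.begin
            C *ˢ (θ C *ˢ C ^ˢ k)                       ES.≈⟨ S.*-assoc C (θ C) (C ^ˢ k) ⟨
            (C *ˢ θ C) *ˢ C ^ˢ k
              ES.≈⟨ S.*-congʳ {x = C ^ˢ k} (*ˢ-comm (θ C) C (θ-commuteˡ C C comm)) ⟨
            (θ C *ˢ C) *ˢ C ^ˢ k                       ES.≈⟨ S.*-assoc (θ C) C (C ^ˢ k) ⟩
            θ C *ˢ C ^ˢ suc k                          ES.∎) ⟩
        suc k SM.× (θ C *ˢ C ^ˢ suc k)                 ES.∎) ⟩
    suc (suc k) SM.× (θ C *ˢ C ^ˢ suc k)               ES.∎

  -- The exponential solves its differential equation.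
  θ-exp : ∀ {d} (C : Power d) → NoConstantTerm C → Commute C C → θ (exp C) ≈ˢ θ C *ˢ exp C
  θ-exp C C₀ comm α = E.begin
    n times ∑< (suc n) (expTerm C α)
      E.≈⟨ ∑<-homo +-commutativeMonoid +-commutativeMonoid (n times_) (times-0 n)
             (λ a b → ×-distrib-+ a b n) (suc n) (expTerm C α) ⟩
    n times expTerm C α 0 + ∑< n (λ k → n times expTerm C α (suc k))
      E.≈⟨ +-cong head (∑<-cong n _ _ tail) ⟩
    0# + ∑< n (λ k → (θ C *ˢ T k) α)
      E.≈⟨ +-identityˡ _ ⟩
    ∑< n (λ k → (θ C *ˢ T k) α)
      E.≈⟨ *-truncated (θ C) (θ-deg0 C) T order α ⟨
    (θ C *ˢ exp C) α E.∎
    where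
    n = deg α
    T : ℕ → Power _
    T k γ = expTerm C γ k
    order : ∀ k γ → deg γ < k → T k γ ≈ 0#
    order k γ γ<k = trans (·-cong K.refl (^-order C C₀ k γ γ<k)) (·-zeroʳ _)
    -- θ kills the term for k = 0.
    head : n times expTerm C α 0 ≈ 0#
    head = trans (·-times n _ (one α)) (trans (·-cong K.refl (θ-one α)) (·-zeroʳ _))
    tail : ∀ k → n times expTerm C α (suc k) ≈ (θ C *ˢ T k) α
    tail k = E.begin
      n times (x′ · (C ^ˢ suc k) α)            E.≈⟨ ·-times n x′ _ ⟩
      x′ · θ (C ^ˢ suc k) α                    E.≈⟨ ·-cong K.refl (θ-^ C comm k α) ⟩
      x′ · (suc k SM.× (θ C *ˢ C ^ˢ k)) α
        E.≈⟨ ·-cong K.refl (times-pointwise (suc k) (θ C *ˢ C ^ˢ k) α) ⟩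
      x′ · (suc k times (θ C *ˢ C ^ˢ k) α)     E.≈⟨ factorial-step k _ ⟩
      x · (θ C *ˢ C ^ˢ k) α
        E.≈⟨ convolve-homo (x ·_) (·-cong K.refl) (·-zeroʳ x) (·-distribˡ x) α _ ⟩
      convolve (λ β γ → x · (θ C β * (C ^ˢ k) γ)) α
        E.≈⟨ convolve-cong′ α _ _ (λ β γ → ·-*ʳ x (θ C β) ((C ^ˢ k) γ)) ⟨
      (θ C *ˢ T k) α                           E.∎
      where
      x  = K.1# K./ K.fromℕ (k !)
      x′ = K.1# K./ K.fromℕ (suc k !)

  exp-deg0 : ∀ {d} (C : Power d) α → deg α ≡ 0 → exp C α ≈ one α
  exp-deg0 C α eq = E.begin
    ∑< (suc (deg α)) (expTerm C α)   E.≡⟨ ≡.cong (λ n → ∑< (suc n) (expTerm C α)) eq ⟩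
    expTerm C α 0 + 0#               E.≈⟨ +-identityʳ _ ⟩
    (K.1# K.* o K.⁻¹) · one α        E.≈⟨ ·-cong unit refl ⟩
    K.1# · one α                     E.≈⟨ 1-· _ ⟩
    one α                            E.∎
    where
    o = K.fromℕ 1
    unit : K.1# K.* o K.⁻¹ K.≈ K.1#
    unit = K.trans (K.*-congʳ (K.sym (K.+-identityʳ K.1#))) (K.inverse o (char0 0))

  -- The geometric series inverts a series with constant term 1.
  reciprocal-inverse : ∀ {d} (D : Power d) → (∀ α → deg α ≡ 0 → D α ≈ one α) →
                       D *ˢ reciprocal D ≈ˢ one
  reciprocal-inverse D D₀ = ES.begin
    D *ˢ W                    ES.≈⟨ S.*-congʳ {x = W} D≈ ⟩
    (one -ˢ C) *ˢ W           ES.≈⟨ S.distribʳ W one (-ˢ C) ⟩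
    one *ˢ W +ˢ (-ˢ C) *ˢ W   ES.≈⟨ S.+-cong {x = one *ˢ W} (S.*-identityˡ W) (S.sym (RP.-‿distribˡ-* C W)) ⟩
    W -ˢ C *ˢ W               ES.≈⟨ S.+-congʳ {x = -ˢ (C *ˢ W)} W≈ ⟩
    (one +ˢ C *ˢ W) -ˢ C *ˢ W ES.≈⟨ S.+-assoc one (C *ˢ W) (-ˢ (C *ˢ W)) ⟩
    one +ˢ (C *ˢ W -ˢ C *ˢ W) ES.≈⟨ S.+-congˡ {x = one} (S.-‿inverseʳ (C *ˢ W)) ⟩
    one +ˢ (λ _ → 0#)         ES.≈⟨ S.+-identityʳ one ⟩
    one                       ES.∎
    where
    module RP {d} = RingProperties (series d)
    C = one -ˢ D
    W = reciprocal D
    C₀ : NoConstantTerm C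
    C₀ α eq = trans (+-congˡ (-‿cong (D₀ α eq))) (-‿inverseʳ (one α))
    D≈ : D ≈ˢ one -ˢ C
    D≈ α = E.begin
      D α                         E.≈⟨ xyx⁻¹≈y (one α) (D α) ⟨
      one α + D α - one α         E.≈⟨ +-assoc _ _ _ ⟩
      one α + (D α - one α)       E.≈⟨ +-congˡ (⁻¹-anti-homo‿- (one α) (D α)) ⟨
      one α - (one α - D α)       E.∎
    -- The geometric series satisfies W = 1 + C W.
    W≈ : W ≈ˢ one +ˢ C *ˢ W
    W≈ α = +-congˡ (sym (*-truncated C C₀ (C ^ˢ_) (^-order C C₀) α))

  commute-convolve : ∀ {d} a (C D : Power d) → (∀ β → a * C β ≈ C β * a) →
    (∀ γ → a * D γ ≈ D γ * a) → ∀ α → a * (C *ˢ D) α ≈ (C *ˢ D) α * a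
  commute-convolve a C D eC eD α = E.begin
    a * (C *ˢ D) α
      E.≈⟨ convolve-homo (a *_) *-congˡ (zeroʳ a) (distribˡ a) α _ ⟩
    convolve (λ β γ → a * (C β * D γ)) α
      E.≈⟨ convolve-cong′ α _ _ (λ β γ → E.begin
        a * (C β * D γ)   E.≈⟨ *-assoc _ _ _ ⟨
        a * C β * D γ     E.≈⟨ *-congʳ (eC β) ⟩
        C β * a * D γ     E.≈⟨ *-assoc _ _ _ ⟩
        C β * (a * D γ)   E.≈⟨ *-congˡ (eD γ) ⟩
        C β * (D γ * a)   E.≈⟨ *-assoc _ _ _ ⟨
        C β * D γ * a     E.∎) ⟩
    convolve (λ β γ → C β * D γ * a) α
      E.≈⟨ convolve-homo (_* a) *-congʳ (zeroˡ a) (distribʳ a) α _ ⟨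
    (C *ˢ D) α * a E.∎

  commute-one : ∀ {d} a (α : Vec ℕ d) → a * one α ≈ one α * a
  commute-one a []          = trans (*-identityʳ a) (sym (*-identityˡ a))
  commute-one a (zero  ∷ α) = commute-one a α
  commute-one a (suc _ ∷ α) = trans (zeroʳ a) (sym (zeroˡ a))

  commute-^ : ∀ {d} a (C : Power d) → (∀ β → a * C β ≈ C β * a) →
              ∀ k α → a * (C ^ˢ k) α ≈ (C ^ˢ k) α * a
  commute-^ a C e zero    α = commute-one a α
  commute-^ a C e (suc k) α = commute-convolve a C (C ^ˢ k) e (commute-^ a C e k) α

  commute-exp : ∀ {d} a (C : Power d) → (∀ β → a * C β ≈ C β * a) →
                ∀ α → a * exp C α ≈ exp C α * a
  commute-exp a C e α = E.begin
    a * ∑< n T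
      E.≈⟨ ∑<-homo +-commutativeMonoid +-commutativeMonoid (a *_) (zeroʳ a) (distribˡ a) n T ⟩
    ∑< n (λ k → a * T k)
      E.≈⟨ ∑<-cong n _ _ (λ k → trans (·-*ʳ (x k) a _)
             (trans (·-cong K.refl (commute-^ a C e k α)) (sym (·-*ˡ (x k) _ a)))) ⟩
    ∑< n (λ k → T k * a)
      E.≈⟨ ∑<-homo +-commutativeMonoid +-commutativeMonoid (_* a) (zeroˡ a) (distribʳ a) n T ⟨
    ∑< n T * a E.∎
    where
    n = suc (deg α)
    T = expTerm C α
    x : ℕ → K.Carrier
    x k = K.1# K./ K.fromℕ (k !)

  in-z-* : ∀ (C : Power 1) (X : Power 2) m l →
    (in-z C *ˢ X) (m ∷ l ∷ []) ≈ diag (λ i j → C (i ∷ []) * X (j ∷ l ∷ [])) m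
  in-z-* C X m l = diag-cong m
    (λ i j → diag (λ i′ j′ → in-z C (i ∷ i′ ∷ []) * X (j ∷ j′ ∷ [])) l) _ (λ i j _ → first i j l)
    where
    first : ∀ i j l → diag (λ i′ j′ → in-z C (i ∷ i′ ∷ []) * X (j ∷ j′ ∷ [])) l ≈
            C (i ∷ []) * X (j ∷ l ∷ [])
    first i j zero    = +-identityʳ _
    first i j (suc l) = trans
      (+-congˡ (diag-zero l (λ _ j′ → 0# * X (j ∷ j′ ∷ [])) (λ _ j′ _ → zeroˡ _))) (+-identityʳ _)

  in-w-* : ∀ (C : Power 1) (X : Power 2) m l →
    (in-w C *ˢ X) (m ∷ l ∷ []) ≈ diag (λ i j → C (i ∷ []) * X (m ∷ j ∷ [])) l
  in-w-* C X zero    l = +-identityʳ _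
  in-w-* C X (suc m) l = trans
    (+-congˡ (diag-zero m (λ _ j → diag (λ _ j′ → 0# * X (j ∷ j′ ∷ [])) l)
      (λ _ j _ → diag-zero l (λ _ j′ → 0# * X (j ∷ j′ ∷ [])) (λ _ j′ _ → zeroˡ _))))
    (+-identityʳ _)

  commute-sym : ∀ {d e} (C : Power d) (D : Power e) → Commute C D → Commute D C
  commute-sym C D e α β = sym (e β α)

  in-z-commute : ∀ {d} (C : Power 1) (D : Power d) → Commute C D → Commute (in-z C) D
  in-z-commute C D e (m ∷ zero  ∷ []) β = e (m ∷ []) β
  in-z-commute C D e (m ∷ suc l ∷ []) β = trans (zeroˡ _) (sym (zeroʳ _))

  in-w-commute : ∀ {d} (C : Power 1) (D : Power d) → Commute C D → Commute (in-w C) D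
  in-w-commute C D e (zero  ∷ l ∷ []) β = e (l ∷ []) β
  in-w-commute C D e (suc m ∷ l ∷ []) β = trans (zeroˡ _) (sym (zeroʳ _))

  +-commute : ∀ {d e} (C C′ : Power d) (D : Power e) → Commute C D → Commute C′ D →
              Commute (C +ˢ C′) D
  +-commute C C′ D e e′ α β = trans (distribʳ _ _ _)
    (trans (+-cong (e α β) (e′ α β)) (sym (distribˡ _ _ _)))

  ^-cong : ∀ {d} {C D : Power d} → C ≈ˢ D → ∀ k → C ^ˢ k ≈ˢ D ^ˢ k
  ^-cong e zero    = λ _ → refl
  ^-cong e (suc k) = *ˢ-cong e (^-cong e k)

  exp-cong : ∀ {d} {C D : Power d} → C ≈ˢ D → exp C ≈ˢ exp D
  exp-cong {C = C} {D} e α = ∑<-cong (suc (deg α)) (expTerm C α) (expTerm D α)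
    (λ k → ·-cong K.refl (^-cong e k α))

  -- exp (C(z) + D(w)) = exp C(z) exp D(w).
  exp-zw : ∀ (C D : Power 1) → NoConstantTerm C → NoConstantTerm D →
    Commute C C → Commute C D → Commute D D →
    ∀ m l → exp (in-z C +ˢ in-w D) (m ∷ l ∷ []) ≈ exp C (m ∷ []) * exp D (l ∷ [])
  exp-zw C D C₀ D₀ CC CD DD m l =
    ode-unique torsionFree (θ Z) (exp Z) X (θ-deg0 Z) (θ-exp Z Z₀ ZZ) θ-X X₀ (m ∷ l ∷ [])
    where
    Z X : Power 2
    Z = in-z C +ˢ in-w D
    X (m ∷ l ∷ []) = exp C (m ∷ []) * exp D (l ∷ [])
    Z₀ : NoConstantTerm Z
    Z₀ (zero ∷ zero ∷ []) _ = trans (+-cong (C₀ (0 ∷ []) ≡.refl) (D₀ (0 ∷ []) ≡.refl)) (+-identityˡ 0#)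
    ZZ : Commute Z Z
    ZZ = +-commute (in-z C) (in-w D) Z
      (in-z-commute C Z (commute-sym Z C (+-commute (in-z C) (in-w D) C
        (in-z-commute C C CC) (in-w-commute D C (commute-sym C D CD)))))
      (in-w-commute D Z (commute-sym Z D (+-commute (in-z C) (in-w D) D
        (in-z-commute C D CD) (in-w-commute D D DD))))
    X₀ : ∀ α → deg α ≡ 0 → exp Z α ≈ X α
    X₀ (zero ∷ zero ∷ []) eq = E.begin
      exp Z (0 ∷ 0 ∷ [])                 E.≈⟨ exp-deg0 Z (0 ∷ 0 ∷ []) ≡.refl ⟩
      1#                                 E.≈⟨ *-identityˡ 1# ⟨
      1# * 1#
        E.≈⟨ *-cong (exp-deg0 C (0 ∷ []) ≡.refl) (exp-deg0 D (0 ∷ []) ≡.refl) ⟨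
      exp C (0 ∷ []) * exp D (0 ∷ [])    E.∎
    θ-Z : θ Z ≈ˢ in-z (θ C) +ˢ in-w (θ D)
    θ-Z α = trans (×-distrib-+ (in-z C α) (in-w D α) (deg α)) (+-cong (z-part α) (w-part α))
      where
      z-part : θ (in-z C) ≈ˢ in-z (θ C)
      z-part (m ∷ zero  ∷ []) = refl
      z-part (m ∷ suc l ∷ []) = times-0 (m ℕ.+ (suc l ℕ.+ 0))
      w-part : θ (in-w D) ≈ˢ in-w (θ D)
      w-part (zero  ∷ l ∷ []) = refl
      w-part (suc m ∷ l ∷ []) = times-0 (suc m ℕ.+ (l ℕ.+ 0))
    θ-X : θ X ≈ˢ θ Z *ˢ X
    θ-X (m ∷ l ∷ []) = E.begin
      (m ℕ.+ (l ℕ.+ 0)) times (Em * El)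
        E.≈⟨ ×-homo-+ (Em * El) m (l ℕ.+ 0) ⟩
      m times (Em * El) + (l ℕ.+ 0) times (Em * El)
        E.≈⟨ +-cong z-part w-part ⟩
      (in-z (θ C) *ˢ X) (m ∷ l ∷ []) + (in-w (θ D) *ˢ X) (m ∷ l ∷ [])
        E.≈⟨ S.distribʳ X (in-z (θ C)) (in-w (θ D)) (m ∷ l ∷ []) ⟨
      ((in-z (θ C) +ˢ in-w (θ D)) *ˢ X) (m ∷ l ∷ [])
        E.≈⟨ S.*-congʳ {x = X} θ-Z (m ∷ l ∷ []) ⟨
      (θ Z *ˢ X) (m ∷ l ∷ []) E.∎
      where
      Em El : Carrier
      Em = exp C (m ∷ [])
      El = exp D (l ∷ [])
      z-part : m times (Em * El) ≈ (in-z (θ C) *ˢ X) (m ∷ l ∷ [])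
      z-part = E.begin
        m times (Em * El)                 E.≡⟨ ≡.cong (_times (Em * El)) (ℕ.+-identityʳ m) ⟨
        (m ℕ.+ 0) times (Em * El)         E.≈⟨ ×-assoc-* (m ℕ.+ 0) Em El ⟨
        θ (exp C) (m ∷ []) * El           E.≈⟨ *-congʳ (θ-exp C C₀ CC (m ∷ [])) ⟩
        diag (λ i j → θ C (i ∷ []) * exp C (j ∷ [])) m * El
          E.≈⟨ convolve-homo (_* El) *-congʳ (zeroˡ El) (distribʳ El) (m ∷ [])
                 (λ β γ → θ C β * exp C γ) ⟩
        diag (λ i j → θ C (i ∷ []) * exp C (j ∷ []) * El) m
          E.≈⟨ diag-cong m _ (λ i j → θ C (i ∷ []) * X (j ∷ l ∷ [])) (λ i j _ → *-assoc _ _ _) ⟩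
        diag (λ i j → θ C (i ∷ []) * X (j ∷ l ∷ [])) m
          E.≈⟨ in-z-* (θ C) X m l ⟨
        (in-z (θ C) *ˢ X) (m ∷ l ∷ [])    E.∎
      w-part : (l ℕ.+ 0) times (Em * El) ≈ (in-w (θ D) *ˢ X) (m ∷ l ∷ [])
      w-part = E.begin
        (l ℕ.+ 0) times (Em * El)         E.≈⟨ ×-comm-* (l ℕ.+ 0) Em El ⟨
        Em * θ (exp D) (l ∷ [])           E.≈⟨ *-congˡ (θ-exp D D₀ DD (l ∷ [])) ⟩
        Em * diag (λ i j → θ D (i ∷ []) * exp D (j ∷ [])) l
          E.≈⟨ convolve-homo (Em *_) *-congˡ (zeroʳ Em) (distribˡ Em) (l ∷ [])
                 (λ β γ → θ D β * exp D γ) ⟩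
        diag (λ i j → Em * (θ D (i ∷ []) * exp D (j ∷ []))) l
          E.≈⟨ diag-cong l _ (λ i j → θ D (i ∷ []) * X (m ∷ j ∷ [])) (λ i j _ → move i j) ⟩
        diag (λ i j → θ D (i ∷ []) * X (m ∷ j ∷ [])) l
          E.≈⟨ in-w-* (θ D) X m l ⟨
        (in-w (θ D) *ˢ X) (m ∷ l ∷ [])    E.∎
        where
        move : ∀ i j → Em * (θ D (i ∷ []) * exp D (j ∷ [])) ≈ θ D (i ∷ []) * X (m ∷ j ∷ [])
        move i j = E.begin
          Em * (θ D (i ∷ []) * exp D (j ∷ []))   E.≈⟨ *-assoc _ _ _ ⟨
          Em * θ D (i ∷ []) * exp D (j ∷ [])
            E.≈⟨ *-congʳ (commute-exp (θ D (i ∷ [])) C (λ β →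
                   θ-commuteˡ D C (commute-sym C D CD) (i ∷ []) β) (m ∷ [])) ⟨
          θ D (i ∷ []) * Em * exp D (j ∷ [])     E.≈⟨ *-assoc _ _ _ ⟩
          θ D (i ∷ []) * X (m ∷ j ∷ [])          E.∎

  -- The same for a series Z equal to C(z) + D(w).
  exp-sum : ∀ (Z : Power 2) (C D : Power 1) → Z ≈ˢ in-z C +ˢ in-w D →
    NoConstantTerm C → NoConstantTerm D → Commute C C → Commute C D → Commute D D →
    ∀ m l → Series.exp K R _·_ Z (m ∷ l ∷ []) ≈
            Series.exp K R _·_ C (m ∷ []) * Series.exp K R _·_ D (l ∷ [])
  exp-sum Z C D e C₀ D₀ CC CD DD m l =
    trans (exp-cong e (m ∷ l ∷ [])) (exp-zw C D C₀ D₀ CC CD DD m l)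

-- Exchanging two exponentials whose exponents have a central commutator.

-- A field as an algebra over itself.
regular : (K : Field c ℓ) → IsAlgebra K (Field.rawRing K) (Field._*_ K)
regular K = record
  { ·-cong     = *-cong
  ; ·-distribˡ = distribˡ
  ; ·-distribʳ = λ x y a → distribʳ a x y
  ; ·-assoc    = *-assoc
  ; 1-·        = *-identityˡ
  ; ·-*ˡ       = *-assoc
  ; ·-*ʳ       = λ x a b → x∙yz≈y∙xz a x b
  }
  where
  open Field K
  open CommutativeSemigroupProperties *-commutativeSemigroup using (x∙yz≈y∙xz)

module Commutation (K : Field c ℓ) (char0 : Characteristic0 (Field.commutativeRing K)) (R : RawRing r ρ)
                   (laws : RingLaws R)
                   (_·_ : Field.Carrier K → RawRing.Carrier R → RawRing.Carrier R)
                   (isAlgebra : IsAlgebra K R _·_) where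
  private module K = Field K
  open Ring (fromLaws R laws)
  open IsAlgebra isAlgebra
  open Exponentials K char0 R laws _·_ isAlgebra
  open FiniteSums +-commutativeMonoid
  open MultProperties +-commutativeMonoid using () renaming (_×_ to _times_)
  open AbelianGroupProperties +-abelianGroup using (⁻¹-∙-comm)
  private
    module E = SetoidReasoning setoid
    module Scalar = Exponentials K char0 K.rawRing K.isRing K._*_ (regular K)
    module KM = SemiringMult K.semiring
    module S = Ring (series 1)
    module SE = SetoidReasoning S.setoid
    module SM = SemiringMult S.semiring
    module SF = FiniteSums S.+-commutativeMonoid
    module RP = RingProperties (series 1)

  -- Power series in x over the ring of power series in w.
  _·ˢ_ : K.Carrier → Power 1 → Power 1
  (x ·ˢ C) α = x · C α

  module T = PowerSeries K (seriesRing 1) (seriesLaws 1) _·ˢ_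
  private
    module TR = Ring (T.series 1)
    module TE = SetoidReasoning TR.setoid

  -- Multiplication by w ^ k.
  shift : ℕ → Power 1 → Power 1
  shift zero    C j            = C j
  shift (suc k) C (zero ∷ [])  = 0#
  shift (suc k) C (suc j ∷ []) = shift k C (j ∷ [])

  shift-cong : ∀ k {C D} → C ≈ˢ D → shift k C ≈ˢ shift k D
  shift-cong zero    e j            = e j
  shift-cong (suc k) e (zero ∷ [])  = refl
  shift-cong (suc k) e (suc j ∷ []) = shift-cong k e (j ∷ [])

  shift-* : ∀ k C D → shift k C *ˢ D ≈ˢ shift k (C *ˢ D)
  shift-* zero    C D j            = refl
  shift-* (suc k) C D (zero ∷ [])  = trans (+-identityʳ _) (zeroˡ _)
  shift-* (suc k) C D (suc j ∷ []) =
    trans (+-congʳ (zeroˡ _)) (trans (+-identityˡ _) (shift-* k C D (j ∷ [])))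

  shift-shift : ∀ k m C → shift k (shift m C) ≈ˢ shift (k ℕ.+ m) C
  shift-shift zero    m C j            = refl
  shift-shift (suc k) m C (zero ∷ [])  = refl
  shift-shift (suc k) m C (suc j ∷ []) = shift-shift k m C (j ∷ [])

  shift-scale : ∀ x k C j → shift k (λ i → x · C i) j ≈ x · shift k C j
  shift-scale x zero    C j            = refl
  shift-scale x (suc k) C (zero ∷ [])  = sym (·-zeroʳ x)
  shift-scale x (suc k) C (suc j ∷ []) = shift-scale x k C (j ∷ [])

  -- The series x w ^ k.
  monomial : K.Carrier → ℕ → Power 1
  monomial x k = shift k (λ j → x · one j)

  monomial-* : ∀ x k C j → (monomial x k *ˢ C) j ≈ x · shift k C j
  monomial-* x k C j = E.begin
    (shift k (λ i → x · one i) *ˢ C) j     E.≈⟨ shift-* k (λ i → x · one i) C j ⟩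
    shift k ((λ i → x · one i) *ˢ C) j     E.≈⟨ shift-cong k scale j ⟩
    shift k (λ i → x · C i) j              E.≈⟨ shift-scale x k C j ⟩
    x · shift k C j                        E.∎
    where
    scale : (λ i → x · one i) *ˢ C ≈ˢ (λ i → x · C i)
    scale i = E.begin
      convolve (λ β γ → (x · one β) * C γ) i
        E.≈⟨ convolve-cong′ i _ _ (λ β γ → ·-*ˡ x (one β) (C γ)) ⟩
      convolve (λ β γ → x · (one β * C γ)) i
        E.≈⟨ convolve-homo (x ·_) (·-cong K.refl) (·-zeroʳ x) (·-distribˡ x) i
               (λ β γ → one β * C γ) ⟨
      x · (one *ˢ C) i   E.≈⟨ ·-cong K.refl (*ˢ-identityˡ C i) ⟩
      x · C i            E.∎

  monomial-coeff : ∀ x k j → monomial x k j ≈ x · shift k one j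
  monomial-coeff x k j = shift-scale x k one j

  monomial-cong : ∀ {x y} k → x K.≈ y → monomial x k S.≈ monomial y k
  monomial-cong k e = shift-cong k (λ j → ·-cong e refl)

  monomial-+ : ∀ k x y → monomial (x K.+ y) k S.≈ monomial x k S.+ monomial y k
  monomial-+ k x y j = E.begin
    monomial (x K.+ y) k j                     E.≈⟨ monomial-coeff _ k j ⟩
    (x K.+ y) · shift k one j                  E.≈⟨ ·-distribʳ x y _ ⟩
    (x · shift k one j) + (y · shift k one j)  E.≈⟨ +-cong (monomial-coeff x k j) (monomial-coeff y k j) ⟨
    monomial x k j + monomial y k j            E.∎

  monomial-0 : ∀ k → monomial K.0# k S.≈ S.0#
  monomial-0 k j = trans (monomial-coeff K.0# k j) (·-zeroˡ _)

  monomial-monomial : ∀ x y k m → monomial x k S.* monomial y m S.≈ monomial (x K.* y) (k ℕ.+ m)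
  monomial-monomial x y k m j = E.begin
    (monomial x k *ˢ monomial y m) j     E.≈⟨ monomial-* x k (monomial y m) j ⟩
    x · shift k (monomial y m) j         E.≈⟨ ·-cong K.refl (shift-shift k m (λ i → y · one i) j) ⟩
    x · monomial y (k ℕ.+ m) j           E.≈⟨ ·-cong K.refl (monomial-coeff y (k ℕ.+ m) j) ⟩
    x · (y · shift (k ℕ.+ m) one j)      E.≈⟨ ·-assoc x y _ ⟨
    (x K.* y) · shift (k ℕ.+ m) one j    E.≈⟨ monomial-coeff (x K.* y) (k ℕ.+ m) j ⟨
    monomial (x K.* y) (k ℕ.+ m) j       E.∎

  shift-one-diagonal : ∀ k → shift k one (k ∷ []) ≈ 1#
  shift-one-diagonal zero    = refl
  shift-one-diagonal (suc k) = shift-one-diagonal k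

  shift-one-off : ∀ k j → k ≢ j → shift k one (j ∷ []) ≈ 0#
  shift-one-off zero    zero    k≢j = ⊥-elim (k≢j ≡.refl)
  shift-one-off zero    (suc j) k≢j = refl
  shift-one-off (suc k) zero    k≢j = refl
  shift-one-off (suc k) (suc j) k≢j = shift-one-off k j (λ e → k≢j (≡.cong suc e))

  shift-one-commute : ∀ a k j → shift k one j * a ≈ a * shift k one j
  shift-one-commute a zero    j            = sym (commute-one a j)
  shift-one-commute a (suc k) (zero ∷ [])  = trans (zeroˡ a) (sym (zeroʳ a))
  shift-one-commute a (suc k) (suc j ∷ []) = shift-one-commute a k (j ∷ [])

  monomial-central : ∀ x k C → monomial x k S.* C S.≈ C S.* monomial x k
  monomial-central x k C = *ˢ-comm (monomial x k) C (λ β γ → E.begin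
    monomial x k β * C γ       E.≈⟨ *-congʳ (monomial-coeff x k β) ⟩
    (x · shift k one β) * C γ  E.≈⟨ ·-*ˡ x _ _ ⟩
    x · (shift k one β * C γ)  E.≈⟨ ·-cong K.refl (shift-one-commute (C γ) k β) ⟩
    x · (C γ * shift k one β)  E.≈⟨ ·-*ʳ x _ _ ⟨
    C γ * (x · shift k one β)  E.≈⟨ *-congˡ (monomial-coeff x k β) ⟨
    C γ * monomial x k β       E.∎)

  monomial-times : ∀ k n x → n SM.× monomial x k S.≈ monomial (n KM.× x) k
  monomial-times k zero    x = S.sym (monomial-0 k)
  monomial-times k (suc n) x =
    S.trans (S.+-congˡ {x = monomial x k} (monomial-times k n x)) (S.sym (monomial-+ k x (n KM.× x)))

  constant-+ : ∀ a b → constant {1} (a + b) S.≈ constant a S.+ constant b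
  constant-+ a b j = distribʳ (one j) a b

  constant-0 : constant {1} 0# S.≈ S.0#
  constant-0 j = zeroˡ (one j)

  constant-times : ∀ n a → n SM.× constant {1} a S.≈ constant (n times a)
  constant-times zero    a = S.sym constant-0
  constant-times (suc n) a =
    S.trans (S.+-congˡ {x = constant a} (constant-times n a)) (S.sym (constant-+ a (n times a)))

  constant-constant : ∀ a b → constant {1} a S.* constant b S.≈ constant (a * b)
  constant-constant a b j = trans (constant-*ˡ a (constant b) j) (sym (*-assoc a b (one j)))

  -- A power series in x with constant coefficients in w.
  inner : Power 1 → T.Power 1
  inner C (n ∷ []) = constant (C (n ∷ []))

  -- The series C(x w).
  twist : Scalar.Power 1 → T.Power 1
  twist C (n ∷ []) = monomial (C (n ∷ [])) n

  θ-inner : ∀ C → T.θ (inner C) TR.≈ inner (θ C)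
  θ-inner C (n ∷ []) = constant-times (n ℕ.+ 0) (C (n ∷ []))

  inner-* : ∀ C D → inner C TR.* inner D TR.≈ inner (C *ˢ D)
  inner-* C D (n ∷ []) = S.trans
    (SF.diag-cong n (λ i j → constant (C (i ∷ [])) S.* constant (D (j ∷ [])))
                    (λ i j → constant (C (i ∷ []) * D (j ∷ [])))
                    (λ i j _ → constant-constant (C (i ∷ [])) (D (j ∷ []))))
    (S.sym (∑<-homo +-commutativeMonoid S.+-commutativeMonoid constant constant-0 constant-+
      (suc n) (λ i → C (i ∷ []) * D ((n ∸ i) ∷ []))))

  θ-twist : ∀ C → T.θ (twist C) TR.≈ twist (Scalar.θ C)
  θ-twist C (n ∷ []) = monomial-times n (n ℕ.+ 0) (C (n ∷ []))

  twist-* : ∀ C D → twist C TR.* twist D TR.≈ twist (C Scalar.*ˢ D)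
  twist-* C D (n ∷ []) = S.trans
    (SF.diag-cong n (λ i j → monomial (C (i ∷ [])) i S.* monomial (D (j ∷ [])) j)
                    (λ i j → monomial (C (i ∷ []) K.* D (j ∷ [])) n)
                    (λ { i j ≡.refl → monomial-monomial (C (i ∷ [])) (D (j ∷ [])) i j }))
    (S.sym (∑<-homo K.+-commutativeMonoid S.+-commutativeMonoid (λ x → monomial x n)
      (monomial-0 n) (monomial-+ n) (suc n) (λ i → C (i ∷ []) K.* D ((n ∸ i) ∷ []))))

  twist-central : ∀ C D → twist C TR.* D TR.≈ D TR.* twist C
  twist-central C D = T.*ˢ-comm (twist C) D (λ { (n ∷ []) γ → monomial-central (C (n ∷ [])) n (D γ) })

  series-torsionFree : T.TorsionFree
  series-torsionFree n {x} {y} e j = torsionFree n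
    (trans (sym (times-pointwise (suc n) x j)) (trans (e j) (times-pointwise (suc n) y j)))

  -- Exponents A(w) and B(x) with [Bₙ, Aⱼ] = cₙ for n = j and 0 otherwise.
  module _ (A B : Power 1) (c : Scalar.Power 1)
           (A₀ : NoConstantTerm A) (B₀ : NoConstantTerm B) (c₀ : Scalar.NoConstantTerm c)
           (AA : Commute A A) (BB : Commute B B)
           (BA : ∀ n j → B (n ∷ []) * A (j ∷ []) ≈
                         A (j ∷ []) * B (n ∷ []) + monomial (c (n ∷ [])) n (j ∷ [])) where

    -- The commutator of Bₙ with exp A(w) is cₙ wⁿ exp A(w). Equivalently, with
    -- b = Bₙ and u = cₙ wⁿ, exp A(w) b = (b - u) exp A(w).
    commutator-exp : ∀ n → constant (B (n ∷ [])) S.* exp A S.≈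
      exp A S.* constant (B (n ∷ [])) S.+ monomial (c (n ∷ [])) n S.* exp A
    commutator-exp n = SE.begin
      b S.* E                              SE.≈⟨ S.+-identityʳ (b S.* E) ⟨
      b S.* E S.+ S.0#                     SE.≈⟨ S.+-congˡ {x = b S.* E} (S.-‿inverseˡ (u S.* E)) ⟨
      b S.* E S.+ (S.- (u S.* E) S.+ u S.* E) SE.≈⟨ S.+-assoc (b S.* E) (S.- (u S.* E)) (u S.* E) ⟨
      (b S.* E S.- u S.* E) S.+ u S.* E    SE.≈⟨ S.+-congʳ {x = u S.* E} (SE.begin
        b S.* E S.- u S.* E                SE.≈⟨ S.+-congˡ {x = b S.* E} (RP.-‿distribˡ-* u E) ⟩
        b S.* E S.+ (S.- u) S.* E          SE.≈⟨ S.distribʳ E b (S.- u) ⟨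
        v S.* E                            SE.≈⟨ conj ⟨
        E S.* b                            SE.∎) ⟩
      E S.* b S.+ u S.* E                  SE.∎
      where
      E b u v M : Power 1
      E = exp A
      b = constant (B (n ∷ []))
      u = monomial (c (n ∷ [])) n
      v = b S.- u
      M = θ A
      bA : b S.* A S.≈ A S.* b S.+ u
      bA (j ∷ []) = E.begin
        (b *ˢ A) (j ∷ [])              E.≈⟨ constant-*ˡ (B (n ∷ [])) A (j ∷ []) ⟩
        B (n ∷ []) * A (j ∷ [])        E.≈⟨ BA n j ⟩
        A (j ∷ []) * B (n ∷ []) + u (j ∷ [])
          E.≈⟨ +-congʳ (constant-*ʳ A (B (n ∷ [])) (j ∷ [])) ⟨
        (A *ˢ b) (j ∷ []) + u (j ∷ []) E.∎
      θb : θ b S.≈ S.0#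
      θb = θ-constant (B (n ∷ []))
      -- θ applied to the relation bA.
      bM : b S.* M S.≈ M S.* b S.+ θ u
      bM = SE.begin
        b S.* M                        SE.≈⟨ S.+-identityˡ (b S.* M) ⟨
        S.0# S.+ b S.* M               SE.≈⟨ S.+-congʳ {x = b S.* M} (S.zeroˡ A) ⟨
        S.0# S.* A S.+ b S.* M         SE.≈⟨ S.+-congʳ {x = b S.* M} (S.*-congʳ {x = A} θb) ⟨
        θ b S.* A S.+ b S.* M          SE.≈⟨ θ-* b A ⟨
        θ (b S.* A)                    SE.≈⟨ θ-cong bA ⟩
        θ (A S.* b S.+ u)              SE.≈⟨ θ-+ (A S.* b) u ⟩
        θ (A S.* b) S.+ θ u            SE.≈⟨ S.+-congʳ {x = θ u} (SE.begin
          θ (A S.* b)                  SE.≈⟨ θ-* A b ⟩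
          M S.* b S.+ A S.* θ b        SE.≈⟨ S.+-congˡ {x = M S.* b} (S.*-congˡ {x = A} θb) ⟩
          M S.* b S.+ A S.* S.0#       SE.≈⟨ S.+-congˡ {x = M S.* b} (S.zeroʳ A) ⟩
          M S.* b S.+ S.0#             SE.≈⟨ S.+-identityʳ (M S.* b) ⟩
          M S.* b                      SE.∎) ⟩
        M S.* b S.+ θ u                SE.∎
      θv : θ v S.≈ S.- θ u
      θv = SE.begin
        θ (b S.- u)                    SE.≈⟨ θ-+ b (S.- u) ⟩
        θ b S.+ θ (S.- u)              SE.≈⟨ S.+-congʳ {x = θ (S.- u)} θb ⟩
        S.0# S.+ θ (S.- u)             SE.≈⟨ S.+-identityˡ (θ (S.- u)) ⟩
        θ (S.- u)                      SE.≈⟨ (λ j → times-neg (deg j) (u j)) ⟩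
        S.- θ u                        SE.∎
        where
        times-neg : ∀ n a → n times (- a) ≈ - (n times a)
        times-neg zero    a = sym (RingProperties.-0#≈0# (fromLaws R laws))
        times-neg (suc n) a = trans (+-congˡ (times-neg n a)) (⁻¹-∙-comm a (n times a))
      θv+vM : θ v S.+ v S.* M S.≈ M S.* v
      θv+vM = SE.begin
        θ v S.+ v S.* M
          SE.≈⟨ S.+-cong θv (S.distribʳ M b (S.- u)) ⟩
        S.- θ u S.+ (b S.* M S.+ (S.- u) S.* M)
          SE.≈⟨ S.+-congˡ {x = S.- θ u} (S.+-cong bM (S.sym (RP.-‿distribˡ-* u M))) ⟩
        S.- θ u S.+ ((M S.* b S.+ θ u) S.- u S.* M)
          SE.≈⟨ S.+-assoc (S.- θ u) (M S.* b S.+ θ u) (S.- (u S.* M)) ⟨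
        (S.- θ u S.+ (M S.* b S.+ θ u)) S.- u S.* M
          SE.≈⟨ S.+-cong (λ j → E.begin
            - θ u j + ((M S.* b) j + θ u j)   E.≈⟨ +-comm _ _ ⟩
            (M S.* b) j + θ u j - θ u j       E.≈⟨ +-assoc _ _ _ ⟩
            (M S.* b) j + (θ u j - θ u j)     E.≈⟨ +-congˡ (-‿inverseʳ _) ⟩
            (M S.* b) j + 0#                  E.≈⟨ +-identityʳ _ ⟩
            (M S.* b) j                       E.∎)
            (S.-‿cong (monomial-central (c (n ∷ [])) n M)) ⟩
        M S.* b S.- M S.* u
          SE.≈⟨ S.+-congˡ {x = M S.* b} (RP.-‿distribʳ-* M u) ⟩
        M S.* b S.+ M S.* (S.- u)
          SE.≈⟨ S.distribˡ M b (S.- u) ⟨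
        M S.* v SE.∎
      -- For n = 0 this needs c₀ = 0.
      u₀ : u (0 ∷ []) ≈ 0#
      u₀ with n ℕ.≟ 0
      ... | yes ≡.refl = trans (·-cong (c₀ (0 ∷ []) ≡.refl) refl) (·-zeroˡ 1#)
      ... | no n≢0 = trans (monomial-coeff (c (n ∷ [])) n (0 ∷ []))
                      (trans (·-cong K.refl (shift-one-off n 0 n≢0)) (·-zeroʳ _))
      conj₀ : ∀ α → deg α ≡ 0 → (E S.* b) α ≈ (v S.* E) α
      conj₀ (zero ∷ []) _ = +-congʳ (E.begin
        exp A (0 ∷ []) * (B (n ∷ []) * 1#)
          E.≈⟨ *-cong (exp-deg0 A (0 ∷ []) ≡.refl) (*-identityʳ _) ⟩
        1# * B (n ∷ [])             E.≈⟨ *-identityˡ _ ⟩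
        B (n ∷ [])                  E.≈⟨ *-identityʳ _ ⟨
        B (n ∷ []) * 1#             E.≈⟨ +-identityʳ _ ⟨
        B (n ∷ []) * 1# + 0#        E.≈⟨ +-congˡ (trans (-‿cong u₀) (RingProperties.-0#≈0# (fromLaws R laws))) ⟨
        v (0 ∷ [])                  E.≈⟨ *-identityʳ _ ⟨
        v (0 ∷ []) * 1#             E.≈⟨ *-congˡ (exp-deg0 A (0 ∷ []) ≡.refl) ⟨
        v (0 ∷ []) * exp A (0 ∷ []) E.∎)
      conj : E S.* b S.≈ v S.* E
      conj = intertwine torsionFree M E b v (θ-deg0 A) (θ-exp A A₀ AA) θb θv+vM conj₀

    private
      F : Scalar.Power 1
      F = Scalar.exp c

      -- The series exp B(x), F(x w), B(x), exp A(w), c(x w) and θ B(x), where θ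
      -- is the Euler operator in x.
      G H B̂ Ê u M : T.Power 1
      G = inner (exp B)
      H = twist F
      B̂ = inner B
      Ê = T.constant (exp A)
      u = twist c
      M = T.θ B̂

      θ-G : T.θ G TR.≈ M TR.* G
      θ-G = TE.begin
        T.θ G                              TE.≈⟨ θ-inner (exp B) ⟩
        inner (θ (exp B))                  TE.≈⟨ (λ { (n ∷ []) j → *-congʳ (θ-exp B B₀ BB (n ∷ [])) }) ⟩
        inner (θ B *ˢ exp B)               TE.≈⟨ inner-* (θ B) (exp B) ⟨
        inner (θ B) TR.* G                 TE.≈⟨ TR.*-congʳ {x = G} (θ-inner B) ⟨
        M TR.* G                           TE.∎

      θ-H : T.θ H TR.≈ T.θ u TR.* H
      θ-H = TE.begin
        T.θ H                              TE.≈⟨ θ-twist F ⟩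
        twist (Scalar.θ F)                 TE.≈⟨ (λ { (n ∷ []) → monomial-cong n
                                                   (Scalar.θ-exp c c₀ (λ _ _ → K.*-comm _ _) (n ∷ [])) }) ⟩
        twist (Scalar.θ c Scalar.*ˢ F)     TE.≈⟨ twist-* (Scalar.θ c) F ⟨
        twist (Scalar.θ c) TR.* H          TE.≈⟨ TR.*-congʳ {x = H} (θ-twist c) ⟨
        T.θ u TR.* H                       TE.∎

      θ-Ê : T.θ Ê TR.≈ TR.0#
      θ-Ê = T.θ-constant (exp A)

      drop-θÊ : ∀ X → X TR.* T.θ Ê TR.≈ TR.0#
      drop-θÊ X = TR.trans (TR.*-congˡ {x = X} θ-Ê) (TR.zeroʳ X)

      B̂Ê : B̂ TR.* Ê TR.≈ Ê TR.* B̂ TR.+ u TR.* Ê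
      B̂Ê (n ∷ []) = SE.begin
        (B̂ TR.* Ê) (n ∷ [])                SE.≈⟨ T.constant-*ʳ B̂ (exp A) (n ∷ []) ⟩
        B̂ (n ∷ []) S.* exp A               SE.≈⟨ commutator-exp n ⟩
        exp A S.* B̂ (n ∷ []) S.+ u (n ∷ []) S.* exp A
          SE.≈⟨ S.+-cong (T.constant-*ˡ (exp A) B̂ (n ∷ [])) (T.constant-*ʳ u (exp A) (n ∷ [])) ⟨
        (Ê TR.* B̂) (n ∷ []) S.+ (u TR.* Ê) (n ∷ []) SE.∎

      -- θ applied to the relation B̂Ê.
      MÊ : M TR.* Ê TR.≈ Ê TR.* M TR.+ T.θ u TR.* Ê
      MÊ = TE.begin
        M TR.* Ê                           TE.≈⟨ leibnizʳ B̂ ⟨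
        T.θ (B̂ TR.* Ê)                     TE.≈⟨ T.θ-cong B̂Ê ⟩
        T.θ (Ê TR.* B̂ TR.+ u TR.* Ê)       TE.≈⟨ T.θ-+ (Ê TR.* B̂) (u TR.* Ê) ⟩
        T.θ (Ê TR.* B̂) TR.+ T.θ (u TR.* Ê) TE.≈⟨ TR.+-cong leibnizˡ (leibnizʳ u) ⟩
        Ê TR.* M TR.+ T.θ u TR.* Ê         TE.∎
        where
        leibnizʳ : ∀ X → T.θ (X TR.* Ê) TR.≈ T.θ X TR.* Ê
        leibnizʳ X = TE.begin
          T.θ (X TR.* Ê)                   TE.≈⟨ T.θ-* X Ê ⟩
          T.θ X TR.* Ê TR.+ X TR.* T.θ Ê   TE.≈⟨ TR.+-congˡ {x = T.θ X TR.* Ê} (drop-θÊ X) ⟩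
          T.θ X TR.* Ê TR.+ TR.0#          TE.≈⟨ TR.+-identityʳ (T.θ X TR.* Ê) ⟩
          T.θ X TR.* Ê                     TE.∎
        leibnizˡ : T.θ (Ê TR.* B̂) TR.≈ Ê TR.* M
        leibnizˡ = TE.begin
          T.θ (Ê TR.* B̂)                   TE.≈⟨ T.θ-* Ê B̂ ⟩
          T.θ Ê TR.* B̂ TR.+ Ê TR.* M       TE.≈⟨ TR.+-congʳ {x = Ê TR.* M} (TR.*-congʳ {x = B̂} θ-Ê) ⟩
          TR.0# TR.* B̂ TR.+ Ê TR.* M       TE.≈⟨ TR.+-congʳ {x = Ê TR.* M} (TR.zeroˡ B̂) ⟩
          TR.0# TR.+ Ê TR.* M              TE.≈⟨ TR.+-identityˡ (Ê TR.* M) ⟩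
          Ê TR.* M                         TE.∎

      -- F(x w) exp A(w) solves the adjoint equation of exp B(x).
      adjoint : T.θ (H TR.* Ê) TR.+ (H TR.* Ê) TR.* M TR.≈ M TR.* (H TR.* Ê)
      adjoint = TE.begin
        T.θ (H TR.* Ê) TR.+ (H TR.* Ê) TR.* M
          TE.≈⟨ TR.+-cong θ-HÊ (TR.*-assoc H Ê M) ⟩
        H TR.* (T.θ u TR.* Ê) TR.+ H TR.* (Ê TR.* M)
          TE.≈⟨ TR.distribˡ H (T.θ u TR.* Ê) (Ê TR.* M) ⟨
        H TR.* (T.θ u TR.* Ê TR.+ Ê TR.* M)
          TE.≈⟨ TR.*-congˡ {x = H} (TR.+-comm (T.θ u TR.* Ê) (Ê TR.* M)) ⟩
        H TR.* (Ê TR.* M TR.+ T.θ u TR.* Ê)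
          TE.≈⟨ TR.*-congˡ {x = H} MÊ ⟨
        H TR.* (M TR.* Ê)                  TE.≈⟨ TR.*-assoc H M Ê ⟨
        (H TR.* M) TR.* Ê                  TE.≈⟨ TR.*-congʳ {x = Ê} (twist-central F M) ⟩
        (M TR.* H) TR.* Ê                  TE.≈⟨ TR.*-assoc M H Ê ⟩
        M TR.* (H TR.* Ê)                  TE.∎
        where
        θ-HÊ : T.θ (H TR.* Ê) TR.≈ H TR.* (T.θ u TR.* Ê)
        θ-HÊ = TE.begin
          T.θ (H TR.* Ê)                   TE.≈⟨ T.θ-* H Ê ⟩
          T.θ H TR.* Ê TR.+ H TR.* T.θ Ê   TE.≈⟨ TR.+-congˡ {x = T.θ H TR.* Ê} (drop-θÊ H) ⟩
          T.θ H TR.* Ê TR.+ TR.0#          TE.≈⟨ TR.+-identityʳ (T.θ H TR.* Ê) ⟩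
          T.θ H TR.* Ê                     TE.≈⟨ TR.*-congʳ {x = Ê} θ-H ⟩
          (T.θ u TR.* H) TR.* Ê            TE.≈⟨ TR.*-congʳ {x = Ê} (twist-central F (T.θ u)) ⟨
          (H TR.* T.θ u) TR.* Ê            TE.≈⟨ TR.*-assoc H (T.θ u) Ê ⟩
          H TR.* (T.θ u TR.* Ê)            TE.∎

      same-constant-term : ∀ α → T.deg α ≡ 0 → (G TR.* Ê) α S.≈ ((H TR.* Ê) TR.* G) α
      same-constant-term (zero ∷ []) _ = SE.begin
        (G TR.* Ê) o                       SE.≈⟨ T.constant-*ʳ G (exp A) o ⟩
        G o S.* exp A                      SE.≈⟨ S.*-congʳ {x = exp A} G₀ ⟩
        S.1# S.* exp A                     SE.≈⟨ S.*-congʳ {x = exp A} H₀ ⟨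
        H o S.* exp A                      SE.≈⟨ T.constant-*ʳ H (exp A) o ⟨
        (H TR.* Ê) o                       SE.≈⟨ S.*-identityʳ ((H TR.* Ê) o) ⟨
        (H TR.* Ê) o S.* S.1#              SE.≈⟨ S.*-congˡ {x = (H TR.* Ê) o} G₀ ⟨
        (H TR.* Ê) o S.* G o               SE.≈⟨ S.+-identityʳ ((H TR.* Ê) o S.* G o) ⟨
        ((H TR.* Ê) TR.* G) o              SE.∎
        where
        o : Vec ℕ 1
        o = 0 ∷ []
        G₀ : G o S.≈ S.1#
        G₀ j = trans (*-congʳ (exp-deg0 B o ≡.refl)) (*-identityˡ _)
        H₀ : H o S.≈ S.1#
        H₀ j = trans (·-cong (Scalar.exp-deg0 c o ≡.refl) refl) (1-· _)

      -- exp B(x) exp A(w) = F(x w) exp A(w) exp B(x).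
      exchange : G TR.* Ê TR.≈ (H TR.* Ê) TR.* G
      exchange = T.intertwine series-torsionFree M G Ê (H TR.* Ê) (T.θ-deg0 B̂)
        θ-G θ-Ê adjoint same-constant-term

    -- The coefficient of x ^ n w ^ j in that identity.
    exp-exchange : ∀ n j → Series.exp K R _·_ B (n ∷ []) * Series.exp K R _·_ A (j ∷ []) ≈
      diag (λ k b → (Series.exp K K.rawRing K._*_ c (k ∷ []) ·
        shift k (Series.exp K R _·_ A) (j ∷ [])) * Series.exp K R _·_ B (b ∷ [])) n
    exp-exchange n j = E.begin
      exp B (n ∷ []) * exp A (j ∷ [])
        E.≈⟨ constant-*ˡ (exp B (n ∷ [])) (exp A) (j ∷ []) ⟨
      (G (n ∷ []) S.* exp A) (j ∷ [])
        E.≈⟨ T.constant-*ʳ G (exp A) (n ∷ []) (j ∷ []) ⟨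
      (G TR.* Ê) (n ∷ []) (j ∷ [])
        E.≈⟨ exchange (n ∷ []) (j ∷ []) ⟩
      SF.diag (λ k b → (H TR.* Ê) (k ∷ []) S.* G (b ∷ [])) n (j ∷ [])
        E.≈⟨ ∑<-homo S.+-commutativeMonoid +-commutativeMonoid (λ C → C (j ∷ [])) refl
               (λ _ _ → refl) (suc n) (λ k → (H TR.* Ê) (k ∷ []) S.* G ((n ∸ k) ∷ [])) ⟩
      diag (λ k b → ((H TR.* Ê) (k ∷ []) S.* G (b ∷ [])) (j ∷ [])) n
        E.≈⟨ diag-cong n (λ k b → ((H TR.* Ê) (k ∷ []) S.* G (b ∷ [])) (j ∷ [])) _ (λ k b _ → E.begin
          ((H TR.* Ê) (k ∷ []) S.* G (b ∷ [])) (j ∷ [])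
            E.≈⟨ constant-*ʳ ((H TR.* Ê) (k ∷ [])) (exp B (b ∷ [])) (j ∷ []) ⟩
          (H TR.* Ê) (k ∷ []) (j ∷ []) * exp B (b ∷ [])
            E.≈⟨ *-congʳ (T.constant-*ʳ H (exp A) (k ∷ []) (j ∷ [])) ⟩
          (H (k ∷ []) S.* exp A) (j ∷ []) * exp B (b ∷ [])
            E.≈⟨ *-congʳ (monomial-* (F (k ∷ [])) k (exp A) (j ∷ [])) ⟩
          (F (k ∷ []) · shift k (exp A) (j ∷ [])) * exp B (b ∷ []) E.∎) ⟩
      diag (λ k b → (F (k ∷ []) · shift k (exp A) (j ∷ [])) * exp B (b ∷ [])) n E.∎

-- Vertex operators.

odd-nonZero : ∀ n → Odd n → NonZero n
odd-nonZero (suc n) _ = _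

module VertexOperators (K : Field c ℓ) (char0 : Characteristic0 (Field.commutativeRing K)) where
  open Fock K
  open Operator using (⟦_⟧)
  private
    module K = Field K
    module G = CommutativeRing Γ-ring
    module Γs = FiniteSums G.+-commutativeMonoid
    module S = SetoidReasoning Γ-setoid
  open Γs using (∑<; diag)
  open FieldProperties K
  open K using () renaming (Carrier to 𝕂)

  -- The linear operators on Γ form a K-algebra under composition.
  operatorLaws : RingLaws (Fock.operatorRing K)
  operatorLaws = record
    { +-isAbelianGroup = record
      { isGroup = record
        { isMonoid = record
          { isSemigroup = record
            { isMagma = record
              { isEquivalence = record
                { refl  = λ _ → refl
                ; sym   = λ e f → sym (e f)
                ; trans = λ e e′ f → trans (e f) (e′ f) }
              ; ∙-cong = λ e e′ f → +-cong (e f) (e′ f) }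
            ; assoc = λ Φ Ψ Ω f → +-assoc (⟦ Φ ⟧ f) (⟦ Ψ ⟧ f) (⟦ Ω ⟧ f) }
          ; identity = (λ Φ f → G.+-identityˡ (⟦ Φ ⟧ f)) , (λ Φ f → G.+-identityʳ (⟦ Φ ⟧ f)) }
        ; inverse = (λ Φ f → G.-‿inverseˡ (⟦ Φ ⟧ f)) , (λ Φ f → G.-‿inverseʳ (⟦ Φ ⟧ f))
        ; ⁻¹-cong = λ e f → *-cong refl (e f) }
      ; comm = λ Φ Ψ f → +-comm (⟦ Φ ⟧ f) (⟦ Ψ ⟧ f) }
    ; *-cong = λ {Φ} {Φ′} {Ψ} {Ψ′} e e′ f → trans (Operator.cong Φ (e′ f)) (e (⟦ Ψ′ ⟧ f))
    ; *-assoc = λ _ _ _ _ → refl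
    ; *-identity = (λ _ _ → refl) , (λ _ _ → refl)
    ; distrib = (λ Φ Ψ Ω f → Operator.+-homo Φ (⟦ Ψ ⟧ f) (⟦ Ω ⟧ f)) , (λ _ _ _ _ → refl) }

  operatorAlgebra : IsAlgebra K (Fock.operatorRing K) (Fock._·_ K)
  operatorAlgebra = record
    { ·-cong     = λ e e′ f → *-cong (con-cong e) (e′ f)
    ; ·-distribˡ = λ x Φ Ψ f → G.distribˡ (con x) (⟦ Φ ⟧ f) (⟦ Ψ ⟧ f)
    ; ·-distribʳ = λ x y Φ f → trans (*-cong (con-+ x y) refl) (distribʳ _ _ _)
    ; ·-assoc    = λ x y Φ f → trans (*-cong (con-* x y) refl) (*-assoc _ _ _)
    ; 1-·        = λ Φ f → *-identityˡ (⟦ Φ ⟧ f)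
    ; ·-*ˡ       = λ _ _ _ _ → refl
    ; ·-*ʳ       = λ x Φ Ψ f → Operator.·-homo Φ x (⟦ Ψ ⟧ f)
    }

  private module O = Ring (fromLaws (Fock.operatorRing K) operatorLaws)
  open Commutation K char0 (Fock.operatorRing K) operatorLaws (Fock._·_ K) operatorAlgebra
  open Exponentials K char0 (Fock.operatorRing K) operatorLaws (Fock._·_ K) operatorAlgebra using (NoConstantTerm; Commute; exp-sum)
  private
    module Sc = Exponentials K char0 K.rawRing K.isRing K._*_ (regular K)
    module KE = SetoidReasoning K.setoid

  ·-commute : ∀ x y Φ Ψ → Φ ∘ᵒ Ψ ≈ᵒ Ψ ∘ᵒ Φ → (x · Φ) ∘ᵒ (y · Ψ) ≈ᵒ (y · Ψ) ∘ᵒ (x · Φ)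
  ·-commute x y Φ Ψ e f = S.begin
    x *ₗ ⟦ Φ ⟧ (y *ₗ ⟦ Ψ ⟧ f)     S.≈⟨ *-cong refl (Operator.·-homo Φ y (⟦ Ψ ⟧ f)) ⟩
    x *ₗ y *ₗ ⟦ Φ ⟧ (⟦ Ψ ⟧ f)     S.≈⟨ x∙yz≈y∙xz (con x) (con y) _ ⟩
    y *ₗ x *ₗ ⟦ Φ ⟧ (⟦ Ψ ⟧ f)     S.≈⟨ *-cong refl (*-cong refl (e f)) ⟩
    y *ₗ x *ₗ ⟦ Ψ ⟧ (⟦ Φ ⟧ f)     S.≈⟨ *-cong refl (Operator.·-homo Ψ x (⟦ Φ ⟧ f)) ⟨
    y *ₗ ⟦ Ψ ⟧ (x *ₗ ⟦ Φ ⟧ f)     S.∎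
    where open CommutativeSemigroupProperties G.*-commutativeSemigroup using (x∙yz≈y∙xz)

  ∂-comm : ∀ n m f → ∂ n (∂ m f) ≈ ∂ m (∂ n f)
  ∂-comm n m (con x) = refl
  ∂-comm n m (p k odd) with k ℕ.≟ m | k ℕ.≟ n
  ... | yes _ | yes _ = refl
  ... | yes _ | no _  = refl
  ... | no _  | yes _ = refl
  ... | no _  | no _  = refl
  ∂-comm n m (f + g) = +-cong (∂-comm n m f) (∂-comm n m g)
  ∂-comm n m (f * g) = S.begin
    (∂ n (∂ m f) * g + ∂ m f * ∂ n g) + (∂ n f * ∂ m g + f * ∂ n (∂ m g))
      S.≈⟨ +-cong (+-cong (*-cong (∂-comm n m f) refl) refl) (+-cong refl (*-cong refl (∂-comm n m g))) ⟩
    (∂ m (∂ n f) * g + ∂ m f * ∂ n g) + (∂ n f * ∂ m g + f * ∂ m (∂ n g))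
      S.≈⟨ interchange _ _ _ _ ⟩
    (∂ m (∂ n f) * g + ∂ n f * ∂ m g) + (∂ m f * ∂ n g + f * ∂ m (∂ n g)) S.∎
    where open CommutativeSemigroupProperties G.+-commutativeSemigroup using (interchange)

  -- The canonical commutation relations.
  ∂-p-same : ∀ n .(odd : Odd n) → derivative n ∘ᵒ a₋ n odd ≈ᵒ (a₋ n odd ∘ᵒ derivative n) +ᵒ idᵒ
  ∂-p-same n odd f with n ℕ.≟ n
  ... | yes _  = trans (+-comm _ _) (+-cong refl (*-identityˡ f))
  ... | no n≢n = ⊥-elim (n≢n ≡.refl)

  ∂-p-other : ∀ n m .(odd : Odd m) → n ≢ m → derivative n ∘ᵒ a₋ m odd ≈ᵒ a₋ m odd ∘ᵒ derivative n
  ∂-p-other n m odd n≢m f with m ℕ.≟ n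
  ... | yes m≡n = ⊥-elim (n≢m (≡.sym m≡n))
  ... | no _    = trans (+-cong (zeroˡ f) refl) (+-identityˡ _)

  A-no-constant : ∀ τ → NoConstantTerm (A τ)
  A-no-constant τ (zero ∷ []) _ _ = refl

  B-no-constant : ∀ τ → NoConstantTerm (B τ)
  B-no-constant τ (zero ∷ []) _ _ = refl

  A-commute : ∀ τ σ → Commute (A τ) (A σ)
  A-commute τ σ (n ∷ []) (m ∷ []) with n % 2 ℕ.≟ 1 | m % 2 ℕ.≟ 1
  ... | yes n-odd | yes m-odd = ·-commute _ _ (a₋ n n-odd) (a₋ m m-odd)
          (λ f → x∙yz≈y∙xz (p n n-odd) (p m m-odd) f)
    where open CommutativeSemigroupProperties G.*-commutativeSemigroup using (x∙yz≈y∙xz)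
  ... | yes n-odd | no _ = λ f → Operator.0-homo (_ · a₋ n n-odd)
  ... | no _ | yes m-odd = λ f → sym (Operator.0-homo (_ · a₋ m m-odd))
  ... | no _ | no _ = λ f → refl

  B-commute : ∀ τ σ → Commute (B τ) (B σ)
  B-commute τ σ (n ∷ []) (m ∷ []) with n % 2 ℕ.≟ 1 | m % 2 ℕ.≟ 1
  ... | yes _ | yes _ = ·-commute _ _ (a₊ n) (a₊ m)
          (·-commute _ _ (derivative n) (derivative m) (∂-comm n m))
  ... | yes _ | no _ = λ f → Operator.0-homo (_ · a₊ n)
  ... | no _ | yes _ = λ f → sym (Operator.0-homo (_ · a₊ m))
  ... | no _ | no _ = λ f → refl

  -- The exponent of F. Its coefficient at n is the commutator cₙ.
  logF : 𝕂 → 𝕂 → Scalar.Power 1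
  logF τ σ = overOdd K.0# λ n _ →
    (K.- K.fromℕ 2) K.* (((K.1# K.- σ K.^ n) K./ (K.1# K.- τ K.^ n)) K./ K.fromℕ n)

  logF-no-constant : ∀ τ σ → Sc.NoConstantTerm (logF τ σ)
  logF-no-constant τ σ (zero ∷ []) _ = K.refl

  -- The coefficient of B times the coefficient n / 2 of aₙ times the
  -- coefficient of A is the coefficient of log F.
  commutator-scalar : ∀ (n : ℕ) .{{_ : NonZero n}} d s → ¬ d K.≈ K.0# →
    let two = K.fromℕ 2; N = K.fromℕ n in
    (K.- (two K./ (N K.* d))) K.* ((N K./ two) K.* ((two K.* s) K./ N)) K.≈
    (K.- two) K.* ((s K./ d) K./ N)
  commutator-scalar n d s d≉0 = KE.begin
    (K.- (two K.* (N K.* d) K.⁻¹)) K.* ((N K.* h) K.* ((two K.* s) K.* i))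
      KE.≈⟨ K.*-congʳ (KR.-‿distribˡ-* two _) ⟩
    (K.- two K.* (N K.* d) K.⁻¹) K.* ((N K.* h) K.* ((two K.* s) K.* i))
      KE.≈⟨ K.*-congʳ (K.*-congˡ Nd⁻¹) ⟩
    (K.- two K.* (i K.* e)) K.* ((N K.* h) K.* ((two K.* s) K.* i))
      KE.≈⟨ solve 7 (λ m t N h i e s →
             ((m ⊛ (i ⊛ e)) ⊛ ((N ⊛ h) ⊛ ((t ⊛ s) ⊛ i))) ⊜
             (((m ⊛ ((s ⊛ e) ⊛ i)) ⊛ (N ⊛ i)) ⊛ (t ⊛ h)))
           K.refl (K.- two) two N h i e s ⟩
    ((K.- two K.* ((s K.* e) K.* i)) K.* (N K.* i)) K.* (two K.* h)
      KE.≈⟨ K.*-cong (K.*-congˡ (K.inverse N N≉0)) (K.inverse two (char0 1)) ⟩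
    ((K.- two K.* ((s K.* e) K.* i)) K.* K.1#) K.* K.1#
      KE.≈⟨ K.trans (K.*-identityʳ _) (K.*-identityʳ _) ⟩
    (K.- two) K.* ((s K.* e) K.* i) KE.∎
    where
    module KR = RingProperties K.ring
    open SemiringSolver K.commutativeSemiring using (solve) renaming (_:=_ to _⊜_; _:*_ to _⊛_)
    two N h i e : 𝕂
    two = K.fromℕ 2
    N   = K.fromℕ n
    h   = two K.⁻¹
    i   = N K.⁻¹
    e   = d K.⁻¹
    N≉0 : ¬ N K.≈ K.0#
    N≉0 = Sc.fromℕ≉0 n
    product : (N K.* d) K.* (i K.* e) K.≈ K.1#
    product = KE.begin
      (N K.* d) K.* (i K.* e)   KE.≈⟨ interchange N d i e ⟩
      (N K.* i) K.* (d K.* e)   KE.≈⟨ K.*-cong (K.inverse N N≉0) (K.inverse d d≉0) ⟩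
      K.1# K.* K.1#             KE.≈⟨ K.*-identityˡ K.1# ⟩
      K.1#                      KE.∎
      where open CommutativeSemigroupProperties K.*-commutativeSemigroup using (interchange)
    Nd≉0 : ¬ (N K.* d) K.≈ K.0#
    Nd≉0 e≈0 = K.1≉0 (K.trans (K.sym product) (K.trans (K.*-congʳ e≈0) (K.zeroˡ _)))
    Nd⁻¹ : (N K.* d) K.⁻¹ K.≈ i K.* e
    Nd⁻¹ = inverse-unique (N K.* d) (i K.* e) Nd≉0 product

  module _ (τ σ : 𝕂) (τ-generic : NotRootOfUnity K.commutativeRing τ) where

    -- The commutator of Bₙ(τ) and Aⱼ(σ) is cₙ if n = j and 0 otherwise. The
    -- monomial cₙ wⁿ at w ^ j expresses both cases.
    BA-commutator : ∀ n j → B τ (n ∷ []) ∘ᵒ A σ (j ∷ []) ≈ᵒ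
      (A σ (j ∷ []) ∘ᵒ B τ (n ∷ [])) +ᵒ monomial (logF τ σ (n ∷ [])) n (j ∷ [])
    BA-commutator n j with n % 2 ℕ.≟ 1 | j % 2 ℕ.≟ 1
    ... | no _ | yes j-odd = λ f → sym (trans
            (+-cong (Operator.0-homo (_ · a₋ j j-odd)) (monomial-0 n (j ∷ []) f)) (+-identityˡ _))
    ... | no _ | no _ = λ f → sym (trans (+-cong refl (monomial-0 n (j ∷ []) f)) (+-identityˡ _))
    ... | yes n-odd | no j-even = λ f → trans (Operator.0-homo (_ · a₊ n))
            (sym (trans (+-cong refl (monomial-off f)) (+-identityˡ _)))
      where
      monomial-off : ∀ {x} → monomial x n (j ∷ []) ≈ᵒ 0ᵒ
      monomial-off {x} f = trans (monomial-coeff x n (j ∷ []) f)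
        (trans (*-cong refl (shift-one-off n j (λ { ≡.refl → j-even n-odd }) f)) (G.zeroʳ _))
    ... | yes n-odd | yes j-odd with n ℕ.≟ j
    ... | no n≢j = λ f → trans
            (·-commute _ _ (a₊ n) (a₋ j j-odd) (λ f′ → trans
              (*-cong refl (∂-p-other n j j-odd n≢j f′)) (sym (Operator.·-homo (a₋ j j-odd) _ _))) f)
            (sym (trans (+-cong refl (monomial-off f)) (G.+-identityʳ _)))
      where
      monomial-off : ∀ {x} → monomial x n (j ∷ []) ≈ᵒ 0ᵒ
      monomial-off {x} f = trans (monomial-coeff x n (j ∷ []) f)
        (trans (*-cong refl (shift-one-off n j n≢j f)) (G.zeroʳ _))
    ... | yes ≡.refl = λ f → S.begin
            y *ₗ z *ₗ ∂ n (x *ₗ (P * f))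
              S.≈⟨ *-cong refl (*-cong refl (∂-con* n x (P * f))) ⟩
            y *ₗ z *ₗ x *ₗ ∂ n (P * f)
              S.≈⟨ *-cong refl (*-cong refl (*-cong refl (∂-p-same n n-odd f))) ⟩
            y *ₗ z *ₗ x *ₗ (P * ∂ n f + f)
              S.≈⟨ solve 5 (λ y z x q f →
                     (y ⊛ (z ⊛ (x ⊛ (q ⊹ f)))) ⊜ ((y ⊛ (z ⊛ (x ⊛ q))) ⊹ ((y ⊛ (z ⊛ x)) ⊛ f)))
                   refl (con y) (con z) (con x) (P * ∂ n f) f ⟩
            y *ₗ z *ₗ x *ₗ (P * ∂ n f) + (con y * (con z * con x)) * f
              S.≈⟨ +-cong (move f) (*-cong constants refl) ⟩
            x *ₗ (P * (y *ₗ z *ₗ ∂ n f)) + con w * f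
              S.≈⟨ +-cong refl (trans (monomial-coeff w n (n ∷ []) f)
                     (*-cong refl (shift-one-diagonal n f))) ⟨
            x *ₗ (P * (y *ₗ z *ₗ ∂ n f)) + ⟦ monomial w n (n ∷ []) ⟧ f S.∎
      where
      open SemiringSolver G.commutativeSemiring using (solve)
        renaming (_:=_ to _⊜_; _:*_ to _⊛_; _:+_ to _⊹_)
      P : Γ
      P = p n n-odd
      x y z w : 𝕂
      x = (K.fromℕ 2 K.* (K.1# K.- σ K.^ n)) K./ K.fromℕ n
      y = K.- (K.fromℕ 2 K./ (K.fromℕ n K.* (K.1# K.- τ K.^ n)))
      z = K.fromℕ n K./ K.fromℕ 2
      w = (K.- K.fromℕ 2) K.* (((K.1# K.- σ K.^ n) K./ (K.1# K.- τ K.^ n)) K./ K.fromℕ n)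
      move : ∀ f → y *ₗ z *ₗ x *ₗ (P * ∂ n f) ≈ x *ₗ (P * (y *ₗ z *ₗ ∂ n f))
      move f = solve 5 (λ y z x P q → (y ⊛ (z ⊛ (x ⊛ (P ⊛ q)))) ⊜ (x ⊛ (P ⊛ (y ⊛ (z ⊛ q)))))
        refl (con y) (con z) (con x) P (∂ n f)
      constants : con y * (con z * con x) ≈ con w
      constants = trans (*-cong refl (sym (con-* z x))) (trans (sym (con-* y (z K.* x)))
        (con-cong (commutator-scalar n {{odd-nonZero n n-odd}} _ _ (τ-generic n {{odd-nonZero n n-odd}}))))

  ⟦⟧-∑< : ∀ Φ n x → ⟦ Φ ⟧ (∑< n x) ≈ ∑< n (λ i → ⟦ Φ ⟧ (x i))
  ⟦⟧-∑< Φ = ∑<-homo G.+-commutativeMonoid G.+-commutativeMonoid ⟦ Φ ⟧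
    (Operator.0-homo Φ) (Operator.+-homo Φ)

  -- A locally finite sum, computed with any large enough cut-off.
  ∑-cutoff : ∀ {d} (Φ : Vec ℕ d → Operator) (fin : LocallyFinite Φ) f {N} →
    proj₁ (fin f) ≤ N → ⟦ ∑ Φ fin ⟧ f ≈ box N (λ β → ⟦ Φ β ⟧ f)
  ∑-cutoff Φ fin f le = sym (box-stable le (λ β → ⟦ Φ β ⟧ f) (proj₂ (fin f)))

  -- The coefficient of w ^ k C(w) at w ^ l is that of C at l - k, which is 0
  -- for k > l.
  shift-extend : ∀ k (C : Op.Power 1) l → shift k C (l ∷ []) ≈ᵒ extend C ((+ l ℤ.- + k) ∷ [])
  shift-extend k C l f = trans (by-⊖ k l)
    (G.reflexive (≡.cong (λ i → ⟦ extend C (i ∷ []) ⟧ f) (≡.sym (ℤ.m-n≡m⊖n l k))))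
    where
    by-⊖ : ∀ k l → ⟦ shift k C (l ∷ []) ⟧ f ≈ ⟦ extend C ((l ℤ.⊖ k) ∷ []) ⟧ f
    by-⊖ zero    l       = refl
    by-⊖ (suc k) zero    = refl
    by-⊖ (suc k) (suc l) = trans (by-⊖ k l)
      (G.reflexive (≡.cong (λ i → ⟦ extend C (i ∷ []) ⟧ f) (≡.sym (ℤ.[1+m]⊖[1+n]≡m⊖n l k))))

  -- Normal ordering of E(z) G(z⁻¹) E′(w) G′(w⁻¹), given that E₂ and G₂ are
  -- the products E(z) E′(w) and G(z) G′(w) and that moving G past E′ costs
  -- the factor H.
  module NormalOrdering (EA EA′ GB GB′ : Op.Power 1) (E₂ G₂ : Op.Power 2) (H : Scalar.Power 1)
    (E₂-split : ∀ m l f → ⟦ E₂ (m ∷ l ∷ []) ⟧ f ≈ ⟦ EA (m ∷ []) ⟧ (⟦ EA′ (l ∷ []) ⟧ f))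
    (G₂-split : ∀ m l f → ⟦ G₂ (m ∷ l ∷ []) ⟧ f ≈ ⟦ GB (m ∷ []) ⟧ (⟦ GB′ (l ∷ []) ⟧ f))
    (exchange : ∀ n j f → ⟦ GB (n ∷ []) ⟧ (⟦ EA′ (j ∷ []) ⟧ f) ≈
      diag (λ k b → H (k ∷ []) *ₗ ⟦ shift k EA′ (j ∷ []) ⟧ (⟦ GB (b ∷ []) ⟧ f)) n)
    (fin : LocallyFinite GB) (fin′ : LocallyFinite GB′) (fin₂ : LocallyFinite G₂) where

    extend-E₂ : ∀ i j → extend E₂ (i ∷ j ∷ []) ≈ᵒ extend EA (i ∷ []) ∘ᵒ extend EA′ (j ∷ [])
    extend-E₂ (+ m)    (+ l)    f = E₂-split m l f
    extend-E₂ (+ m)    -[1+ _ ] f = sym (Operator.0-homo (EA (m ∷ [])))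
    extend-E₂ -[1+ _ ] j        f = refl

    exchange-extend : ∀ n j g → ⟦ GB (n ∷ []) ⟧ (⟦ extend EA′ (j ∷ []) ⟧ g) ≈
      diag (λ k b → H (k ∷ []) *ₗ
        ⟦ extend EA′ ((j ℤ.- + k) ∷ []) ⟧ (⟦ GB (b ∷ []) ⟧ g)) n
    exchange-extend n -[1+ q ] g = trans (Operator.0-homo (GB (n ∷ [])))
      (sym (Γs.diag-zero n _ (λ k b _ → vanish k (⟦ GB (b ∷ []) ⟧ g))))
      where
      vanish : ∀ k h → H (k ∷ []) *ₗ ⟦ extend EA′ ((-[1+ q ] ℤ.- + k) ∷ []) ⟧ h ≈ 0Γ
      vanish zero    h = G.zeroʳ _
      vanish (suc k) h = G.zeroʳ _
    exchange-extend n (+ l) g = trans (exchange n l g)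
      (Γs.diag-cong n _ (λ k b → H (k ∷ []) *ₗ
          ⟦ extend EA′ ((+ l ℤ.- + k) ∷ []) ⟧ (⟦ GB (b ∷ []) ⟧ g))
        (λ k b _ → *-cong refl (shift-extend k EA′ l (⟦ GB (b ∷ []) ⟧ g))))

    module _ (m l : ℤ) (f : Γ) where
      private
        N₂ N₃ : ℕ
        N₂ = proj₁ (fin₂ f)
        N₃ = N₂ ℕ.+ ℤ.∣ l ∣

        P : ℕ → Operator
        P β = extend EA ((m ℤ.+ + β) ∷ []) ∘ᵒ GB (β ∷ [])
        h : ℕ → Γ
        h γ = ⟦ extend EA′ ((l ℤ.+ + γ) ∷ []) ∘ᵒ GB′ (γ ∷ []) ⟧ f
        Q : ℕ → Vec ℕ 2 → Operator
        Q k β = extend E₂ ((m ℤ.+ + k ∷ l ℤ.- + k ∷ []) ⊞ β) ∘ᵒ G₂ β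
        -- The contribution of Hₖ, with b and γ the exponents of z⁻¹ and w⁻¹
        -- taken from the annihilation part.
        y : ℕ → ℕ → ℕ → Γ
        y γ k b = H (k ∷ []) *ₗ ⟦ Q k (b ∷ γ ∷ []) ⟧ f
        -- If N₂ ≤ b the annihilation part kills f. Otherwise N₃ ≤ k, and either
        -- N₂ ≤ b + γ, so that f is killed again, or the exponent of w in the
        -- creation part is negative.
        y-vanishes : ∀ γ k b → N₃ ℕ.+ N₂ ≤ k ℕ.+ b → y γ k b ≈ 0Γ
        y-vanishes γ k b N≤ = trans (*-cong refl q≈0) (G.zeroʳ _)
          where
          Φ : Operator
          Φ = G₂ (b ∷ γ ∷ [])
          small : N₂ ≤ b ℕ.+ γ → ⟦ Φ ⟧ f ≈ 0Γ
          small le = proj₂ (fin₂ f) (b ∷ γ ∷ [])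
            (ℕ.≤-trans le (ℕ.≤-reflexive (≡.cong (b ℕ.+_) (≡.sym (ℕ.+-identityʳ γ)))))
          q≈0 : ⟦ Q k (b ∷ γ ∷ []) ⟧ f ≈ 0Γ
          q≈0 with N₂ ℕ.≤? b
          ... | yes le = trans (Operator.cong E (small (ℕ.≤-trans le (ℕ.m≤m+n b γ)))) (Operator.0-homo E)
            where
            E : Operator
            E = extend E₂ ((m ℤ.+ + k ∷ l ℤ.- + k ∷ []) ⊞ (b ∷ γ ∷ []))
          ... | no  gt = coefficient-vanishes E₂ Φ N₂ m l k b γ f
            (ℕ.+-cancelʳ-≤ N₂ N₃ k (ℕ.≤-trans N≤ (ℕ.+-monoʳ-≤ k (ℕ.<⇒≤ (ℕ.≰⇒> gt))))) small
        -- The term of the left-hand side with exponents β and γ is a sum over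
        -- k + b = β.
        exchanged : ∀ β γ → ⟦ P β ⟧ (h γ) ≈ diag (y γ) β
        exchanged β γ = S.begin
          ⟦ E ⟧ (⟦ GB (β ∷ []) ⟧ (⟦ extend EA′ ((l ℤ.+ + γ) ∷ []) ⟧ f′))
            S.≈⟨ Operator.cong E (exchange-extend β (l ℤ.+ + γ) f′) ⟩
          ⟦ E ⟧ (diag x β)
            S.≈⟨ ⟦⟧-∑< E (suc β) (λ k → x k (β ∸ k)) ⟩
          diag (λ k b → ⟦ E ⟧ (x k b)) β
            S.≈⟨ Γs.diag-cong β _ _ term ⟩
          diag (y γ) β S.∎
          where
          E : Operator
          E = extend EA ((m ℤ.+ + β) ∷ [])
          f′ : Γ
          f′ = ⟦ GB′ (γ ∷ []) ⟧ f
          x : ℕ → ℕ → Γ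
          x k b = H (k ∷ []) *ₗ
            ⟦ extend EA′ (((l ℤ.+ + γ) ℤ.- + k) ∷ []) ⟧ (⟦ GB (b ∷ []) ⟧ f′)
          swap-γ-k : ∀ k → (l ℤ.+ + γ) ℤ.- + k ≡ (l ℤ.- + k) ℤ.+ + γ
          swap-γ-k k = xy∙z≈xz∙y l (+ γ) (ℤ.- + k)
            where open CommutativeSemigroupProperties ℤ.+-commutativeSemigroup using (xy∙z≈xz∙y)
          term : ∀ k b → k ℕ.+ b ≡ β → ⟦ E ⟧ (x k b) ≈ y γ k b
          term k b ≡.refl = S.begin
            ⟦ E ⟧ (x k b)
              S.≈⟨ Operator.·-homo E (H (k ∷ [])) _ ⟩
            H (k ∷ []) *ₗ ⟦ extend EA ((m ℤ.+ + (k ℕ.+ b)) ∷ []) ⟧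
              (⟦ extend EA′ (((l ℤ.+ + γ) ℤ.- + k) ∷ []) ⟧ q)
              S.≡⟨ ≡.cong₂ (λ i j → H (k ∷ []) *ₗ
                     ⟦ extend EA (i ∷ []) ⟧ (⟦ extend EA′ (j ∷ []) ⟧ q))
                   (≡.sym (ℤ.+-assoc m (+ k) (+ b))) (swap-γ-k k) ⟩
            H (k ∷ []) *ₗ ⟦ extend EA (i ∷ []) ⟧ (⟦ extend EA′ (j ∷ []) ⟧ q)
              S.≈⟨ *-cong refl (extend-E₂ i j q) ⟨
            H (k ∷ []) *ₗ ⟦ extend E₂ (i ∷ j ∷ []) ⟧ q
              S.≈⟨ *-cong refl (Operator.cong (extend E₂ (i ∷ j ∷ [])) (G₂-split b γ f)) ⟨
            y γ k b S.∎
            where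
            q : Γ
            q = ⟦ GB (b ∷ []) ⟧ f′
            i j : ℤ
            i = (m ℤ.+ + k) ℤ.+ + b
            j = (l ℤ.- + k) ℤ.+ + γ

      -- The coefficient of z ^ m w ^ l at f, with N a bound for all the sums.
      product-coefficient : ∀ N → proj₁ (fin (⟦ product± EA′ GB′ fin′ (l ∷ []) ⟧ f)) ≤ N →
        proj₁ (fin′ f) ≤ N → N₃ ℕ.+ N₂ ≤ N →
        ⟦ product± EA GB fin (m ∷ []) ⟧ (⟦ product± EA′ GB′ fin′ (l ∷ []) ⟧ f) ≈
        ⟦ timesRatio H ((product± E₂ G₂ fin₂)) (product±-finite H E₂ G₂ fin₂) (m ∷ l ∷ []) ⟧ f
      product-coefficient N cut₁ cut₂ cut = S.begin
        ⟦ product± EA GB fin (m ∷ []) ⟧ g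
          S.≈⟨ ∑-cutoff (λ β → extend EA ((m ∷ []) ⊞ β) ∘ᵒ GB β)
                 (product-finite EA GB (fin) (m ∷ [])) g cut₁ ⟩
        ∑< N (λ β → ⟦ P β ⟧ g)
          S.≈⟨ Γs.∑<-cong N (λ β → ⟦ P β ⟧ g) (λ β → ⟦ P β ⟧ (∑< N h)) (λ β → Operator.cong (P β)
                 (∑-cutoff (λ β → extend EA′ ((l ∷ []) ⊞ β) ∘ᵒ GB′ β)
                   (product-finite EA′ GB′ (fin′) (l ∷ [])) f cut₂)) ⟩
        ∑< N (λ β → ⟦ P β ⟧ (∑< N h))
          S.≈⟨ Γs.∑<-cong N (λ β → ⟦ P β ⟧ (∑< N h)) (λ β → ∑< N (λ γ → ⟦ P β ⟧ (h γ)))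
                 (λ β → ⟦⟧-∑< (P β) N h) ⟩
        ∑< N (λ β → ∑< N (λ γ → ⟦ P β ⟧ (h γ)))
          S.≈⟨ Γs.∑<-cong N (λ β → ∑< N (λ γ → ⟦ P β ⟧ (h γ))) (λ β → ∑< N (λ γ → diag (y γ) β))
                 (λ β → Γs.∑<-cong N (λ γ → ⟦ P β ⟧ (h γ)) (λ γ → diag (y γ) β) (exchanged β)) ⟩
        ∑< N (λ β → ∑< N (λ γ → diag (y γ) β))
          S.≈⟨ Γs.∑<-swap N N (λ β γ → diag (y γ) β) ⟩
        ∑< N (λ γ → ∑< N (diag (y γ)))
          S.≈⟨ Γs.∑<-cong N (λ γ → ∑< N (diag (y γ))) (λ γ → ∑< N (λ k → ∑< N (y γ k)))
                 (λ γ → Γs.triangle N (y γ) (λ k b le → y-vanishes γ k b (ℕ.≤-trans cut le))) ⟩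
        ∑< N (λ γ → ∑< N (λ k → ∑< N (y γ k)))
          S.≈⟨ Γs.∑<-swap N N (λ γ k → ∑< N (y γ k)) ⟩
        ∑< N (λ k → ∑< N (λ γ → ∑< N (y γ k)))
          S.≈⟨ Γs.∑<-cong N (λ k → ∑< N (λ γ → ∑< N (y γ k))) normal (λ k → S.begin
            ∑< N (λ γ → ∑< N (y γ k))
              S.≈⟨ Γs.∑<-swap N N (λ γ b → y γ k b) ⟩
            box N (λ β → H (k ∷ []) *ₗ ⟦ Q k β ⟧ f)
              S.≈⟨ box-· {2} N (H (k ∷ [])) (λ β → ⟦ Q k β ⟧ f) ⟩
            H (k ∷ []) *ₗ box N (λ β → ⟦ Q k β ⟧ f)
              S.≈⟨ *-cong refl (∑-cutoff (Q k)
                     (product-finite E₂ G₂ (fin₂)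
                       (m ℤ.+ + k ∷ l ℤ.- + k ∷ [])) f (ℕ.≤-trans (ℕ.m≤n+m N₂ N₃) cut)) ⟨
            normal k S.∎) ⟩
        ∑< N normal
          S.≈⟨ ∑-cutoff (ratioTerm H ((product± E₂ G₂ fin₂)) m l)
                 (product±-finite H E₂ G₂ fin₂ m l) f (ℕ.≤-trans (ℕ.m≤m+n N₃ N₂) cut) ⟨
        ⟦ timesRatio H ((product± E₂ G₂ fin₂)) (product±-finite H E₂ G₂ fin₂) (m ∷ l ∷ []) ⟧ f S.∎
        where
        g : Γ
        g = ⟦ product± EA′ GB′ fin′ (l ∷ []) ⟧ f
        normal : ℕ → Γ
        normal k = H (k ∷ []) *ₗ ⟦ product± E₂ G₂ fin₂ (m ℤ.+ + k ∷ l ℤ.- + k ∷ []) ⟧ f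

    product-formula : product± EA GB fin ⊗ product± EA′ GB′ fin′ ≈ᴰ
      timesRatio H ((product± E₂ G₂ fin₂)) (product±-finite H E₂ G₂ fin₂)
    product-formula (m ∷ l ∷ []) f = product-coefficient m l f (N₁ ℕ.+ (N₄ ℕ.+ N₅))
      (ℕ.m≤m+n N₁ (N₄ ℕ.+ N₅)) (ℕ.≤-trans (ℕ.m≤m+n N₄ N₅) (ℕ.m≤n+m (N₄ ℕ.+ N₅) N₁))
      (ℕ.≤-trans (ℕ.m≤n+m N₅ N₄) (ℕ.m≤n+m (N₄ ℕ.+ N₅) N₁))
      where
      N₁ N₄ N₅ : ℕ
      N₁ = proj₁ (fin (⟦ product± EA′ GB′ fin′ (l ∷ []) ⟧ f))
      N₄ = proj₁ (fin′ f)
      N₅ = (proj₁ (fin₂ f) ℕ.+ ℤ.∣ l ∣) ℕ.+ proj₁ (fin₂ f)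

  -- Both sides unfold to the same series. The equation is stated for a
  -- variable series and exponent, which lets exponentials of the series A and
  -- B be compared without unfolding them.
  op-exp : ∀ {d} (C : Op.Power d) α →
           Op.exp C α ≡ Series.exp K (Fock.operatorRing K) (Fock._·_ K) C α
  op-exp C α = ≡.refl

  scalar-exp : ∀ {d} (C : Scalar.Power d) α →
               Scalar.exp C α ≡ Series.exp K (Field.rawRing K) (Field._*_ K) C α
  scalar-exp C α = ≡.refl

  op-exp-sum : ∀ Z C D → (∀ α f → ⟦ Z α ⟧ f ≈ ⟦ Op.in-z C α ⟧ f + ⟦ Op.in-w D α ⟧ f) →
    NoConstantTerm C → NoConstantTerm D → Commute C C → Commute C D → Commute D D →
    ∀ m l f → ⟦ Op.exp Z (m ∷ l ∷ []) ⟧ f ≈ ⟦ Op.exp C (m ∷ []) ⟧ (⟦ Op.exp D (l ∷ []) ⟧ f)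
  op-exp-sum Z C D e C₀ D₀ CC CD DD m l f = trans
    (G.reflexive (≡.cong (λ Φ → ⟦ Φ ⟧ f) (op-exp Z (m ∷ l ∷ []))))
    (trans (exp-sum Z C D e C₀ D₀ CC CD DD m l f)
      (G.reflexive (≡.sym (≡.cong₂ (λ Φ Ψ → ⟦ Φ ⟧ (⟦ Ψ ⟧ f))
        (op-exp C (m ∷ [])) (op-exp D (l ∷ []))))))

  op-exp-exchange : ∀ (C D : Op.Power 1) (x : Scalar.Power 1) →
    NoConstantTerm C → NoConstantTerm D → Sc.NoConstantTerm x → Commute C C → Commute D D →
    (∀ n j → D (n ∷ []) ∘ᵒ C (j ∷ []) ≈ᵒ
             (C (j ∷ []) ∘ᵒ D (n ∷ [])) +ᵒ monomial (x (n ∷ [])) n (j ∷ [])) →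
    ∀ n j f → ⟦ Op.exp D (n ∷ []) ⟧ (⟦ Op.exp C (j ∷ []) ⟧ f) ≈
      diag (λ k b → Scalar.exp x (k ∷ []) *ₗ
        ⟦ shift k (Op.exp C) (j ∷ []) ⟧ (⟦ Op.exp D (b ∷ []) ⟧ f)) n
  op-exp-exchange C D x C₀ D₀ x₀ CC DD DC n j f = trans
    (G.reflexive (≡.cong₂ (λ Φ Ψ → ⟦ Φ ⟧ (⟦ Ψ ⟧ f)) (op-exp D (n ∷ [])) (op-exp C (j ∷ []))))
    (trans (exp-exchange C D x C₀ D₀ x₀ CC DD DC n j f)
    (trans (∑<-homo O.+-commutativeMonoid G.+-commutativeMonoid (λ Φ → ⟦ Φ ⟧ f) refl (λ _ _ → refl)
      (suc n) (λ k → (Fock._·_ K (Series.exp K (Field.rawRing K) (Field._*_ K) x (k ∷ []))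
        (shift k (Series.exp K (Fock.operatorRing K) (Fock._·_ K) C) (j ∷ []))) ∘ᵒ
        Series.exp K (Fock.operatorRing K) (Fock._·_ K) D ((n ∸ k) ∷ [])))
      (Γs.diag-cong n
        (λ k b → Series.exp K (Field.rawRing K) (Field._*_ K) x (k ∷ []) *ₗ
          ⟦ shift k (Series.exp K (Fock.operatorRing K) (Fock._·_ K) C) (j ∷ []) ⟧
            (⟦ Series.exp K (Fock.operatorRing K) (Fock._·_ K) D (b ∷ []) ⟧ f))
        (λ k b → Scalar.exp x (k ∷ []) *ₗ
          ⟦ shift k (Op.exp C) (j ∷ []) ⟧ (⟦ Op.exp D (b ∷ []) ⟧ f))
        (λ k b _ → *-cong (G.reflexive (≡.cong con (≡.sym (scalar-exp x (k ∷ [])))))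
          (trans (shift-cong k {C = Series.exp K (Fock.operatorRing K) (Fock._·_ K) C} {D = Op.exp C}
                   (λ α g → refl) (j ∷ []) _)
            (Operator.cong (shift k (Op.exp C) (j ∷ []))
              (G.reflexive (≡.cong (λ Φ → ⟦ Φ ⟧ f) (≡.sym (op-exp D (b ∷ [])))))))))))

  Y-product : ∀ τ σ → NotRootOfUnity K.commutativeRing τ →
    Y τ ⊗ Y σ ≈ᴰ timesRatio (F τ σ) (normalOrdered τ σ) (normalOrdered-finite (F τ σ) τ σ)
  Y-product τ σ τ-generic = NormalOrdering.product-formula
    (Op.exp (A τ)) (Op.exp (A σ)) (Op.exp (B τ)) (Op.exp (B σ))
    (Op.exp (A₂ τ σ)) (Op.exp (B₂ τ σ)) (F τ σ)
    (op-exp-sum (A₂ τ σ) (A τ) (A σ) (λ _ _ → refl) (A-no-constant τ) (A-no-constant σ)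
      (A-commute τ τ) (A-commute τ σ) (A-commute σ σ))
    (op-exp-sum (B₂ τ σ) (B τ) (B σ) (λ _ _ → refl) (B-no-constant τ) (B-no-constant σ)
      (B-commute τ τ) (B-commute τ σ) (B-commute σ σ))
    (op-exp-exchange (A σ) (B τ) (logF τ σ) (A-no-constant σ) (B-no-constant τ)
      (logF-no-constant τ σ) (A-commute σ σ) (B-commute τ τ) (BA-commutator τ σ τ-generic))
    (expB-finite τ) (expB-finite σ) (expB₂-finite τ σ)

-- Equal parameters.

module EqualParameters (K : Field c ℓ) (char0 : Characteristic0 (Field.commutativeRing K)) (τ : Field.Carrier K)
  (τ-generic : NotRootOfUnity (Field.commutativeRing K) τ) where
  open Field K
  open Exponentials K char0 rawRing isRing _*_ (regular K)
  open Commutation K char0 rawRing isRing _*_ (regular K) using (shift; shift-*; shift-cong; shift-shift)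
  open VertexOperators K char0 using (logF; logF-no-constant)
  open SemiringMult semiring using (×-homo-1; ×-comm-*; ×-congʳ) renaming (_×_ to _times_)
  private
    module KE = SetoidReasoning setoid
    module KR = RingProperties ring

  seriesCommutative : CommutativeRing c ℓ
  seriesCommutative = record { isCommutativeRing = record
    { isRing = seriesLaws 1 ; *-comm = λ C D → *ˢ-comm C D (λ _ _ → *-comm _ _) } }

  private
    module S = CommutativeRing seriesCommutative
    module SR = RingProperties S.ring
    module SG = AbelianGroupProperties S.+-abelianGroup
    module SE = SetoidReasoning S.setoid
    open SemiringSolver S.commutativeSemiring using (solve)
      renaming (_:=_ to _⊜_; _:*_ to _⊛_; _:+_ to _⊹_)

    -- E is θ (log F), and V W is the quotient of V = 1 - u by Z = 1 + u.
    u V Z W m E : Power 1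
    u = indeterminate
    V = one -ˢ u
    Z = one +ˢ u
    W = reciprocal Z
    m = -ˢ u
    E = θ (logF τ τ)

  -- Multiplication by u shifts coefficients.
  indeterminate-* : ∀ C → u S.* C S.≈ shift 1 C
  indeterminate-* C = SE.begin
    u S.* C               SE.≈⟨ S.*-congʳ {x = C} u≈ ⟩
    shift 1 one S.* C     SE.≈⟨ shift-* 1 one C ⟩
    shift 1 (one S.* C)   SE.≈⟨ shift-cong 1 (*ˢ-identityˡ C) ⟩
    shift 1 C             SE.∎
    where
    u≈ : u S.≈ shift 1 one
    u≈ (0 ∷ [])           = refl
    u≈ (1 ∷ [])           = refl
    u≈ (suc (suc n) ∷ []) = refl

  θu : θ u S.≈ u
  θu (0 ∷ [])           = refl
  θu (1 ∷ [])           = ×-homo-1 1#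
  θu (suc (suc n) ∷ []) = times-0 (suc (suc n) ℕ.+ 0)

  -- θ (log F) is the sum of -2 uⁿ over odd n.
  E-coeff : ∀ n → E (n ∷ []) ≈ overOdd 0# (λ _ _ → - fromℕ 2) (n ∷ [])
  E-coeff n with n % 2 ℕ.≟ 1
  ... | no _ = times-0 (n ℕ.+ 0)
  ... | yes n-odd = KE.begin
    (n ℕ.+ 0) times (two * ((d * d ⁻¹) * N ⁻¹))   KE.≡⟨ ≡.cong (_times (two * ((d * d ⁻¹) * N ⁻¹))) (ℕ.+-identityʳ n) ⟩
    n times (two * ((d * d ⁻¹) * N ⁻¹))           KE.≈⟨ ×-congʳ n (*-congˡ (*-congʳ (inverse d (τ-generic n {{odd-nonZero n n-odd}})))) ⟩
    n times (two * (1# * N ⁻¹))                   KE.≈⟨ ×-congʳ n (*-congˡ (*-identityˡ _)) ⟩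
    n times (two * N ⁻¹)                          KE.≈⟨ ×-comm-* n two (N ⁻¹) ⟨
    two * (n times (N ⁻¹))                        KE.≈⟨ *-congˡ (times-· n (N ⁻¹)) ⟩
    two * (N * N ⁻¹)                              KE.≈⟨ *-congˡ (inverse N (fromℕ≉0 n {{odd-nonZero n n-odd}})) ⟩
    two * 1#                                      KE.≈⟨ *-identityʳ two ⟩
    two                                           KE.∎
    where
    two N d : Carrier
    two = - fromℕ 2
    N   = fromℕ n
    d   = 1# - τ ^ n

  -- E = u² E - 2u: the coefficients of E begin with 0 and -2 and have period 2.
  E-recurrence : E S.≈ shift 2 E S.+ m S.* (one S.+ one)
  E-recurrence = λ α → trans (recurrence α) (+-congˡ (sym (double α)))
    where
    double : m S.* (one S.+ one) S.≈ m S.+ m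
    double = S.trans (S.distribˡ m one one) (S.+-cong (S.*-identityʳ m) (S.*-identityʳ m))
    zero-sum : - 0# + - 0# ≈ 0#
    zero-sum = trans (+-cong KR.-0#≈0# KR.-0#≈0#) (+-identityˡ 0#)
    recurrence : E S.≈ shift 2 E S.+ (m S.+ m)
    recurrence (0 ∷ []) = sym (trans (+-identityˡ _) zero-sum)
    recurrence (1 ∷ []) = trans (E-coeff 1) (sym (trans (+-identityˡ _)
      (trans (AbelianGroupProperties.⁻¹-∙-comm +-abelianGroup 1# 1#) (-‿cong (+-congˡ (sym (+-identityʳ 1#)))))))
    recurrence (suc (suc n) ∷ []) = KE.begin
      E (suc (suc n) ∷ [])        KE.≈⟨ E-coeff (suc (suc n)) ⟩
      overOdd 0# (λ _ _ → - fromℕ 2) (suc (suc n) ∷ []) KE.≈⟨ period n ⟩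
      overOdd 0# (λ _ _ → - fromℕ 2) (n ∷ [])           KE.≈⟨ E-coeff n ⟨
      E (n ∷ [])                  KE.≈⟨ trans (+-congˡ zero-sum) (+-identityʳ _) ⟨
      E (n ∷ []) + (- 0# + - 0#)  KE.∎
      where
      period : ∀ n → overOdd 0# (λ _ _ → - fromℕ 2) (suc (suc n) ∷ []) ≈
                     overOdd 0# (λ _ _ → - fromℕ 2) (n ∷ [])
      period n with n % 2 ℕ.≟ 1
      ... | yes _ = refl
      ... | no _  = refl

  -- θ (log F) (1 - u) (1 + u) = -2 u.
  E-closed-form : (E S.* V) S.* Z S.≈ m S.* (one S.+ one)
  E-closed-form = SE.begin
    (E S.* (one S.+ m)) S.* (one S.+ u)
      SE.≈⟨ S.trans (S.*-assoc E (one S.+ m) (one S.+ u)) (S.trans (S.*-congˡ {x = E} difference-of-squares)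
              (S.distribˡ E one (m S.* u))) ⟩
    E S.* one S.+ E S.* (m S.* u)
      SE.≈⟨ S.+-cong (S.*-identityʳ E) (SE.begin
        E S.* (m S.* u)      SE.≈⟨ S.*-congˡ {x = E} (SR.-‿distribˡ-* u u) ⟨
        E S.* (-ˢ (u S.* u)) SE.≈⟨ SR.-‿distribʳ-* E (u S.* u) ⟨
        -ˢ (E S.* (u S.* u)) SE.≈⟨ S.-‿cong (SE.begin
          E S.* (u S.* u)    SE.≈⟨ S.*-comm E (u S.* u) ⟩
          (u S.* u) S.* E    SE.≈⟨ S.*-assoc u u E ⟩
          u S.* (u S.* E)    SE.≈⟨ indeterminate-* (u S.* E) ⟩
          shift 1 (u S.* E)  SE.≈⟨ shift-cong 1 (indeterminate-* E) ⟩
          shift 1 (shift 1 E) SE.≈⟨ shift-shift 1 1 E ⟩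
          shift 2 E          SE.∎) ⟩
        -ˢ shift 2 E         SE.∎) ⟩
    E S.- shift 2 E          SE.≈⟨ S.+-congʳ {x = -ˢ shift 2 E} E-recurrence ⟩
    (shift 2 E S.+ m S.* (one S.+ one)) S.- shift 2 E
      SE.≈⟨ SG.xyx⁻¹≈y (shift 2 E) (m S.* (one S.+ one)) ⟩
    m S.* (one S.+ one)      SE.∎
    where
    difference-of-squares : (one S.+ m) S.* (one S.+ u) S.≈ one S.+ m S.* u
    difference-of-squares = SE.begin
      (one S.+ m) S.* (one S.+ u)
        SE.≈⟨ S.distribʳ (one S.+ u) one m ⟩
      one S.* (one S.+ u) S.+ m S.* (one S.+ u)
        SE.≈⟨ S.+-cong (S.*-identityˡ (one S.+ u)) (S.trans (S.distribˡ m one u)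
                (S.trans (S.+-congʳ {x = m S.* u} (S.*-identityʳ m)) (S.+-comm m (m S.* u)))) ⟩
      (one S.+ u) S.+ (m S.* u S.+ m)
        SE.≈⟨ solve 4 (λ o u mu m → (o ⊹ u) ⊹ (mu ⊹ m) ⊜ (o ⊹ mu) ⊹ (u ⊹ m)) S.refl one u (m S.* u) m ⟩
      (one S.+ m S.* u) S.+ (u S.+ m)
        SE.≈⟨ S.+-congˡ {x = one S.+ m S.* u} (S.-‿inverseʳ u) ⟩
      (one S.+ m S.* u) S.+ S.0#
        SE.≈⟨ S.+-identityʳ (one S.+ m S.* u) ⟩
      one S.+ m S.* u SE.∎

  ZW : Z S.* W S.≈ one
  ZW = reciprocal-inverse Z (λ { (zero ∷ []) _ → +-identityʳ 1# })

  θZ : θ Z S.≈ u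
  θZ = S.trans (θ-+ one u) (S.trans (S.+-cong θ-one θu) (S.+-identityˡ u))

  θV : θ V S.≈ m
  θV = S.trans (θ-+ one m) (S.trans (S.+-cong θ-one θm) (S.+-identityˡ m))
    where
    θm : θ m S.≈ m
    θm = SR.+-inverseʳ-unique u (θ m) (SE.begin
      u S.+ θ m          SE.≈⟨ S.+-congʳ {x = θ m} θu ⟨
      θ u S.+ θ m        SE.≈⟨ θ-+ u m ⟨
      θ (u S.+ m)        SE.≈⟨ θ-cong (S.-‿inverseʳ u) ⟩
      θ S.0#             SE.≈⟨ (λ α → times-0 (deg α)) ⟩
      S.0#               SE.∎)

  -- θ (Z W) = θ 1 = 0 gives θ W = - (θ Z) W W.
  θW : θ W S.≈ m S.* (W S.* W)
  θW = SE.begin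
    θ W                              SE.≈⟨ S.*-identityˡ (θ W) ⟨
    one S.* θ W                      SE.≈⟨ S.*-congʳ {x = θ W} ZW ⟨
    (Z S.* W) S.* θ W                SE.≈⟨ solve 3 (λ z w x → (z ⊛ w) ⊛ x ⊜ w ⊛ (z ⊛ x)) S.refl Z W (θ W) ⟩
    W S.* (Z S.* θ W)                SE.≈⟨ S.*-congˡ {x = W} ZθW ⟩
    W S.* (m S.* W)                  SE.≈⟨ solve 2 (λ m w → w ⊛ (m ⊛ w) ⊜ m ⊛ (w ⊛ w)) S.refl m W ⟩
    m S.* (W S.* W)                  SE.∎
    where
    ZθW : Z S.* θ W S.≈ m S.* W
    ZθW = S.trans (SR.+-inverseʳ-unique (u S.* W) (Z S.* θ W) (SE.begin
      u S.* W S.+ Z S.* θ W          SE.≈⟨ S.+-congʳ {x = Z S.* θ W} (S.*-congʳ {x = W} θZ) ⟨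
      θ Z S.* W S.+ Z S.* θ W        SE.≈⟨ θ-* Z W ⟨
      θ (Z S.* W)                    SE.≈⟨ θ-cong ZW ⟩
      θ one                          SE.≈⟨ θ-one ⟩
      S.0#                           SE.∎)) (SR.-‿distribˡ-* u W)

  -- Both sides are -2 u W W.
  θ-quotient : θ (V S.* W) S.≈ E S.* (V S.* W)
  θ-quotient = SE.begin
    θ (V S.* W)                      SE.≈⟨ θ-* V W ⟩
    θ V S.* W S.+ V S.* θ W          SE.≈⟨ S.+-cong (S.*-congʳ {x = W} θV) (S.*-congˡ {x = V} θW) ⟩
    m S.* W S.+ V S.* (m S.* (W S.* W))
      SE.≈⟨ S.+-congʳ {x = V S.* (m S.* (W S.* W))}
              (S.trans (S.sym (S.*-identityʳ (m S.* W))) (S.*-congˡ {x = m S.* W} (S.sym ZW))) ⟩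
    (m S.* W) S.* (Z S.* W) S.+ V S.* (m S.* (W S.* W))
      SE.≈⟨ solve 4 (λ m w z v → ((m ⊛ w) ⊛ (z ⊛ w)) ⊹ (v ⊛ (m ⊛ (w ⊛ w))) ⊜ (m ⊛ (z ⊹ v)) ⊛ (w ⊛ w))
           S.refl m W Z V ⟩
    (m S.* (Z S.+ V)) S.* (W S.* W)
      SE.≈⟨ S.*-congʳ {x = W S.* W} (S.*-congˡ {x = m} Z+V) ⟩
    (m S.* (one S.+ one)) S.* (W S.* W)
      SE.≈⟨ S.*-congʳ {x = W S.* W} E-closed-form ⟨
    ((E S.* V) S.* Z) S.* (W S.* W)
      SE.≈⟨ solve 4 (λ e v z w → ((e ⊛ v) ⊛ z) ⊛ (w ⊛ w) ⊜ (e ⊛ (v ⊛ w)) ⊛ (z ⊛ w)) S.refl E V Z W ⟩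
    (E S.* (V S.* W)) S.* (Z S.* W)
      SE.≈⟨ S.*-congˡ {x = E S.* (V S.* W)} ZW ⟩
    (E S.* (V S.* W)) S.* one        SE.≈⟨ S.*-identityʳ (E S.* (V S.* W)) ⟩
    E S.* (V S.* W)                  SE.∎
    where
    Z+V : Z S.+ V S.≈ one S.+ one
    Z+V = SE.begin
      (one S.+ u) S.+ (one S.+ m)    SE.≈⟨ solve 3 (λ o u m → (o ⊹ u) ⊹ (o ⊹ m) ⊜ (o ⊹ o) ⊹ (u ⊹ m)) S.refl one u m ⟩
      (one S.+ one) S.+ (u S.+ m)    SE.≈⟨ S.+-congˡ {x = one S.+ one} (S.-‿inverseʳ u) ⟩
      (one S.+ one) S.+ S.0#         SE.≈⟨ S.+-identityʳ (one S.+ one) ⟩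
      one S.+ one                    SE.∎

  exp-logF : exp (logF τ τ) ≈ˢ V /ˢ Z
  exp-logF = ode-unique torsionFree E (exp (logF τ τ)) (V S.* W) (θ-deg0 (logF τ τ))
    (θ-exp (logF τ τ) (logF-no-constant τ τ) (λ _ _ → *-comm _ _)) θ-quotient e₀
    where
    e₀ : ∀ α → deg α ≡ 0 → exp (logF τ τ) α ≈ (V S.* W) α
    e₀ (zero ∷ []) _ = KE.begin
      exp (logF τ τ) (0 ∷ [])                    KE.≈⟨ exp-deg0 (logF τ τ) (0 ∷ []) ≡.refl ⟩
      1#                                         KE.≈⟨ *-identityˡ 1# ⟨
      1# * 1#
        KE.≈⟨ *-cong (trans (+-congˡ KR.-0#≈0#) (+-identityʳ 1#)) (+-identityʳ 1#) ⟨
      V (0 ∷ []) * W (0 ∷ [])                    KE.≈⟨ +-identityʳ _ ⟨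
      (V S.* W) (0 ∷ [])                         KE.∎

  open Fock K using (F; module Scalar)

  F-equal : F τ τ Scalar.≈ˢ (Scalar.one Scalar.-ˢ Scalar.indeterminate) Scalar./ˢ
                            (Scalar.one Scalar.+ˢ Scalar.indeterminate)
  F-equal = exp-logF

-- The rational function field.

-- The two conditions on a polynomial ring can be checked on constant terms.
module PolynomialProperties (R : CommutativeRing c ℓ) where
  open CommutativeRing R
  open Polynomial R
  open RawMonoidDefs +-rawMonoid using () renaming (_×_ to _times_)
  open RawSemiringDefs (RawRing.rawSemiring rawRing) using (_^_)
  private
    module P = CommutativeRing polyRing
    open RawMonoidDefs P.+-rawMonoid using () renaming (_×_ to _timesₚ_)
    open RawSemiringDefs (RawRing.rawSemiring P.rawRing) using () renaming (_^_ to _^ₚ_)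

  coeff₀-* : ∀ f g → coeff (f *ₚ g) 0 ≈ coeff f 0 * coeff g 0
  coeff₀-* []      g = sym (zeroˡ _)
  coeff₀-* (a ∷ f) g = trans (coeff-+ (a · g) (0# ∷ f *ₚ g) 0)
    (trans (+-identityʳ _) (coeff-· a g 0))

  coeff₀-times : ∀ n → coeff (n timesₚ 1ₚ) 0 ≈ n times 1#
  coeff₀-times zero    = refl
  coeff₀-times (suc n) = trans (coeff-+ 1ₚ (n timesₚ 1ₚ) 0) (+-congˡ (coeff₀-times n))

  coeff₀-^ : ∀ f n → coeff (f ^ₚ n) 0 ≈ coeff f 0 ^ n
  coeff₀-^ f zero    = refl
  coeff₀-^ f (suc n) = trans (coeff₀-* f (f ^ₚ n)) (*-congˡ (coeff₀-^ f n))

  characteristic0 : Characteristic0 R → Characteristic0 polyRing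
  characteristic0 h n e = h n (trans (sym (coeff₀-times (suc n))) (at e 0))

  notRootOfUnity : ∀ f → NotRootOfUnity R (coeff f 0) → NotRootOfUnity polyRing f
  notRootOfUnity f h n e = h n (trans
    (sym (trans (coeff-+ 1ₚ (-ₚ (f ^ₚ n)) 0)
      (+-congˡ (trans (coeff-neg (f ^ₚ n) 0) (-‿cong (coeff₀-^ f n)))))) (at e 0))

-- The embedding of a domain in its field of fractions preserves both
-- conditions.
module FractionProperties (D : IntegralDomain c ℓ) where
  open IntegralDomain D
  open Fractions D
  private module F = Field fractionField
  open RawMonoidDefs +-rawMonoid using () renaming (_×_ to _times_)
  open RawSemiringDefs (RawRing.rawSemiring rawRing) using (_^_)

  embed-+ : ∀ x y → embed x +ᶠ embed y ≃ embed (x + y)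
  embed-+ x y = mk (*-cong (+-cong (*-identityʳ x) (*-identityʳ y)) (sym (*-identityˡ 1#)))

  embed-* : ∀ x y → embed x *ᶠ embed y ≃ embed (x * y)
  embed-* x y = mk (*-congˡ (sym (*-identityˡ 1#)))

  embed-fromℕ : ∀ n → F.fromℕ n ≃ embed (n times 1#)
  embed-fromℕ zero    = ≃-refl
  embed-fromℕ (suc n) = ≃-trans (+ᶠ-cong {embed 1#} ≃-refl (embed-fromℕ n)) (embed-+ 1# (n times 1#))

  embed-^ : ∀ x n → embed x F.^ n ≃ embed (x ^ n)
  embed-^ x zero    = ≃-refl
  embed-^ x (suc n) = ≃-trans (*ᶠ-cong {embed x} ≃-refl (embed-^ x n)) (embed-* x (x ^ n))

  embed-injective : ∀ x → embed x ≃ embed 0# → x ≈ 0#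
  embed-injective x = num≈0 {embed x}

  characteristic0 : Characteristic0 commutativeRing → Characteristic0 F.commutativeRing
  characteristic0 h n e = h n (embed-injective _ (≃-trans (≃-sym (embed-fromℕ (suc n))) e))

  notRootOfUnity : ∀ x → NotRootOfUnity commutativeRing x → NotRootOfUnity F.commutativeRing (embed x)
  notRootOfUnity x h n e = h n (embed-injective _ (≃-trans (≃-sym (≃-trans
    (+ᶠ-cong {embed 1#} ≃-refl (-ᶠ-cong (embed-^ x n))) (embed-+ 1# (- x ^ n)))) e))

ℚ-characteristic0 : Characteristic0 ℚ.+-*-commutativeRing
ℚ-characteristic0 n e = ℚ.<⇒≢ (positive n) (≡.sym e)
  where
  open CommutativeRing ℚ.+-*-commutativeRing using (+-rawMonoid)
  open RawMonoidDefs +-rawMonoid using () renaming (_×_ to _times_)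
  nonNegative : ∀ n → 0ℚ ℚ.≤ n times 1ℚ
  positive : ∀ n → 0ℚ ℚ.< suc n times 1ℚ
  positive n = ℚ.+-mono-<-≤ {0ℚ} {1ℚ} {0ℚ} {n times 1ℚ} (ℚ.positive⁻¹ 1ℚ) (nonNegative n)
  nonNegative zero    = ℚ.≤-refl
  nonNegative (suc n) = ℚ.<⇒≤ (positive n)

0-notRootOfUnity : (R : CommutativeRing c ℓ) → let open CommutativeRing R in
                   ¬ 1# ≈ 0# → NotRootOfUnity R 0#
0-notRootOfUnity R 1≉0 (suc n) e = 1≉0 (trans (sym (trans
  (+-congˡ (trans (-‿cong (zeroˡ (0# ^ n))) (RingProperties.-0#≈0# ring))) (+-identityʳ 1#))) e)
  where
  open CommutativeRing R
  open RawSemiringDefs (RawRing.rawSemiring rawRing) using (_^_)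

ℚ⟨t,s⟩-characteristic0 : Characteristic0 (Field.commutativeRing ℚ⟨t,s⟩)
ℚ⟨t,s⟩-characteristic0 = FractionProperties.characteristic0 ℚ[t][s]
  (PolynomialProperties.characteristic0 _ (PolynomialProperties.characteristic0 _ ℚ-characteristic0))

-- The constant term of t in ℚ[t] is 0, and 1 - 0 ^ n is 1 for n > 0.
t-notRootOfUnity : NotRootOfUnity (Field.commutativeRing ℚ⟨t,s⟩) t
t-notRootOfUnity = FractionProperties.notRootOfUnity ℚ[t][s] _
  (PolynomialProperties.notRootOfUnity (IntegralDomain.commutativeRing ℚ[t]) _
    (PolynomialProperties.notRootOfUnity (IntegralDomain.commutativeRing rationals) _
      (0-notRootOfUnity ℚ.+-*-commutativeRing (IntegralDomain.1≉0 rationals))))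

open Γ⟨t,s⟩ using (Y; F; normalOrdered; normalOrdered-finite; timesRatio; _⊗_; _≈ᴰ_)
open Γ⟨t,s⟩.Scalar using (_≈ˢ_; _+ˢ_; _-ˢ_; _/ˢ_; one; indeterminate)

theorem3p1 : (Y t ⊗ Y s ≈ᴰ timesRatio (F t s) (normalOrdered t s) (normalOrdered-finite (F t s) t s))
    × (F t t ≈ˢ (one -ˢ indeterminate) /ˢ (one +ˢ indeterminate))
theorem3p1 =
  VertexOperators.Y-product ℚ⟨t,s⟩ ℚ⟨t,s⟩-characteristic0 t s t-notRootOfUnity ,
  EqualParameters.F-equal ℚ⟨t,s⟩ ℚ⟨t,s⟩-characteristic0 t t-notRootOfUnity
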